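{- Let $p$ be a prime with $p \equiv 5 \pmod{6}$. Then for all integers $\alpha \geq 0$ and $n \geq 0$, and for every integer $i$ with $1 \leq i \leq p-1$, $$\mathrm{RD}^{(4,9)}\left(6p^{2\alpha+1}(pn+i) + 3p^{2\alpha+2} + 1\right) \equiv 0 \pmod{12}.$$
   Context: For a nonnegative integer $n$, $\mathrm{RD}^{(4,9)}(n)$ denotes the number of partitions of $n$ into parts that are simultaneously 4-regular and 9-distinct, i.e., partitions of $n$ in which no part is divisible by $4$ and each distinct part appears at least once and at most $8$ times. Equivalently, writing $f_k = \prod_{m\ge1}(1-q^{km})$, $\sum_{n\ge0}\mathrm{RD}^{(4,9)}(n)q^n = \frac{f_9 f_4}{f_1 f_{36}}$. -}

module Defs where

open import Data.Nat using (ℕ; zero; suc; _+_; _*_; _∸_; _≤?_)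
open import Data.Nat.Divisibility using (_∣?_)
open import Data.List using (List; map; upTo)
open import Data.Nat.ListAction using (sum)
open import Relation.Nullary using (yes; no)

-- A partition of m is encoded by its multiplicity function: for each part
-- size k, the number of times k occurs.
-- cnt k m = number of partitions of m with all parts ≤ k, no part divisible
-- by 4, and each part occurring at most 8 times.
cnt : ℕ → ℕ → ℕ
cnt zero zero = 1
cnt zero (suc _) = 0
cnt (suc k) m with 4 ∣? suc k
... | yes _ = cnt k m
... | no _ = sum (map choose (upTo 9))
  where
  choose : ℕ → ℕ
  choose j with j * suc k ≤? m
  ... | yes _ = cnt k (m ∸ j * suc k)
  ... | no _ = 0

RD49 : ℕ → ℕ
RD49 n = cnt n n

{-# OPTIONS --safe #-}

-- Let f_k = ∏ (1 − q^{km}), φ(q) = ∑ q^{x²}, ψ(q) = ∑ q^{s(s+1)/2}, and let U extract the coefficients of q^{3m+1}.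
-- Gauss' products φ(−q) = f₁²/f₂ and ψ(q) = f₂²/f₁ turn ∑ RD(n) qⁿ = f₄f₉/(f₁f₃₆) into a theta quotient whose
-- trisection is elementary. Modulo 4 the series is ψ(q) φ(−q²) f₉/f₃₆ because φ(−q²)² ≡ 1, and U gives
-- ∑ RD(3m+1) q^m ≡ 1. Modulo 3 it is φ(−q)² φ(q) f₉f₁₂/(f₃f₆f₃₆) because f_k³ ≡ f_{3k}; with
-- Ω(q) = ∑ q^{3x²+2x}, the identity Ω(q) φ(−q³) + Ω(−q) φ(q³) = 2 f₄² (the rotation (i , j) ↦ (i + j , i − j)
-- of ℤ² together with the pentagonal number theorem) gives ∑ RD(3m+1) q^m ≡ φ(−q) φ(−q³).
-- The index in the theorem is 3m + 1 where p ≡ 2 (mod 3) divides m to an odd power, so m ≠ x² + 3y².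
module Submission where

open import Defs
open import Algebra.Bundles using (CommutativeRing)
open import Algebra.Solver.Ring.AlmostCommutativeRing
  using (AlmostCommutativeRing; fromCommutativeRing; _-Raw-AlmostCommutative⟶_)
import Algebra.Solver.Ring
open import Data.Empty using (⊥)
open import Data.Integer as ℤ using (ℤ; +_; -[1+_]; +[1+_]; _+_; _*_; _-_; -_; 0ℤ; 1ℤ; ∣_∣)
import Data.Integer.Properties as ℤₚ
open import Data.Integer.Tactic.RingSolver using (solve-∀)
open import Data.List using ([]; _∷_; map; upTo)
open import Data.Maybe using (Maybe; just; nothing)
open import Data.Nat as ℕ using (ℕ; zero; suc; z≤n; s≤s; _≤_; _<_; _^_; _%_; _!)
open import Data.Nat.Combinatorics
  using (_C_; nCk≡n!/k![n-k]!; k![n∸k]!∣n!; k>n⇒nCk≡0; nCn≡1; nCk≡nC[n∸k]; nCk+nC[k+1]≡[n+1]C[k+1])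
open import Data.Nat.Coprimality using (coprime-divisor; coprime?)
open import Data.Nat.Divisibility
  using (_∣_; _∤_; _∣?_; divides; ∣-trans; ∣⇒≤; ∣m∣n⇒∣m+n; ∣m+n∣m⇒∣n; m∣m*n; n∣m*n)
open import Data.Nat.DivMod using (m/n*n≡m; m≡m%n+[m/n]*n)
open import Data.Nat.ListAction using (sum)
open import Data.Nat.Primality using (Prime; prime⇒nonZero; prime⇒nonTrivial; euclidsLemma)
import Data.Nat.Properties as ℕₚ
open import Data.Nat.Properties using (_!*_!≢0)
open import Data.Nat.Tactic.RingSolver using () renaming (solve to ℕ-solve; solve-∀ to ℕ-solve-∀)
open import Data.Product using (∃; _×_; _,_)
open import Data.Sum using (_⊎_; inj₁; inj₂)
open import Level using (0ℓ)
open import Relation.Binary.PropositionalEquality as ≡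
  using (_≡_; _≢_; refl; cong; cong₂; subst; module ≡-Reasoning)
open import Relation.Nullary using (Dec; yes; no; ¬_; contradiction)
open import Relation.Nullary.Decidable using (from-yes)

-- Formal power series

-- Quotients of eta products are never formed: identities are cross-multiplied, and common factors
-- with constant coefficient 1 are cancelled. Infinite products and sums enter through finite stages
-- whose coefficients stabilise, so each analytic identity becomes an algebraic one between stages
-- plus an estimate of orders. One finite recurrence with a free parameter takes the place of the
-- Jacobi triple product. Ω originates in (3x + 1)² = 1 + 3(3x² + 2x), which gives φ(-q) = φ(-q⁹) -
-- 2qΩ(-q³) and φ(q) = φ(q⁹) + 2qΩ(q³). In φ(-q)²φ(q) the part with exponents ≡ 1 (mod 3) then
-- carries the coefficients 2 and -4. They agree modulo 3, and this is what lets the two terms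
-- combine into the left side of the identity for Ω. The modulus is a parameter `d` of the ring of
-- series because both halves of the argument rest on the same exact identities and part ways only
-- with the relations 4 ≈ 0 and 3 ≈ 0.

Series : Set
Series = ℕ → ℤ

const : ℤ → Series
const c zero = c
const c (suc n) = 0ℤ

tail : Series → Series
tail a n = a (suc n)

infixl 6 _⊕_
infixl 7 _⊛_
infix 8 ⊖_

_⊕_ : Series → Series → Series
(a ⊕ b) n = a n + b n

⊖_ : Series → Series
(⊖ a) n = - a n

-- Cauchy product, unfolded from a(q) = a(0) + q · (`tail a`)(q), so that no sum over pairs of
-- indices occurs.
_⊛_ : Series → Series → Series
(a ⊛ b) zero = a 0 * b 0
(a ⊛ b) (suc n) = a 0 * b (suc n) + (tail a ⊛ b) n

q^_ : ℕ → Series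
(q^ zero) = const 1ℤ
(q^ suc e) zero = 0ℤ
(q^ suc e) (suc n) = (q^ e) n

-- Congruence of integers, series and truncated series

module Mod (d : ℕ) where

  infix 4 _~_ _≈_ _≈[_]_

  record _~_ (x y : ℤ) : Set where
    constructor mk~
    field
      quot : ℤ
      equation : x ≡ y + + d * quot

  ~-reflexive : ∀ {x y} → x ≡ y → x ~ y
  ~-reflexive {x} refl = mk~ 0ℤ (lemma x (+ d))
    where
    lemma : ∀ x d → x ≡ x + d * 0ℤ
    lemma = solve-∀

  ~-refl : ∀ {x} → x ~ x
  ~-refl = ~-reflexive refl

  ~-sym : ∀ {x y} → x ~ y → y ~ x
  ~-sym {x} {y} (mk~ q refl) = mk~ (- q) (lemma y (+ d) q)
    where
    lemma : ∀ y d q → y ≡ y + d * q + d * (- q)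
    lemma = solve-∀

  ~-trans : ∀ {x y z} → x ~ y → y ~ z → x ~ z
  ~-trans {z = z} (mk~ q refl) (mk~ r refl) = mk~ (r + q) (lemma z (+ d) q r)
    where
    lemma : ∀ z d q r → z + d * r + d * q ≡ z + d * (r + q)
    lemma = solve-∀

  ~-+ : ∀ {x y u v} → x ~ y → u ~ v → x + u ~ y + v
  ~-+ {y = y} {v = v} (mk~ q refl) (mk~ r refl) = mk~ (q + r) (lemma y v (+ d) q r)
    where
    lemma : ∀ y v d q r → (y + d * q) + (v + d * r) ≡ (y + v) + d * (q + r)
    lemma = solve-∀

  ~-* : ∀ {x y u v} → x ~ y → u ~ v → x * u ~ y * v
  ~-* {y = y} {v = v} (mk~ q refl) (mk~ r refl) = mk~ (q * v + y * r + + d * q * r) (lemma y v (+ d) q r)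
    where
    lemma : ∀ y v d q r → (y + d * q) * (v + d * r) ≡ y * v + d * (q * v + y * r + d * q * r)
    lemma = solve-∀

  ~-neg : ∀ {x y} → x ~ y → - x ~ - y
  ~-neg {y = y} (mk~ q refl) = mk~ (- q) (lemma y (+ d) q)
    where
    lemma : ∀ y d q → - (y + d * q) ≡ - y + d * (- q)
    lemma = solve-∀

  ~0⇒∣ : ∀ {x} → x ~ 0ℤ → d ∣ ∣ x ∣
  ~0⇒∣ {x} (mk~ k eq) = divides ∣ k ∣ (≡.trans (cong ∣_∣ (≡.trans eq (ℤₚ.+-identityˡ (+ d * k))))
    (≡.trans (ℤₚ.abs-* (+ d) k) (ℕₚ.*-comm d ∣ k ∣)))

  record _≈_ (a b : Series) : Set where
    constructor mk≈
    field
      at : ∀ n → a n ~ b n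
  open _≈_ public

  record _≈[_]_ (a : Series) (N : ℕ) (b : Series) : Set where
    constructor trunc
    field
      upto : ∀ {n} → n ≤ N → a n ~ b n
  open _≈[_]_ public

  from≡ : ∀ {a b} → (∀ n → a n ≡ b n) → a ≈ b
  from≡ eq = mk≈ λ n → ~-reflexive (eq n)

  ≈-refl : ∀ {a} → a ≈ a
  ≈-refl = mk≈ λ n → ~-refl

  ≈-sym : ∀ {a b} → a ≈ b → b ≈ a
  ≈-sym e = mk≈ λ n → ~-sym (at e n)

  ≈-trans : ∀ {a b c} → a ≈ b → b ≈ c → a ≈ c
  ≈-trans e f = mk≈ λ n → ~-trans (at e n) (at f n)

  ⊕-cong : ∀ {a b u v} → a ≈ b → u ≈ v → a ⊕ u ≈ b ⊕ v
  ⊕-cong e f = mk≈ λ n → ~-+ (at e n) (at f n)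

  ⊖-cong : ∀ {a b} → a ≈ b → ⊖ a ≈ ⊖ b
  ⊖-cong e = mk≈ λ n → ~-neg (at e n)

  -- Coefficient `n` of a product involves only the coefficients up to `n` of its factors. This
  -- serves congruences of whole series and of truncations alike.
  ⊛-cong-at : ∀ n {a b u v} → (∀ {m} → m ≤ n → a m ~ b m) → (∀ {m} → m ≤ n → u m ~ v m) → (a ⊛ u) n ~ (b ⊛ v) n
  ⊛-cong-at zero e f = ~-* (e z≤n) (f z≤n)
  ⊛-cong-at (suc n) e f =
    ~-+ (~-* (e z≤n) (f ℕₚ.≤-refl)) (⊛-cong-at n (λ m≤n → e (s≤s m≤n)) (λ m≤n → f (ℕₚ.m≤n⇒m≤1+n m≤n)))

  ⊛-cong : ∀ {a b u v} → a ≈ b → u ≈ v → a ⊛ u ≈ b ⊛ v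
  ⊛-cong e f = mk≈ λ n → ⊛-cong-at n (λ _ → at e _) (λ _ → at f _)

⊛-distribʳ : ∀ c a b n → ((a ⊕ b) ⊛ c) n ≡ (a ⊛ c) n + (b ⊛ c) n
⊛-distribʳ c a b zero = ℤₚ.*-distribʳ-+ (c 0) (a 0) (b 0)
⊛-distribʳ c a b (suc n) rewrite ⊛-distribʳ c (tail a) (tail b) n = lemma (a 0) (b 0) (c (suc n)) _ _
  where
  lemma : ∀ a b c x y → (a + b) * c + (x + y) ≡ (a * c + x) + (b * c + y)
  lemma = solve-∀

-- Mirror image of the defining recursion, with the constant term of the right factor split off;
-- commutativity is then a plain induction.
⊛-sucʳ : ∀ a b n → (a ⊛ b) (suc n) ≡ a (suc n) * b 0 + (a ⊛ tail b) n
⊛-sucʳ a b zero = ℤₚ.+-comm (a 0 * b 1) (a 1 * b 0)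
⊛-sucʳ a b (suc n) rewrite ⊛-sucʳ (tail a) b n = lemma (a 0 * b (suc (suc n))) (a (suc (suc n)) * b 0) _
  where
  lemma : ∀ x y z → x + (y + z) ≡ y + (x + z)
  lemma = solve-∀

⊛-comm : ∀ a b n → (a ⊛ b) n ≡ (b ⊛ a) n
⊛-comm a b zero = ℤₚ.*-comm (a 0) (b 0)
⊛-comm a b (suc n) rewrite ⊛-sucʳ b a n | ⊛-comm (tail a) b n = cong (_+ (b ⊛ tail a) n) (ℤₚ.*-comm (a 0) (b (suc n)))

scale-⊛ : ∀ x a b n → ((λ m → x * a m) ⊛ b) n ≡ x * (a ⊛ b) n
scale-⊛ x a b zero = ℤₚ.*-assoc x (a 0) (b 0)
scale-⊛ x a b (suc n) rewrite scale-⊛ x (tail a) b n = lemma x (a 0) (b (suc n)) _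
  where
  lemma : ∀ x a b z → x * a * b + x * z ≡ x * (a * b + z)
  lemma = solve-∀

⊛-assoc : ∀ a b c n → ((a ⊛ b) ⊛ c) n ≡ (a ⊛ (b ⊛ c)) n
⊛-assoc a b c zero = ℤₚ.*-assoc (a 0) (b 0) (c 0)
⊛-assoc a b c (suc n) = begin
  a 0 * b 0 * c (suc n) + (((λ m → a 0 * tail b m) ⊕ (tail a ⊛ b)) ⊛ c) n
    ≡⟨ cong (λ x → a 0 * b 0 * c (suc n) + x) (⊛-distribʳ c (λ m → a 0 * tail b m) (tail a ⊛ b) n) ⟩
  a 0 * b 0 * c (suc n) + (((λ m → a 0 * tail b m) ⊛ c) n + ((tail a ⊛ b) ⊛ c) n)
    ≡⟨ cong₂ (λ x y → a 0 * b 0 * c (suc n) + (x + y)) (scale-⊛ (a 0) (tail b) c n) (⊛-assoc (tail a) b c n) ⟩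
  a 0 * b 0 * c (suc n) + (a 0 * (tail b ⊛ c) n + (tail a ⊛ (b ⊛ c)) n)
    ≡⟨ lemma (a 0) (b 0) (c (suc n)) _ _ ⟩
  a 0 * (b 0 * c (suc n) + (tail b ⊛ c) n) + (tail a ⊛ (b ⊛ c)) n ∎
  where
  open ≡-Reasoning
  lemma : ∀ a b c x y → a * b * c + (a * x + y) ≡ a * (b * c + x) + y
  lemma = solve-∀

0-⊛ : ∀ {a} b n → (∀ m → a m ≡ 0ℤ) → (a ⊛ b) n ≡ 0ℤ
0-⊛ b zero a≡0 rewrite a≡0 0 = refl
0-⊛ b (suc n) a≡0 rewrite a≡0 0 | 0-⊛ b n (λ m → a≡0 (suc m)) = refl

const-⊛ : ∀ c a n → (const c ⊛ a) n ≡ c * a n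
const-⊛ c a zero = refl
const-⊛ c a (suc n) rewrite 0-⊛ a n (λ m → refl {x = tail (const c) m}) = ℤₚ.+-identityʳ _

⊛-identityˡ : ∀ a n → (const 1ℤ ⊛ a) n ≡ a n
⊛-identityˡ a n = ≡.trans (const-⊛ 1ℤ a n) (ℤₚ.*-identityˡ (a n))

module Ring (d : ℕ) where
  open Mod d public

  series : CommutativeRing 0ℓ 0ℓ
  series = record
    { Carrier = Series ; _≈_ = _≈_ ; _+_ = _⊕_ ; _*_ = _⊛_ ; -_ = ⊖_ ; 0# = const 0ℤ ; 1# = const 1ℤ
    ; isCommutativeRing = record
      { isRing = record
        { +-isAbelianGroup = record
          { isGroup = record
            { isMonoid = record
              { isSemigroup = record
                { isMagma = record
                  { isEquivalence = record { refl = ≈-refl ; sym = ≈-sym ; trans = ≈-trans }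
                  ; ∙-cong = ⊕-cong }
                ; assoc = λ a b c → from≡ λ n → ℤₚ.+-assoc (a n) (b n) (c n) }
              ; identity = (λ a → from≡ λ { zero → ℤₚ.+-identityˡ _ ; (suc n) → ℤₚ.+-identityˡ _ })
                         , (λ a → from≡ λ { zero → ℤₚ.+-identityʳ _ ; (suc n) → ℤₚ.+-identityʳ _ }) }
            ; inverse = (λ a → from≡ λ { zero → ℤₚ.+-inverseˡ (a 0) ; (suc n) → ℤₚ.+-inverseˡ (a (suc n)) })
                      , (λ a → from≡ λ { zero → ℤₚ.+-inverseʳ (a 0) ; (suc n) → ℤₚ.+-inverseʳ (a (suc n)) })
            ; ⁻¹-cong = ⊖-cong }
          ; comm = λ a b → from≡ λ n → ℤₚ.+-comm (a n) (b n) }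
        ; *-cong = ⊛-cong
        ; *-assoc = λ a b c → from≡ (⊛-assoc a b c)
        ; *-identity = (λ a → from≡ (⊛-identityˡ a)) , (λ a → from≡ λ n → ≡.trans (⊛-comm a (const 1ℤ) n) (⊛-identityˡ a n))
        ; distrib = (λ a b c → from≡ λ n → ≡.trans (⊛-comm a (b ⊕ c) n) (≡.trans (⊛-distribʳ a b c n) (cong₂ _+_ (⊛-comm b a n)
            (⊛-comm c a n))))
                  , (λ a b c → from≡ (⊛-distribʳ a b c)) }
      ; *-comm = λ a b → from≡ (⊛-comm a b) } }

  private
    almost : AlmostCommutativeRing 0ℓ 0ℓ
    almost = fromCommutativeRing series

    constants : CommutativeRing.rawRing ℤₚ.+-*-commutativeRing -Raw-AlmostCommutative⟶ almost
    constants = record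
      { ⟦_⟧ = const
      ; +-homo = λ x y → from≡ λ { zero → refl ; (suc n) → refl }
      ; *-homo = λ x y → from≡ λ { zero → refl ; (suc n) → ≡.sym (≡.trans (const-⊛ x (const y) (suc n)) (ℤₚ.*-zeroʳ x)) }
      ; -‿homo = λ x → from≡ λ { zero → refl ; (suc n) → refl }
      ; 0-homo = ≈-refl
      ; 1-homo = ≈-refl }

    -- Numerals are compared as integers and not modulo `d`. What the solver proves therefore holds
    -- for every `d`, and a relation such as 3 ≈ 0 has to be supplied as a hypothesis.
    const-≟ : ∀ x y → Maybe (const x ≈ const y)
    const-≟ x y with x ℤ.≟ y
    ... | yes refl = just ≈-refl
    ... | no _ = nothing

  module Solver = Algebra.Solver.Ring (CommutativeRing.rawRing ℤₚ.+-*-commutativeRing) almost constants const-≟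

-- Truncation and limits

-- The diagonal is the limit once coefficient `n` no longer changes from stage `n` on, which is the
-- condition `Converges` below.
lim : (ℕ → Series) → Series
lim A n = A n n

sumℕ : ℕ → (ℕ → ℤ) → ℤ
sumℕ zero h = h 0
sumℕ (suc n) h = sumℕ n h + h (suc n)

Σℕ : ℕ → (ℕ → Series) → Series
Σℕ n h m = sumℕ n λ s → h s m

sumℤ : ℕ → (ℤ → ℤ) → ℤ
sumℤ zero h = h 0ℤ
sumℤ (suc n) h = sumℤ n h + (h +[1+ n ] + h -[1+ n ])

Σℤ : ℕ → (ℤ → Series) → Series
Σℤ n h m = sumℤ n λ x → h x m

_⟨q³⟩ : Series → Series
(a ⟨q³⟩) 0 = a 0
(a ⟨q³⟩) 1 = 0ℤ
(a ⟨q³⟩) 2 = 0ℤ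
(a ⟨q³⟩) (suc (suc (suc n))) = (tail a ⟨q³⟩) n

third : Series → Series
third a m = a (suc (m ℕ.* 3))

Π : ℕ → ℕ → Series
Π c zero = const 1ℤ
Π c (suc n) = Π c n ⊛ (const 1ℤ ⊕ ⊖ q^ (c ℕ.* suc n))

-- The product f_c. For c ≥ 1 the factors missing from `Π c n` are 1 up to q^n, so the diagonal is
-- exact.
η : ℕ → Series
η c = lim (Π c)

const-0 : ∀ n → const 0ℤ n ≡ 0ℤ
const-0 zero = refl
const-0 (suc n) = refl

q^-below : ∀ e n → n < e → (q^ e) n ≡ 0ℤ
q^-below (suc e) zero n<e = refl
q^-below (suc e) (suc n) (s≤s n<e) = q^-below e n n<e

module Basic (d : ℕ) where
  open Ring d public
  open Solver public using (solve; _:=_; _:+_; _:*_; con; :-_)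
  open CommutativeRing series public using (setoid)
  open import Relation.Binary.Reasoning.Setoid setoid public

  infixl 6 _⟨+⟩_
  infixl 7 _⟨*⟩_

  _⟨+⟩_ : ∀ {a b u v} → a ≈ b → u ≈ v → a ⊕ u ≈ b ⊕ v
  _⟨+⟩_ = ⊕-cong

  _⟨*⟩_ : ∀ {a b u v} → a ≈ b → u ≈ v → a ⊛ u ≈ b ⊛ v
  _⟨*⟩_ = ⊛-cong

  -- Main tool for algebra under hypotheses: the difference L - R changes by a multiple `k` of a
  -- known relation. A chain of `linear` writes L - R as a combination of hypotheses with explicit
  -- cofactors, and the ring solver checks the identity that remains.
  linear : ∀ {L R l r} k → l ≈ r → L ⊕ k ⊛ r ≈ R ⊕ k ⊛ l → L ≈ R
  linear {L} {R} {l} {r} k l≈r eq = begin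
    L                        ≈⟨ solve 2 (λ L r → L := L :+ r :+ :- r) ≈-refl L (k ⊛ r) ⟩
    L ⊕ k ⊛ r ⊕ ⊖ (k ⊛ r)    ≈⟨ eq ⟨+⟩ ⊖-cong (≈-refl ⟨*⟩ ≈-sym l≈r) ⟩
    R ⊕ k ⊛ l ⊕ ⊖ (k ⊛ l)    ≈⟨ solve 2 (λ L r → L :+ r :+ :- r := L) ≈-refl R (k ⊛ l) ⟩
    R                        ∎

  q^-+ : ∀ a b → q^ (a ℕ.+ b) ≈ q^ a ⊛ q^ b
  q^-+ a b = from≡ (go a)
    where
    go : ∀ a n → (q^ (a ℕ.+ b)) n ≡ (q^ a ⊛ q^ b) n
    go zero n = ≡.sym (⊛-identityˡ (q^ b) n)
    go (suc a) zero = refl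
    go (suc a) (suc n) = ≡.trans (go a n) (≡.sym (ℤₚ.+-identityˡ _))

  q^-≡ : ∀ {a b} → a ≡ b → q^ a ≈ q^ b
  q^-≡ refl = ≈-refl

  q^-split : ∀ {e} a b → e ≡ a ℕ.+ b → q^ e ≈ q^ a ⊛ q^ b
  q^-split a b refl = q^-+ a b

  ≈⇒trunc : ∀ {a b N} → a ≈ b → a ≈[ N ] b
  ≈⇒trunc e = trunc λ _ → at e _

  trunc⇒≈ : ∀ {a b} → (∀ N → a ≈[ N ] b) → a ≈ b
  trunc⇒≈ e = mk≈ λ n → upto (e n) ℕₚ.≤-refl

  trunc-sym : ∀ {a b N} → a ≈[ N ] b → b ≈[ N ] a
  trunc-sym e = trunc λ n≤N → ~-sym (upto e n≤N)

  trunc-trans : ∀ {a b c N} → a ≈[ N ] b → b ≈[ N ] c → a ≈[ N ] c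
  trunc-trans e f = trunc λ n≤N → ~-trans (upto e n≤N) (upto f n≤N)

  trunc-⊕ : ∀ {a b u v N} → a ≈[ N ] b → u ≈[ N ] v → a ⊕ u ≈[ N ] b ⊕ v
  trunc-⊕ e f = trunc λ n≤N → ~-+ (upto e n≤N) (upto f n≤N)

  trunc-⊖ : ∀ {a b N} → a ≈[ N ] b → ⊖ a ≈[ N ] ⊖ b
  trunc-⊖ e = trunc λ n≤N → ~-neg (upto e n≤N)

  trunc-⊛ : ∀ {a b u v N} → a ≈[ N ] b → u ≈[ N ] v → a ⊛ u ≈[ N ] b ⊛ v
  trunc-⊛ e f = trunc λ {n} n≤N → ⊛-cong-at n (λ m≤n → upto e (ℕₚ.≤-trans m≤n n≤N)) (λ m≤n → upto f (ℕₚ.≤-trans m≤n n≤N))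

  q^-trunc : ∀ {e N} → N < e → q^ e ≈[ N ] const 0ℤ
  q^-trunc {e} N<e = trunc λ {n} n≤N → ~-reflexive (≡.trans (q^-below e n (ℕₚ.≤-<-trans n≤N N<e)) (≡.sym (const-0 n)))

  ⊛q^-trunc : ∀ {e N} a → N < e → a ⊛ q^ e ≈[ N ] const 0ℤ
  ⊛q^-trunc a N<e =
    trunc-trans (trunc-⊛ (≈⇒trunc (≈-refl {a})) (q^-trunc N<e)) (≈⇒trunc (solve 1 (λ a → a :* con 0ℤ := con 0ℤ) ≈-refl a))

  Converges : (ℕ → Series) → Set
  Converges A = ∀ n → A (suc n) ≈[ n ] A n

  -- Any stage from `N` on may stand for the limit, so the objects in one identity can be cut at
  -- different stages, for instance at N and at 4N.
  lim-trunc : ∀ {A N n} → Converges A → N ≤ n → lim A ≈[ N ] A n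
  lim-trunc {A} conv N≤n = trunc λ m≤N → go (ℕₚ.≤⇒≤′ (ℕₚ.≤-trans m≤N N≤n))
    where
    go : ∀ {m n} → m ℕ.≤′ n → A m m ~ A n m
    go ℕ.≤′-refl = ~-refl
    go (ℕ.≤′-step m≤n) = ~-trans (go m≤n) (~-sym (upto (conv _) (ℕₚ.≤′⇒≤ m≤n)))

  Π-converges : ∀ c .{{_ : ℕ.NonZero c}} → Converges (Π c)
  Π-converges c n = trunc-trans
    (trunc-⊛ (≈⇒trunc (≈-refl {Π c n})) (trunc-⊕ (≈⇒trunc (≈-refl {const 1ℤ})) (trunc-⊖ (q^-trunc (ℕₚ.m≤n*m (suc n) c)))))
    (≈⇒trunc (solve 1 (λ a → a :* (con 1ℤ :+ :- con 0ℤ) := a) ≈-refl (Π c n)))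

  η-trunc : ∀ c .{{_ : ℕ.NonZero c}} {N n} → N ≤ n → η c ≈[ N ] Π c n
  η-trunc c = lim-trunc (Π-converges c)

  -- Holds for composite `d` too: if a · z vanishes, its constant coefficient gives z(0) ~ 0, and
  -- then a · `tail z` vanishes by `⊛-sucʳ`, so the coefficients of z disappear one after another.
  ⊛-cancelˡ : ∀ {a b c} → a 0 ≡ 1ℤ → a ⊛ b ≈ a ⊛ c → b ≈ c
  ⊛-cancelˡ {a} {b} {c} a₀ eq = linear (const 1ℤ) (mk≈ (λ n → vanish n (b ⊕ ⊖ c) prod))
      (solve 2 (λ b c → b :+ con 1ℤ :* con 0ℤ := c :+ con 1ℤ :* (b :+ :- c)) ≈-refl b c)
    where
    prod : a ⊛ (b ⊕ ⊖ c) ≈ const 0ℤ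
    prod = linear (const 1ℤ) eq (solve 3 (λ a b c → a :* (b :+ :- c) :+ con 1ℤ :* (a :* c) := con 0ℤ :+ con 1ℤ :*
        (a :* b)) ≈-refl a b c)

    vanish : ∀ n z → a ⊛ z ≈ const 0ℤ → z n ~ const 0ℤ n
    vanish zero z az = ~-trans (~-reflexive (≡.sym (≡.trans (cong (_* z 0) a₀) (ℤₚ.*-identityˡ (z 0))))) (at az 0)
    vanish (suc n) z az = ~-trans (vanish n (tail z) (mk≈ tail-az)) (~-reflexive (const-0 n))
      where
      lemma : ∀ x y → x ≡ y + x + - y
      lemma = solve-∀
      tail-az : ∀ n → (a ⊛ tail z) n ~ const 0ℤ n
      tail-az n = ~-trans (~-reflexive (≡.trans (lemma ((a ⊛ tail z) n) (a (suc n) * z 0)) (cong (_- (a (suc n) * z 0))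
          (≡.sym (⊛-sucʳ a z n)))))
        (~-trans (~-+ (at az (suc n)) (~-neg (~-* (~-refl {a (suc n)}) (vanish 0 z az))))
            (~-reflexive (≡.trans (cong (λ x → 0ℤ - x) (ℤₚ.*-zeroʳ (a (suc n)))) (≡.sym (const-0 n)))))

-- H n j = ∑_{s≤j} W(s) Q^{sn} ∏_{s<k≤j} (1 − Q^k) and W(s) = ∏_{1≤k≤s} (x − Q^k), where Q = q^c.
-- Only s = 0 contributes below q^n, so H n n tends to ∏ (1 − Q^k), while H-step makes it satisfy a first-order
-- recurrence in n solved by partial sums of theta series: x = 0 gives Euler's pentagonal number theorem,
-- x = −Q Gauss' product for φ(−Q), and x = q, Q = q² Gauss' product for ψ(q).
module Gauss (d c : ℕ) (x : Series) where
  open Basic d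

  Q^ : ℕ → Series
  Q^ n = q^ (c ℕ.* n)

  W : ℕ → Series
  W zero = const 1ℤ
  W (suc s) = (x ⊕ ⊖ Q^ (suc s)) ⊛ W s

  H : ℕ → ℕ → Series
  H n zero = const 1ℤ
  H n (suc j) = H n j ⊛ (const 1ℤ ⊕ ⊖ Q^ (suc j)) ⊕ W (suc j) ⊛ Q^ (suc j ℕ.* n)

  Q^-+ : ∀ {e} a b → e ≡ a ℕ.+ b → Q^ e ≈ Q^ a ⊛ Q^ b
  Q^-+ a b refl = q^-split (c ℕ.* a) (c ℕ.* b) (ℕₚ.*-distribˡ-+ c a b)

  -- Telescoping in `j`: the last term is what the sum, cut off at `j`, leaves over. Adding one more
  -- summand moves this remainder one place on, because Q^(m+1) · Q^(i+1) = Q^m · Q^(i+2).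
  H-step : ∀ m j → (const 1ℤ ⊕ ⊖ Q^ (suc m)) ⊛ H (suc m) j ≈ (const 1ℤ ⊕ ⊖ (x ⊛ Q^ m)) ⊛ H m j ⊕ W (suc j) ⊛ Q^ (suc j ℕ.* m)
  H-step m zero =
    linear (⊖ const 1ℤ) (Q^-+ {suc m} 1 m refl)
    (linear (Q^ 1 ⊕ ⊖ x) (q^-≡ (cong (c ℕ.*_) (ℕₚ.+-identityʳ m)))
    (solve 5 (λ x Qs q C E → (con 1ℤ :+ :- Qs) :* con 1ℤ :+ (:- con 1ℤ) :* (q :* C) :+ (q :+ :- x) :* C
       := ((con 1ℤ :+ :- (x :* C)) :* con 1ℤ :+ ((x :+ :- q) :* con 1ℤ) :* E) :+ (:- con 1ℤ) :* Qs :+ (q :+ :- x) :* E)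
      ≈-refl x (Q^ (suc m)) (Q^ 1) (Q^ m) (Q^ (1 ℕ.* m))))
  H-step m (suc i) =
    linear (const 1ℤ ⊕ ⊖ B) (H-step m i)
    (linear ((const 1ℤ ⊕ ⊖ Q^ (suc m)) ⊛ w) (Q^-+ (suc i) (suc i ℕ.* m) (ℕₚ.*-suc (suc i) m))
    (linear (⊖ ((x ⊕ ⊖ Q^ (suc (suc i))) ⊛ w)) (Q^-+ m (suc i ℕ.* m) refl)
    (linear (⊖ (w ⊛ A ⊛ B)) (Q^-+ {suc m} 1 m refl)
    (linear (w ⊛ A ⊛ Q^ m) (Q^-+ {suc (suc i)} 1 (suc i) refl)
    (solve 12 (λ x Qs q C h₁ h₀ w B P A B₂ E →
       (con 1ℤ :+ :- Qs) :* (h₁ :* (con 1ℤ :+ :- B) :+ w :* P)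
         :+ (con 1ℤ :+ :- B) :* ((con 1ℤ :+ :- (x :* C)) :* h₀ :+ w :* A)
         :+ ((con 1ℤ :+ :- Qs) :* w) :* (B :* A)
         :+ (:- ((x :+ :- B₂) :* w)) :* (C :* A)
         :+ (:- (w :* A :* B)) :* (q :* C)
         :+ (w :* A :* C) :* (q :* B)
       := (con 1ℤ :+ :- (x :* C)) :* (h₀ :* (con 1ℤ :+ :- B) :+ w :* A) :+ ((x :+ :- B₂) :* w) :* E
         :+ (con 1ℤ :+ :- B) :* ((con 1ℤ :+ :- Qs) :* h₁)
         :+ ((con 1ℤ :+ :- Qs) :* w) :* P
         :+ (:- ((x :+ :- B₂) :* w)) :* E
         :+ (:- (w :* A :* B)) :* Qs
         :+ (w :* A :* C) :* B₂)
      ≈-refl x (Q^ (suc m)) (Q^ 1) (Q^ m) (H (suc m) i) (H m i) w B (Q^ (suc i ℕ.* suc m)) A (Q^ (suc (suc i)))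
          (Q^ (suc (suc i) ℕ.* m)))))))
    where
    w = W (suc i)
    B = Q^ (suc i)
    A = Q^ (suc i ℕ.* m)

  -- The inequality is strict because the summand s = 1 carries `Q^ n`, whose order is exactly `n`
  -- when c = 1. Hence the stage `suc N` in the product formulas below.
  H-trunc : .{{_ : ℕ.NonZero c}} → ∀ {N n} → N < n → ∀ j → H n j ≈[ N ] Π c j
  H-trunc N<n zero = ≈⇒trunc ≈-refl
  H-trunc {N} {n} N<n (suc j) = trunc-trans
    (trunc-⊕ (trunc-⊛ (H-trunc N<n j) (≈⇒trunc ≈-refl)) (⊛q^-trunc (W (suc j)) (ℕₚ.≤-trans N<n (ℕₚ.≤-trans (ℕₚ.m≤n*m n (suc j))
        (ℕₚ.m≤n*m (suc j ℕ.* n) c)))))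
    (≈⇒trunc (solve 1 (λ a → a :+ con 0ℤ := a) ≈-refl (Π c (suc j))))

  module _ (T : ℕ → Series) (T-zero : T 0 ≈ const 1ℤ)
    (T-suc : ∀ m → T (suc m) ≈ (const 1ℤ ⊕ ⊖ (x ⊛ Q^ m)) ⊛ T m ⊕ W (suc m) ⊛ (Q^ (suc m ℕ.* m) ⊕ Q^ (suc m ℕ.* suc m))) where

    -- Passing from `H m m` to `H (suc m) (suc m)` creates two source terms: the remainder of
    -- `H-step`, with Q^((m+1)m), and the newly appended summand, with Q^((m+1)²). They become the
    -- two new theta terms of each step.
    T≈H : ∀ n → T n ≈ H n n
    T≈H zero = T-zero
    T≈H (suc m) =
      linear (const 1ℤ) (T-suc m)
      (linear (const 1ℤ ⊕ ⊖ (x ⊛ Q^ m)) (T≈H m)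
      (linear (⊖ const 1ℤ) (H-step m m)
      (solve 10 (λ T x C t w A P h h₁ B →
         T :+ con 1ℤ :* ((con 1ℤ :+ :- (x :* C)) :* t :+ w :* (A :+ P)) :+ (con 1ℤ :+ :- (x :* C)) :* h
           :+ (:- con 1ℤ) :* ((con 1ℤ :+ :- (x :* C)) :* h :+ w :* A)
         := (h₁ :* (con 1ℤ :+ :- B) :+ w :* P) :+ con 1ℤ :* T :+ (con 1ℤ :+ :- (x :* C)) :* t
           :+ (:- con 1ℤ) :* ((con 1ℤ :+ :- B) :* h₁))
        ≈-refl (T (suc m)) x (Q^ m) (T m) (W (suc m)) (Q^ (suc m ℕ.* m)) (Q^ (suc m ℕ.* suc m)) (H m m) (H (suc m) m)
            (Q^ (suc m)))))

    product : .{{_ : ℕ.NonZero c}} → ∀ {N n} → N < n → T n ≈[ N ] Π c n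
    product {n = n} N<n = trunc-trans (≈⇒trunc (T≈H n)) (H-trunc N<n n)

-- Theta series and their products

parity : ℕ → ℤ
parity zero = 1ℤ
parity (suc n) = - parity n

-- The character (-1)^x, not the sign of `x`.
sgn : ℤ → ℤ
sgn x = parity ∣ x ∣

one : ℤ → ℤ
one _ = 1ℤ

thetaTerm : (ℤ → ℤ) → (ℤ → ℕ) → ℤ → Series
thetaTerm ε e x = const (ε x) ⊛ q^ (e x)

-- Summation over all of ℤ. The bound ∣x∣ ≤ e(x), imposed where it is used, keeps terms outside
-- [-n, n] from reaching q^n.
theta : (ℤ → ℤ) → (ℤ → ℕ) → Series
theta ε e = lim λ n → Σℤ n (thetaTerm ε e)

square : ℕ → ℤ → ℕ
square c x = c ℕ.* (∣ x ∣ ℕ.* ∣ x ∣)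

φ₋ φ₊ : ℕ → Series
φ₋ c = theta sgn (square c)
φ₊ c = theta one (square c)

-- 6x² + 2x
pentagonal : ℤ → ℕ
pentagonal (+ n) = n ℕ.* (6 ℕ.* n ℕ.+ 2)
pentagonal -[1+ n ] = suc n ℕ.* (6 ℕ.* n ℕ.+ 4)

triangle : ℕ → ℕ
triangle zero = 0
triangle (suc n) = suc n ℕ.+ triangle n

ψ : Series
ψ = lim λ n → Σℕ n λ s → q^ (triangle s)

module Products (d : ℕ) where
  open Basic d

  trunc-absorb : ∀ {a b N} → b ≈[ N ] const 0ℤ → a ⊕ b ≈[ N ] a
  trunc-absorb {a} e = trunc-trans (trunc-⊕ (≈⇒trunc (≈-refl {a})) e) (≈⇒trunc (solve 1 (λ a → a :+ con 0ℤ := a) ≈-refl a))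

  Σℤ-converges : ∀ (ε : ℤ → ℤ) {e} → (∀ x → ∣ x ∣ ≤ e x) → Converges (λ n → Σℤ n (thetaTerm ε e))
  Σℤ-converges ε bound n = trunc-absorb (trunc-trans
    (trunc-⊕ (⊛q^-trunc (const (ε +[1+ n ])) (bound +[1+ n ])) (⊛q^-trunc (const (ε -[1+ n ])) (bound -[1+ n ])))
    (≈⇒trunc (solve 0 (con 0ℤ :+ con 0ℤ := con 0ℤ) ≈-refl)))

  theta-trunc : ∀ ε {e} → (∀ x → ∣ x ∣ ≤ e x) → ∀ {N n} → N ≤ n → theta ε e ≈[ N ] Σℤ n (thetaTerm ε e)
  theta-trunc ε bound = lim-trunc (Σℤ-converges ε bound)

  square-bound : ∀ c .{{_ : ℕ.NonZero c}} x → ∣ x ∣ ≤ square c x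
  square-bound c x = ℕₚ.≤-trans (n≤n*n ∣ x ∣) (ℕₚ.m≤n*m (∣ x ∣ ℕ.* ∣ x ∣) c)
    where
    n≤n*n : ∀ n → n ≤ n ℕ.* n
    n≤n*n zero = z≤n
    n≤n*n (suc n) = ℕₚ.m≤m*n (suc n) (suc n)

  pentagonal-bound : ∀ x → ∣ x ∣ ≤ pentagonal x
  pentagonal-bound (+ zero) = z≤n
  pentagonal-bound +[1+ n ] = ℕₚ.m≤m*n (suc n) (6 ℕ.* suc n ℕ.+ 2)
  pentagonal-bound -[1+ n ] = ℕₚ.m≤m*n (suc n) (6 ℕ.* n ℕ.+ 4) {{ℕ.>-nonZero (ℕₚ.≤-trans (s≤s z≤n) (ℕₚ.m≤n+m 4 (6 ℕ.* n)))}}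

  triangle-bound : ∀ n → n ≤ triangle n
  triangle-bound zero = z≤n
  triangle-bound (suc n) = ℕₚ.m≤m+n (suc n) (triangle n)

  ψ-converges : Converges (λ n → Σℕ n λ s → q^ (triangle s))
  ψ-converges n = trunc-absorb (q^-trunc (triangle-bound (suc n)))

  const-neg : ∀ x → const (- x) ≈ ⊖ const x
  const-neg x = from≡ λ { zero → refl ; (suc n) → refl }

  -- With x = 0 the product `W m` is the single term (-1)^m q^(2m(m+1)), and the two source terms
  -- complete its exponent to those at m + 1 and -(m + 1). Base Q = q⁴ turns (3x² + x)/2 into 6x² +
  -- 2x, the exponent that the rotation of ℤ² produces later.
  euler : η 4 ≈ theta sgn pentagonal
  euler = trunc⇒≈ λ N → trunc-trans (η-trunc 4 (ℕₚ.n≤1+n N)) (trunc-trans (trunc-sym (product T ≈-unit T-suc ℕₚ.≤-refl))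
      (trunc-sym (theta-trunc sgn pentagonal-bound (ℕₚ.n≤1+n N))))
    where
    open Gauss d 4 (const 0ℤ)
    T : ℕ → Series
    T n = Σℤ n (thetaTerm sgn pentagonal)
    ≈-unit : T 0 ≈ const 1ℤ
    ≈-unit = solve 0 (con 1ℤ :* con 1ℤ := con 1ℤ) ≈-refl
    W-closed : ∀ m → W m ≈ const (parity m) ⊛ q^ (2 ℕ.* (suc m ℕ.* m))
    W-closed zero = ≈-sym (solve 0 (con 1ℤ :* con 1ℤ := con 1ℤ) ≈-refl)
    W-closed (suc m) = begin
      (const 0ℤ ⊕ ⊖ Q^ (suc m)) ⊛ W m
        ≈⟨ ≈-refl ⟨*⟩ W-closed m ⟩
      (const 0ℤ ⊕ ⊖ Q^ (suc m)) ⊛ (const (parity m) ⊛ q^ (2 ℕ.* (suc m ℕ.* m)))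
        ≈⟨ solve 3 (λ Q p r → (con 0ℤ :+ :- Q) :* (p :* r) := :- p :* (Q :* r)) ≈-refl _ _ _ ⟩
      ⊖ const (parity m) ⊛ (Q^ (suc m) ⊛ q^ (2 ℕ.* (suc m ℕ.* m)))
        ≈⟨ ≈-sym (const-neg _) ⟨*⟩ ≈-sym (q^-split {2 ℕ.* (suc (suc m) ℕ.* suc m)} (4 ℕ.* suc m) (2 ℕ.* (suc m ℕ.* m))
            (ℕ-solve (m ∷ []))) ⟩
      const (parity (suc m)) ⊛ q^ (2 ℕ.* (suc (suc m) ℕ.* suc m)) ∎
    T-suc : ∀ m → T (suc m) ≈ (const 1ℤ ⊕ ⊖ (const 0ℤ ⊛ Q^ m)) ⊛ T m ⊕ W (suc m) ⊛ (Q^ (suc m ℕ.* m) ⊕ Q^ (suc m ℕ.* suc m))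
    T-suc m =
      linear (const s) (q^-split {pentagonal +[1+ m ]} E (4 ℕ.* (suc m ℕ.* suc m)) (exponent⁺ m))
      (linear (const s) (q^-split {pentagonal -[1+ m ]} E (4 ℕ.* (suc m ℕ.* m)) (exponent⁻ m))
      (linear (⊖ (Q^ (suc m ℕ.* m) ⊕ Q^ (suc m ℕ.* suc m))) (W-closed (suc m))
      (solve 9 (λ T s u v E P A C w →
        T :+ (s :* u :+ s :* v) :+ s :* (E :* P) :+ s :* (E :* A) :+ (:- (A :+ P)) :* (s :* E)
        := (con 1ℤ :+ :- (con 0ℤ :* C)) :* T :+ w :* (A :+ P) :+ s :* u :+ s :* v :+ (:- (A :+ P)) :* w)
        ≈-refl (T m) (const s) (q^ (pentagonal +[1+ m ])) (q^ (pentagonal -[1+ m ])) (q^ E)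
        (Q^ (suc m ℕ.* suc m)) (Q^ (suc m ℕ.* m)) (Q^ m) (W (suc m)))))
      where
      s = parity (suc m)
      E = 2 ℕ.* (suc (suc m) ℕ.* suc m)
      exponent⁺ : ∀ m → suc m ℕ.* (6 ℕ.* suc m ℕ.+ 2) ≡ 2 ℕ.* (suc (suc m) ℕ.* suc m) ℕ.+ 4 ℕ.* (suc m ℕ.* suc m)
      exponent⁺ = ℕ-solve-∀
      exponent⁻ : ∀ m → suc m ℕ.* (6 ℕ.* m ℕ.+ 4) ≡ 2 ℕ.* (suc (suc m) ℕ.* suc m) ℕ.+ 4 ℕ.* (suc m ℕ.* m)
      exponent⁻ = ℕ-solve-∀

  const-parity : ∀ m → const (parity (suc m)) ≈ ⊖ const (parity m)
  const-parity m = const-neg (parity m)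

  -- The recurrence shows that the theta sum times ∏ (1 + Q^k) tends to f_c. One more factor f_c
  -- turns each 1 + Q^k into 1 - Q^(2k), which accounts for the square on the left.
  gauss-φ : ∀ c .{{_ : ℕ.NonZero c}} → η c ⊛ η c ≈ η (c ℕ.* 2) ⊛ φ₋ c
  gauss-φ c = trunc⇒≈ λ N → let n = suc N; N≤n = ℕₚ.n≤1+n N in
    trunc-trans (trunc-⊛ (trunc-trans (η-trunc c N≤n) (trunc-sym (product T T-zero T-suc ℕₚ.≤-refl))) (η-trunc c N≤n))
    (trunc-trans (≈⇒trunc (linear (Θ n) (V-Π n) (solve 4 (λ V Θ P R → V :* Θ :* P :+ Θ :* R := R :* Θ :+ Θ :* (V :* P)) ≈-refl
        (V n) (Θ n) (Π c n) (Π (c ℕ.* 2) n))))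
    (trunc-⊛ (trunc-sym (η-trunc (c ℕ.* 2) {{ℕₚ.m*n≢0 c 2}} N≤n)) (trunc-sym (theta-trunc sgn (square-bound c) N≤n))))
    where
    open Gauss d c (⊖ q^ (c ℕ.* 1))
    V Θ T : ℕ → Series
    V zero = const 1ℤ
    V (suc n) = V n ⊛ (const 1ℤ ⊕ Q^ (suc n))
    Θ n = Σℤ n (thetaTerm sgn (square c))
    T n = V n ⊛ Θ n

    V-Π : ∀ n → V n ⊛ Π c n ≈ Π (c ℕ.* 2) n
    V-Π zero = solve 0 (con 1ℤ :* con 1ℤ := con 1ℤ) ≈-refl
    V-Π (suc n) =
      linear (const 1ℤ ⊕ ⊖ (Y ⊛ Y)) (V-Π n)
      (linear (Π (c ℕ.* 2) n) (q^-split (c ℕ.* suc n) (c ℕ.* suc n) (exponent c n))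
      (solve 5 (λ V P R Y Z →
        V :* (con 1ℤ :+ Y) :* (P :* (con 1ℤ :+ :- Y)) :+ (con 1ℤ :+ :- (Y :* Y)) :* R :+ R :* (Y :* Y)
        := R :* (con 1ℤ :+ :- Z) :+ (con 1ℤ :+ :- (Y :* Y)) :* (V :* P) :+ R :* Z)
        ≈-refl (V n) (Π c n) (Π (c ℕ.* 2) n) Y (q^ (c ℕ.* 2 ℕ.* suc n))))
      where
      Y = Q^ (suc n)
      exponent : ∀ c n → c ℕ.* 2 ℕ.* suc n ≡ c ℕ.* suc n ℕ.+ c ℕ.* suc n
      exponent = ℕ-solve-∀

    -- Each factor is -Q - Q^k = -Q(1 + Q^(k-1)), and k = 1 contributes -2Q. This 2 accounts for the
    -- equal theta terms at m + 1 and -(m + 1).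
    W-closed : ∀ m → W (suc m) ≈ const (parity (suc m)) ⊛ (const (+ 2) ⊛ (Q^ (suc m) ⊛ V m))
    W-closed zero = solve 1 (λ Q → (:- Q :+ :- Q) :* con 1ℤ := con (- 1ℤ) :* (con (+ 2) :* (Q :* con 1ℤ))) ≈-refl (Q^ 1)
    W-closed (suc m) =
      linear (⊖ (Q^ 1 ⊕ Z)) (W-closed m)
      (linear (const (+ 2) ⊛ s ⊛ V m) (Q^-+ {suc (suc m)} 1 (suc m) refl)
      (linear (⊖ (const (+ 2) ⊛ (Z ⊛ V (suc m)))) (const-parity (suc m))
      (solve 7 (λ q Y Z s s′ V w →
        (:- q :+ :- Z) :* w :+ (:- (q :+ Z)) :* (s :* (con (+ 2) :* (Y :* V))) :+ con (+ 2) :* s :* V :* (q :* Y)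
          :+ (:- (con (+ 2) :* (Z :* (V :* (con 1ℤ :+ Y))))) :* (:- s)
        := s′ :* (con (+ 2) :* (Z :* (V :* (con 1ℤ :+ Y)))) :+ (:- (q :+ Z)) :* w :+ con (+ 2) :* s :* V :* Z
          :+ (:- (con (+ 2) :* (Z :* (V :* (con 1ℤ :+ Y))))) :* s′)
        ≈-refl (Q^ 1) (Q^ (suc m)) Z s (const (parity (suc (suc m)))) (V m) (W (suc m)))))
      where
      s = const (parity (suc m))
      Z = Q^ (suc (suc m))

    T-zero : T 0 ≈ const 1ℤ
    T-zero = ≈-trans (≈-refl {const 1ℤ} ⟨*⟩ (≈-refl {const 1ℤ} ⟨*⟩ q^-≡ (ℕₚ.*-zeroʳ c)))
        (solve 0 (con 1ℤ :* (con 1ℤ :* con 1ℤ) := con 1ℤ) ≈-refl)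

    T-suc : ∀ m → T (suc m) ≈ (const 1ℤ ⊕ ⊖ (⊖ Q^ 1 ⊛ Q^ m)) ⊛ T m ⊕ W (suc m) ⊛ (Q^ (suc m ℕ.* m) ⊕ Q^ (suc m ℕ.* suc m))
    T-suc m =
      linear (⊖ (A ⊕ P)) (W-closed m)
      (linear (V m ⊛ Θ m) (Q^-+ {suc m} 1 m refl)
      (linear (const (+ 2) ⊛ s ⊛ V m) (Q^-+ (suc m) (suc m ℕ.* m) (ℕₚ.*-suc (suc m) m))
      (solve 9 (λ q C Y A P s V Θ w →
        V :* (con 1ℤ :+ Y) :* (Θ :+ (s :* P :+ s :* P)) :+ (:- (A :+ P)) :* (s :* (con (+ 2) :* (Y :* V)))
          :+ V :* Θ :* (q :* C) :+ con (+ 2) :* s :* V :* (Y :* A)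
        := (con 1ℤ :+ :- (:- q :* C)) :* (V :* Θ) :+ w :* (A :+ P) :+ (:- (A :+ P)) :* w
          :+ V :* Θ :* Y :+ con (+ 2) :* s :* V :* P)
        ≈-refl (Q^ 1) (Q^ m) (Q^ (suc m)) A P s (V m) (Θ m) (W (suc m)))))
      where
      s = const (parity (suc m))
      A = Q^ (suc m ℕ.* m)
      P = Q^ (suc m ℕ.* suc m)

  -- Here q - Q^k = q(1 - q^(2k-1)), so `W` yields the odd factors of f_1, and multiplying by f_2
  -- restores the even ones. Each step adds the triangular exponents of 2m + 1 and 2m + 2, hence the
  -- doubled stage for `ψ` and `η 1`.
  gauss-ψ : η 2 ⊛ η 2 ≈ η 1 ⊛ ψ
  gauss-ψ = trunc⇒≈ λ N → let n = suc N; N≤n = ℕₚ.n≤1+n N; N≤2n = ℕₚ.≤-trans N≤n (ℕₚ.m≤m*n n 2) in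
    trunc-trans (trunc-⊛ (trunc-trans (η-trunc 2 N≤n) (trunc-sym (product T T-zero T-suc ℕₚ.≤-refl))) (η-trunc 2 N≤n))
    (trunc-trans (≈⇒trunc (linear (Ψ (n ℕ.* 2)) (O-Π n) (solve 4 (λ V Θ P R → V :* Θ :* P :+ Θ :* R := R :* Θ :+ Θ :*
        (V :* P)) ≈-refl (O n) (Ψ (n ℕ.* 2)) (Π 2 n) (Π 1 (n ℕ.* 2)))))
    (trunc-⊛ (trunc-sym (η-trunc 1 N≤2n)) (trunc-sym (lim-trunc ψ-converges N≤2n))))
    where
    open Gauss d 2 (q^ 1)
    Ψ O T : ℕ → Series
    Ψ n = Σℕ n λ s → q^ (triangle s)
    O zero = const 1ℤ
    O (suc n) = O n ⊛ (const 1ℤ ⊕ ⊖ q^ (suc (n ℕ.* 2)))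
    T n = O n ⊛ Ψ (n ℕ.* 2)

    O-Π : ∀ n → O n ⊛ Π 2 n ≈ Π 1 (n ℕ.* 2)
    O-Π zero = solve 0 (con 1ℤ :* con 1ℤ := con 1ℤ) ≈-refl
    O-Π (suc n) =
      linear ((const 1ℤ ⊕ ⊖ X) ⊛ (const 1ℤ ⊕ ⊖ Y)) (O-Π n)
      (linear (Π 1 (n ℕ.* 2) ⊛ (const 1ℤ ⊕ ⊖ Y)) (q^-≡ (ℕₚ.*-identityˡ (suc (n ℕ.* 2))))
      (linear (Π 1 (n ℕ.* 2) ⊛ (const 1ℤ ⊕ ⊖ X′)) (q^-≡ (≡.trans (ℕₚ.*-identityˡ (suc n ℕ.* 2)) (ℕₚ.*-comm (suc n) 2)))
      (solve 7 (λ O P R X Y X′ Y′ →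
        O :* (con 1ℤ :+ :- X) :* (P :* (con 1ℤ :+ :- Y)) :+ (con 1ℤ :+ :- X) :* (con 1ℤ :+ :- Y) :* R
          :+ R :* (con 1ℤ :+ :- Y) :* X :+ R :* (con 1ℤ :+ :- X′) :* Y
        := R :* (con 1ℤ :+ :- X′) :* (con 1ℤ :+ :- Y′) :+ (con 1ℤ :+ :- X) :* (con 1ℤ :+ :- Y) :* (O :* P)
          :+ R :* (con 1ℤ :+ :- Y) :* X′ :+ R :* (con 1ℤ :+ :- X′) :* Y′)
        ≈-refl (O n) (Π 2 n) (Π 1 (n ℕ.* 2)) X Y X′ (q^ (1 ℕ.* (suc n ℕ.* 2))))))
      where
      X = q^ (suc (n ℕ.* 2))
      X′ = q^ (1 ℕ.* suc (n ℕ.* 2))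
      Y = Q^ (suc n)

    W-closed : ∀ m → W m ≈ q^ m ⊛ O m
    W-closed zero = ≈-sym (solve 0 (con 1ℤ :* con 1ℤ := con 1ℤ) ≈-refl)
    W-closed (suc m) =
      linear (q^ 1 ⊕ ⊖ Q^ (suc m)) (W-closed m)
      (linear (⊖ (q^ m ⊛ O m)) (q^-split {Q (suc m)} 1 (suc (m ℕ.* 2)) (exponent m))
      (linear (⊖ O (suc m)) (q^-+ 1 m)
      (solve 7 (λ q Y Z X O x w →
        (q :+ :- Y) :* w :+ (q :+ :- Y) :* (x :* O) :+ (:- (x :* O)) :* (q :* X) :+ (:- (O :* (con 1ℤ :+ :- X))) :* (q :* x)
        := Z :* (O :* (con 1ℤ :+ :- X)) :+ (q :+ :- Y) :* w :+ (:- (x :* O)) :* Y :+ (:- (O :* (con 1ℤ :+ :- X))) :* Z)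
        ≈-refl (q^ 1) (Q^ (suc m)) (q^ suc m) (q^ (suc (m ℕ.* 2))) (O m) (q^ m) (W m))))
      where
      Q : ℕ → ℕ
      Q n = 2 ℕ.* n
      exponent : ∀ m → 2 ℕ.* suc m ≡ 1 ℕ.+ suc (m ℕ.* 2)
      exponent = ℕ-solve-∀

    triangle-even : ∀ m → triangle (m ℕ.* 2) ≡ m ℕ.* (m ℕ.* 2 ℕ.+ 1)
    triangle-even zero = refl
    triangle-even (suc m) rewrite triangle-even m = lemma m
      where
      lemma : ∀ m → suc (suc (m ℕ.* 2)) ℕ.+ (suc (m ℕ.* 2) ℕ.+ m ℕ.* (m ℕ.* 2 ℕ.+ 1)) ≡ suc m ℕ.* (suc m ℕ.* 2 ℕ.+ 1)
      lemma = ℕ-solve-∀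

    T-zero : T 0 ≈ const 1ℤ
    T-zero = solve 0 (con 1ℤ :* con 1ℤ := con 1ℤ) ≈-refl

    T-suc : ∀ m → T (suc m) ≈ (const 1ℤ ⊕ ⊖ (q^ 1 ⊛ Q^ m)) ⊛ T m ⊕ W (suc m) ⊛ (Q^ (suc m ℕ.* m) ⊕ Q^ (suc m ℕ.* suc m))
    T-suc m =
      linear (⊖ (A ⊕ P)) (W-closed (suc m))
      (linear (O (suc m)) (q^-split {triangle (suc (m ℕ.* 2))} (suc m) (2 ℕ.* (suc m ℕ.* m))
          (≡.trans (cong (suc (m ℕ.* 2) ℕ.+_) (triangle-even m)) (exponent₁ m)))
      (linear (O (suc m)) (q^-split {triangle (suc m ℕ.* 2)} (suc m) (2 ℕ.* (suc m ℕ.* suc m)) (≡.trans (triangle-even (suc m))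
          (exponent₂ m)))
      (linear (⊖ (O m ⊛ Ψ (m ℕ.* 2))) (q^-split {suc (m ℕ.* 2)} 1 (2 ℕ.* m) (cong suc (ℕₚ.*-comm m 2)))
      (solve 11 (λ q C X A P O Ψ w Z u v →
        O :* (con 1ℤ :+ :- X) :* (Ψ :+ u :+ v) :+ (:- (A :+ P)) :* (Z :* (O :* (con 1ℤ :+ :- X)))
          :+ O :* (con 1ℤ :+ :- X) :* (Z :* A) :+ O :* (con 1ℤ :+ :- X) :* (Z :* P) :+ (:- (O :* Ψ)) :* (q :* C)
        := (con 1ℤ :+ :- (q :* C)) :* (O :* Ψ) :+ w :* (A :+ P) :+ (:- (A :+ P)) :* w
          :+ O :* (con 1ℤ :+ :- X) :* u :+ O :* (con 1ℤ :+ :- X) :* v :+ (:- (O :* Ψ)) :* X)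
        ≈-refl (q^ 1) (Q^ m) (q^ (suc (m ℕ.* 2))) A P (O m) (Ψ (m ℕ.* 2)) (W (suc m)) (q^ suc m)
        (q^ (triangle (suc (m ℕ.* 2)))) (q^ (triangle (suc m ℕ.* 2)))))))
      where
      A = Q^ (suc m ℕ.* m)
      P = Q^ (suc m ℕ.* suc m)
      exponent₁ : ∀ m → suc (m ℕ.* 2) ℕ.+ m ℕ.* (m ℕ.* 2 ℕ.+ 1) ≡ suc m ℕ.+ 2 ℕ.* (suc m ℕ.* m)
      exponent₁ = ℕ-solve-∀
      exponent₂ : ∀ m → suc m ℕ.* (suc m ℕ.* 2 ℕ.+ 1) ≡ suc m ℕ.+ 2 ℕ.* (suc m ℕ.* suc m)
      exponent₂ = ℕ-solve-∀

-- Trisection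

⟨q³⟩-⊕ : ∀ a b n → ((a ⊕ b) ⟨q³⟩) n ≡ (a ⟨q³⟩) n + (b ⟨q³⟩) n
⟨q³⟩-⊕ a b 0 = refl
⟨q³⟩-⊕ a b 1 = refl
⟨q³⟩-⊕ a b 2 = refl
⟨q³⟩-⊕ a b (suc (suc (suc n))) = ⟨q³⟩-⊕ (tail a) (tail b) n

⟨q³⟩-scale : ∀ x a n → ((λ m → x * a m) ⟨q³⟩) n ≡ x * (a ⟨q³⟩) n
⟨q³⟩-scale x a 0 = refl
⟨q³⟩-scale x a 1 = ≡.sym (ℤₚ.*-zeroʳ x)
⟨q³⟩-scale x a 2 = ≡.sym (ℤₚ.*-zeroʳ x)
⟨q³⟩-scale x a (suc (suc (suc n))) = ⟨q³⟩-scale x (tail a) n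

⟨q³⟩-0 : ∀ {a} n → (∀ m → a m ≡ 0ℤ) → (a ⟨q³⟩) n ≡ 0ℤ
⟨q³⟩-0 0 a≡0 = a≡0 0
⟨q³⟩-0 1 a≡0 = refl
⟨q³⟩-0 2 a≡0 = refl
⟨q³⟩-0 (suc (suc (suc n))) a≡0 = ⟨q³⟩-0 n λ m → a≡0 (suc m)

⟨q³⟩-const : ∀ x n → (const x ⟨q³⟩) n ≡ const x n
⟨q³⟩-const x 0 = refl
⟨q³⟩-const x 1 = refl
⟨q³⟩-const x 2 = refl
⟨q³⟩-const x (suc (suc (suc n))) = ⟨q³⟩-0 n λ _ → refl

⟨q³⟩-q^ : ∀ e n → ((q^ e) ⟨q³⟩) n ≡ (q^ (e ℕ.* 3)) n
⟨q³⟩-q^ zero n = ⟨q³⟩-const 1ℤ n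
⟨q³⟩-q^ (suc e) 0 = refl
⟨q³⟩-q^ (suc e) 1 = refl
⟨q³⟩-q^ (suc e) 2 = refl
⟨q³⟩-q^ (suc e) (suc (suc (suc n))) = ⟨q³⟩-q^ e n

⟨q³⟩-⊛-suc³ : ∀ a b n → (a ⟨q³⟩ ⊛ b) (suc (suc (suc n))) ≡ a 0 * b (suc (suc (suc n))) + (tail a ⟨q³⟩ ⊛ b) n
⟨q³⟩-⊛-suc³ a b n = lemma (a 0 * b (suc (suc (suc n)))) (b (suc (suc n))) (b (suc n)) ((tail a ⟨q³⟩ ⊛ b) n)
  where
  lemma : ∀ x y z w → x + (0ℤ * y + (0ℤ * z + w)) ≡ x + w
  lemma = solve-∀

⟨q³⟩-⊛ : ∀ a b n → ((a ⊛ b) ⟨q³⟩) n ≡ (a ⟨q³⟩ ⊛ b ⟨q³⟩) n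
⟨q³⟩-⊛ a b 0 = refl
⟨q³⟩-⊛ a b 1 = lemma (a 0) (b 0)
  where
  lemma : ∀ x y → 0ℤ ≡ x * 0ℤ + 0ℤ * y
  lemma = solve-∀
⟨q³⟩-⊛ a b 2 = lemma (a 0) (b 0)
  where
  lemma : ∀ x y → 0ℤ ≡ x * 0ℤ + (0ℤ * 0ℤ + 0ℤ * y)
  lemma = solve-∀
⟨q³⟩-⊛ a b (suc (suc (suc n))) = begin
  (((λ m → a 0 * tail b m) ⊕ (tail a ⊛ b)) ⟨q³⟩) n              ≡⟨ ⟨q³⟩-⊕ (λ m → a 0 * tail b m) (tail a ⊛ b) n ⟩
  ((λ m → a 0 * tail b m) ⟨q³⟩) n + ((tail a ⊛ b) ⟨q³⟩) n       ≡⟨ cong₂ _+_ (⟨q³⟩-scale (a 0) (tail b) n)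
      (⟨q³⟩-⊛ (tail a) b n) ⟩
  a 0 * (tail b ⟨q³⟩) n + (tail a ⟨q³⟩ ⊛ b ⟨q³⟩) n               ≡⟨ ⟨q³⟩-⊛-suc³ a (b ⟨q³⟩) n ⟨
  (a ⟨q³⟩ ⊛ b ⟨q³⟩) (suc (suc (suc n))) ∎
  where open ≡-Reasoning

-- A factor in q³ does not mix the residue classes of exponents. This is how eta factors of index
-- divisible by 3 leave the extraction.
third-⊛ : ∀ a b m → third (a ⟨q³⟩ ⊛ b) m ≡ (a ⊛ third b) m
third-⊛ a b zero = lemma (a 0) (b 0) (b 1)
  where
  lemma : ∀ x y z → x * z + 0ℤ * y ≡ x * z
  lemma = solve-∀
third-⊛ a b (suc m) = begin
  (a ⟨q³⟩ ⊛ b) (suc (suc (suc (suc (m ℕ.* 3)))))                                        ≡⟨ ⟨q³⟩-⊛-suc³ a b (suc (m ℕ.* 3)) ⟩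
  a 0 * b (suc (suc (suc (suc (m ℕ.* 3))))) + (tail a ⟨q³⟩ ⊛ b) (suc (m ℕ.* 3))         ≡⟨ cong (λ x → a 0 * third b
      (suc m) + x) (third-⊛ (tail a) b m) ⟩
  a 0 * third b (suc m) + (tail a ⊛ third b) m                                          ∎
  where open ≡-Reasoning

-- Together with x ↦ −(3x + 1) these exhaust ℤ.
3x 3x+1 : ℤ → ℤ
3x (+ n) = + (n ℕ.* 3)
3x -[1+ n ] = -[1+ suc (suc (n ℕ.* 3)) ]
3x+1 (+ n) = +[1+ n ℕ.* 3 ]
3x+1 -[1+ n ] = -[1+ suc (n ℕ.* 3) ]

-- The cutoff 3n + 1 is the one for which the three classes, each with ∣x∣ ≤ n, fill the symmetric
-- interval exactly. Writing the last class as -(3x + 1) makes an even `h` agree on the last two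
-- classes.
sumℤ-mod-3 : ∀ n h → sumℤ (suc (n ℕ.* 3)) h ≡ sumℤ n (λ x → h (3x x) + (h (3x+1 x) + h (- 3x+1 x)))
sumℤ-mod-3 zero h = refl
sumℤ-mod-3 (suc n) h rewrite sumℤ-mod-3 n h =
  lemma (sumℤ n (λ x → h (3x x) + (h (3x+1 x) + h (- 3x+1 x)))) (h (+ suc m)) (h -[1+ m ]) (h (+ suc (suc m))) (h -[1+ suc m ])
      (h (+ suc (suc (suc m)))) (h -[1+ suc (suc m) ])
  where
  m = suc (n ℕ.* 3)
  lemma : ∀ s a b c d e f → s + (a + b) + (c + d) + (e + f) ≡ s + ((c + (e + f)) + (d + (b + a)))
  lemma = solve-∀

-- 3x² + 2x
ω : ℤ → ℕ
ω (+ n) = n ℕ.* (3 ℕ.* n ℕ.+ 2)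
ω -[1+ n ] = suc n ℕ.* (3 ℕ.* n ℕ.+ 1)

ω-bound : ∀ c .{{_ : ℕ.NonZero c}} x → ∣ x ∣ ≤ c ℕ.* ω x
ω-bound c x = ℕₚ.≤-trans (bound x) (ℕₚ.m≤n*m (ω x) c)
  where
  bound : ∀ x → ∣ x ∣ ≤ ω x
  bound (+ n) = ℕₚ.m≤m*n n (3 ℕ.* n ℕ.+ 2) {{ℕ.>-nonZero (ℕₚ.≤-trans (s≤s z≤n) (ℕₚ.m≤n+m 2 (3 ℕ.* n)))}}
  bound -[1+ n ] = ℕₚ.m≤m*n (suc n) (3 ℕ.* n ℕ.+ 1) {{ℕ.>-nonZero (ℕₚ.m≤n+m 1 (3 ℕ.* n))}}

module Dissection (d : ℕ) where
  open Products d public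
  open Basic d public

  ⟨q³⟩-trunc : ∀ {a b N} → a ≈[ N ] b → a ⟨q³⟩ ≈[ N ] b ⟨q³⟩
  ⟨q³⟩-trunc e = trunc (go e _)
    where
    go : ∀ {a b N} → a ≈[ N ] b → ∀ n → n ≤ N → (a ⟨q³⟩) n ~ (b ⟨q³⟩) n
    go e 0 n≤N = upto e z≤n
    go e 1 n≤N = ~-refl
    go e 2 n≤N = ~-refl
    go {N = suc (suc (suc N))} e (suc (suc (suc n))) (s≤s (s≤s (s≤s n≤N))) =
      go {N = N} (trunc λ m≤N → upto e (s≤s (ℕₚ.m≤n⇒m≤1+n (ℕₚ.m≤n⇒m≤1+n m≤N)))) n n≤N

  ⟨q³⟩-cong : ∀ {a b} → a ≈ b → a ⟨q³⟩ ≈ b ⟨q³⟩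
  ⟨q³⟩-cong e = trunc⇒≈ λ N → ⟨q³⟩-trunc (≈⇒trunc e)

  third-cong : ∀ {a b} → a ≈ b → third a ≈ third b
  third-cong e = mk≈ λ n → at e (suc (n ℕ.* 3))

  η-⟨q³⟩ : ∀ c .{{_ : ℕ.NonZero c}} → η c ⟨q³⟩ ≈ η (c ℕ.* 3)
  η-⟨q³⟩ c = trunc⇒≈ λ N → trunc-trans (⟨q³⟩-trunc (η-trunc c {N} ℕₚ.≤-refl))
    (trunc-trans (≈⇒trunc (finite N)) (trunc-sym (η-trunc (c ℕ.* 3) {{ℕₚ.m*n≢0 c 3}} ℕₚ.≤-refl)))
    where
    exponent : ∀ c n → c ℕ.* suc n ℕ.* 3 ≡ c ℕ.* 3 ℕ.* suc n
    exponent = ℕ-solve-∀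
    finite : ∀ n → Π c n ⟨q³⟩ ≈ Π (c ℕ.* 3) n
    finite zero = from≡ (⟨q³⟩-const 1ℤ)
    finite (suc n) = ≈-trans (from≡ (⟨q³⟩-⊛ (Π c n) (const 1ℤ ⊕ ⊖ q^ (c ℕ.* suc n))))
      (finite n ⟨*⟩ from≡ factor)
      where
      neg : ∀ a m → ((⊖ a) ⟨q³⟩) m ≡ - (a ⟨q³⟩) m
      neg a 0 = refl
      neg a 1 = refl
      neg a 2 = refl
      neg a (suc (suc (suc m))) = neg (tail a) m
      factor : ∀ m → ((const 1ℤ ⊕ ⊖ q^ (c ℕ.* suc n)) ⟨q³⟩) m ≡ (const 1ℤ ⊕ ⊖ q^ (c ℕ.* 3 ℕ.* suc n)) m
      factor m = ≡.trans (⟨q³⟩-⊕ (const 1ℤ) (⊖ q^ (c ℕ.* suc n)) m) (cong₂ _+_ (⟨q³⟩-const 1ℤ m)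
        (≡.trans (neg (q^ (c ℕ.* suc n)) m) (cong -_ (≡.trans (⟨q³⟩-q^ (c ℕ.* suc n) m) (cong (λ e → (q^ e) m)
            (exponent c n))))))

  Σℤ-cong : ∀ {f g} → (∀ x → f x ≈ g x) → ∀ n → Σℤ n f ≈ Σℤ n g
  Σℤ-cong e zero = e 0ℤ
  Σℤ-cong {f} {g} e (suc n) = Σℤ-cong e n ⟨+⟩ (e +[1+ n ] ⟨+⟩ e -[1+ n ])

  thetaTerm-⟨q³⟩ : ∀ x e → (const x ⊛ q^ e) ⟨q³⟩ ≈ const x ⊛ q^ (e ℕ.* 3)
  thetaTerm-⟨q³⟩ x e = ≈-trans (from≡ (⟨q³⟩-⊛ (const x) (q^ e))) (from≡ (⟨q³⟩-const x) ⟨*⟩ from≡ (⟨q³⟩-q^ e))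

  const-* : ∀ x y → const (x * y) ≈ const x ⊛ const y
  const-* x y = from≡ λ { zero → refl ; (suc n) → ≡.sym (≡.trans (const-⊛ x (const y) (suc n)) (ℤₚ.*-zeroʳ x)) }

  -- Since c(3x)² = 3 · 3cx² and c(3x + 1)² = c + 3c(3x² + 2x), only the residues of 0 and c occur.
  -- Evenness merges the classes ±(3x + 1), whence the 2, and `s` records how the character changes
  -- from x to 3x + 1.
  square-dissection : ∀ c .{{_ : ℕ.NonZero c}} s ε → (∀ x → ε (- x) ≡ ε x) → (∀ x → ε (3x x) ≡ ε x) →
      (∀ x → ε (3x+1 x) ≡ s * ε x) →
    theta ε (square c) ≈ theta ε (square (c ℕ.* 3)) ⟨q³⟩ ⊕ const (+ 2 * s) ⊛ (q^ c ⊛ theta ε (λ x → c ℕ.* ω x) ⟨q³⟩)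
  square-dissection c s ε ε-even ε-3x ε-3x+1 = trunc⇒≈ λ N →
    trunc-trans (theta-trunc ε (square-bound c) (ℕₚ.m≤n⇒m≤1+n (ℕₚ.m≤m*n N 3)))
    (trunc-trans (≈⇒trunc (≈-trans (from≡ λ m → sumℤ-mod-3 N (λ x → thetaTerm ε (square c) x m)) (finite N)))
    (trunc-sym (trunc-⊕ (⟨q³⟩-trunc (theta-trunc ε (square-bound (c ℕ.* 3) {{ℕₚ.m*n≢0 c 3}}) ℕₚ.≤-refl))
      (trunc-⊛ (≈⇒trunc (≈-refl {const (+ 2 * s)})) (trunc-⊛ (≈⇒trunc (≈-refl {q^ c}))
          (⟨q³⟩-trunc (theta-trunc ε (ω-bound c) ℕₚ.≤-refl)))))))
    where
    A B : ℤ → Series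
    A = thetaTerm ε (square (c ℕ.* 3))
    B = thetaTerm ε (λ x → c ℕ.* ω x)
    exponent-3x : ∀ x → square c (3x x) ≡ square (c ℕ.* 3) x ℕ.* 3
    exponent-3x (+ n) = lemma c n
      where
      lemma : ∀ c n → c ℕ.* (n ℕ.* 3 ℕ.* (n ℕ.* 3)) ≡ c ℕ.* 3 ℕ.* (n ℕ.* n) ℕ.* 3
      lemma = ℕ-solve-∀
    exponent-3x -[1+ n ] = lemma c n
      where
      lemma : ∀ c n → c ℕ.* ((suc n ℕ.* 3) ℕ.* (suc n ℕ.* 3)) ≡ c ℕ.* 3 ℕ.* (suc n ℕ.* suc n) ℕ.* 3
      lemma = ℕ-solve-∀
    exponent-3x+1 : ∀ x → square c (3x+1 x) ≡ c ℕ.+ c ℕ.* ω x ℕ.* 3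
    exponent-3x+1 (+ n) = lemma c n
      where
      lemma : ∀ c n → c ℕ.* (suc (n ℕ.* 3) ℕ.* suc (n ℕ.* 3)) ≡ c ℕ.+ c ℕ.* (n ℕ.* (3 ℕ.* n ℕ.+ 2)) ℕ.* 3
      lemma = ℕ-solve-∀
    exponent-3x+1 -[1+ n ] = lemma c n
      where
      lemma : ∀ c n → c ℕ.* (suc (suc (n ℕ.* 3)) ℕ.* suc (suc (n ℕ.* 3))) ≡ c ℕ.+ c ℕ.* (suc n ℕ.* (3 ℕ.* n ℕ.+ 1)) ℕ.* 3
      lemma = ℕ-solve-∀
    term-3x : ∀ x → thetaTerm ε (square c) (3x x) ≈ A x ⟨q³⟩
    term-3x x rewrite ε-3x x | exponent-3x x = ≈-sym (thetaTerm-⟨q³⟩ (ε x) (square (c ℕ.* 3) x))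
    term-3x+1 : ∀ x → thetaTerm ε (square c) (3x+1 x) ≈ const s ⊛ (q^ c ⊛ B x ⟨q³⟩)
    term-3x+1 x rewrite ε-3x+1 x | exponent-3x+1 x =
      linear (q^ (c ℕ.+ c ℕ.* ω x ℕ.* 3)) (const-* s (ε x))
      (linear (const s ⊛ const (ε x)) (q^-+ c (c ℕ.* ω x ℕ.* 3))
      (linear (⊖ (const s ⊛ q^ c)) (thetaTerm-⟨q³⟩ (ε x) (c ℕ.* ω x))
      (solve 7 (λ se s e b q w p →
        se :* b :+ b :* (s :* e) :+ s :* e :* (q :* p) :+ (:- (s :* q)) :* (e :* p)
        := s :* (q :* w) :+ b :* se :+ s :* e :* b :+ (:- (s :* q)) :* w)
        ≈-refl (const (s * ε x)) (const s) (const (ε x)) (q^ (c ℕ.+ c ℕ.* ω x ℕ.* 3)) (q^ c) (B x ⟨q³⟩)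
            (q^ (c ℕ.* ω x ℕ.* 3)))))
    term-even : ∀ x → thetaTerm ε (square c) (- x) ≈ thetaTerm ε (square c) x
    term-even x rewrite ε-even x | ℤₚ.∣-i∣≡∣i∣ x = ≈-refl
    term : ∀ x → thetaTerm ε (square c) (3x x) ⊕ (thetaTerm ε (square c) (3x+1 x) ⊕ thetaTerm ε (square c) (- 3x+1 x))
      ≈ A x ⟨q³⟩ ⊕ const (+ 2 * s) ⊛ (q^ c ⊛ B x ⟨q³⟩)
    term x =
      linear (const 1ℤ) (term-3x x)
      (linear (const 1ℤ) (term-even (3x+1 x))
      (linear (const (+ 2)) (term-3x+1 x)
      (linear (⊖ (q^ c ⊛ B x ⟨q³⟩)) (const-* (+ 2) s)
      (solve 7 (λ a b b′ A B s 2s →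
        a :+ (b :+ b′) :+ con 1ℤ :* A :+ con 1ℤ :* b :+ con (+ 2) :* (s :* B) :+ (:- B) :* (con (+ 2) :* s)
        := A :+ 2s :* B :+ con 1ℤ :* a :+ con 1ℤ :* b′ :+ con (+ 2) :* b :+ (:- B) :* 2s)
        ≈-refl (thetaTerm ε (square c) (3x x)) (thetaTerm ε (square c) (3x+1 x)) (thetaTerm ε (square c) (- 3x+1 x)) (A x ⟨q³⟩)
          (q^ c ⊛ B x ⟨q³⟩) (const s) (const (+ 2 * s))))))
    finite : ∀ n → Σℤ n (λ x → thetaTerm ε (square c) (3x x) ⊕ (thetaTerm ε (square c) (3x+1 x) ⊕ thetaTerm ε (square c)
        (- 3x+1 x)))
      ≈ Σℤ n A ⟨q³⟩ ⊕ const (+ 2 * s) ⊛ (q^ c ⊛ Σℤ n B ⟨q³⟩)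
    finite zero = term 0ℤ
    finite (suc n) =
      linear (const 1ℤ) (finite n)
      (linear (const 1ℤ) (term +[1+ n ])
      (linear (const 1ℤ) (term -[1+ n ])
      (linear (⊖ const 1ℤ) (split (Σℤ n A) (A +[1+ n ]) (A -[1+ n ]))
      (linear (⊖ (const (+ 2 * s) ⊛ q^ c)) (split (Σℤ n B) (B +[1+ n ]) (B -[1+ n ]))
      (solve 13 (λ u v w A a a′ B b b′ k q X Y →
        u :+ (v :+ w) :+ con 1ℤ :* (A :+ k :* (q :* B)) :+ con 1ℤ :* (a :+ k :* (q :* b)) :+ con 1ℤ :* (a′ :+ k :* (q :* b′))
          :+ (:- con 1ℤ) :* (A :+ (a :+ a′)) :+ (:- (k :* q)) :* (B :+ (b :+ b′))
        := X :+ k :* (q :* Y) :+ con 1ℤ :* u :+ con 1ℤ :* v :+ con 1ℤ :* w :+ (:- con 1ℤ) :* X :+ (:- (k :* q)) :* Y)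
        ≈-refl _ _ _ (Σℤ n A ⟨q³⟩) (A +[1+ n ] ⟨q³⟩) (A -[1+ n ] ⟨q³⟩) (Σℤ n B ⟨q³⟩) (B +[1+ n ] ⟨q³⟩) (B -[1+ n ] ⟨q³⟩)
        (const (+ 2 * s)) (q^ c) (Σℤ (suc n) A ⟨q³⟩) (Σℤ (suc n) B ⟨q³⟩))))))
      where
      split : ∀ a b c → (a ⊕ (b ⊕ c)) ⟨q³⟩ ≈ a ⟨q³⟩ ⊕ (b ⟨q³⟩ ⊕ c ⟨q³⟩)
      split a b c = from≡ λ n → ≡.trans (⟨q³⟩-⊕ a (b ⊕ c) n) (cong (λ x → (a ⟨q³⟩) n + x) (⟨q³⟩-⊕ b c n))

-- Rotation of ℤ²

sumℤ-cong : ∀ n {f g} → (∀ x → f x ≡ g x) → sumℤ n f ≡ sumℤ n g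
sumℤ-cong zero e = e 0ℤ
sumℤ-cong (suc n) e = cong₂ _+_ (sumℤ-cong n e) (cong₂ _+_ (e _) (e _))

sumℤ-0 : ∀ n {f} → (∀ x → f x ≡ 0ℤ) → sumℤ n f ≡ 0ℤ
sumℤ-0 zero e = e 0ℤ
sumℤ-0 (suc n) e rewrite sumℤ-0 n e | e +[1+ n ] | e -[1+ n ] = refl

sumℤ-+ : ∀ n f g → sumℤ n (λ x → f x + g x) ≡ sumℤ n f + sumℤ n g
sumℤ-+ zero f g = refl
sumℤ-+ (suc n) f g rewrite sumℤ-+ n f g = lemma (sumℤ n f) (sumℤ n g) (f +[1+ n ]) (g +[1+ n ]) (f -[1+ n ]) (g -[1+ n ])
  where
  lemma : ∀ s t a b c d → s + t + (a + b + (c + d)) ≡ s + (a + c) + (t + (b + d))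
  lemma = solve-∀

sumℤ-* : ∀ n x f → sumℤ n (λ y → x * f y) ≡ x * sumℤ n f
sumℤ-* zero x f = refl
sumℤ-* (suc n) x f rewrite sumℤ-* n x f = lemma x (sumℤ n f) (f +[1+ n ]) (f -[1+ n ])
  where
  lemma : ∀ x s a b → x * s + (x * a + x * b) ≡ x * (s + (a + b))
  lemma = solve-∀

sumℤ-swap : ∀ m n (f : ℤ → ℤ → ℤ) → sumℤ m (λ x → sumℤ n (f x)) ≡ sumℤ n (λ y → sumℤ m (λ x → f x y))
sumℤ-swap zero n f = refl
sumℤ-swap (suc m) n f rewrite sumℤ-swap m n f = ≡.sym (≡.trans
  (sumℤ-+ n (λ y → sumℤ m (λ x → f x y)) (λ y → f +[1+ m ] y + f -[1+ m ] y))
  (cong (λ z → sumℤ n (λ y → sumℤ m (λ x → f x y)) + z) (sumℤ-+ n (f +[1+ m ]) (f -[1+ m ]))))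

sumℤ-outside : ∀ n {f} → (∀ x → ∣ x ∣ ≤ n → f x ≡ 0ℤ) → sumℤ n f ≡ 0ℤ
sumℤ-outside zero e = e 0ℤ z≤n
sumℤ-outside (suc n) e
  rewrite sumℤ-outside n (λ x x≤n → e x (ℕₚ.m≤n⇒m≤1+n x≤n)) | e +[1+ n ] ℕₚ.≤-refl | e -[1+ n ] ℕₚ.≤-refl = refl

sumℤ-pick : ∀ n a {f} → ∣ a ∣ ≤ n → (∀ x → x ≢ a → f x ≡ 0ℤ) → sumℤ n f ≡ f a
sumℤ-pick zero (+ zero) a≤n off = refl
sumℤ-pick (suc n) a {f} a≤1+n off with ∣ a ∣ ℕ.≤? n
... | yes a≤n = ≡.trans (cong₂ _+_ (sumℤ-pick n a a≤n off) (cong₂ _+_ (off +[1+ n ] λ { refl → ℕₚ.<-irrefl refl a≤n })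
    (off -[1+ n ] λ { refl → ℕₚ.<-irrefl refl a≤n })))
  (ℤₚ.+-identityʳ (f a))
... | no a≰n = ≡.trans (cong (_+ (f +[1+ n ] + f -[1+ n ])) (sumℤ-outside n λ x x≤n → off x λ { refl → a≰n x≤n }))
    (≡.trans (ℤₚ.+-identityˡ _) (boundary a ∣a∣≡1+n off))
  where
  ∣a∣≡1+n : ∣ a ∣ ≡ suc n
  ∣a∣≡1+n = ℕₚ.≤-antisym a≤1+n (ℕₚ.≰⇒> a≰n)
  boundary : ∀ b → ∣ b ∣ ≡ suc n → (∀ x → x ≢ b → f x ≡ 0ℤ) → f +[1+ n ] + f -[1+ n ] ≡ f b
  boundary +[1+ _ ] refl off = ≡.trans (cong (λ x → f +[1+ n ] + x) (off -[1+ n ] λ ())) (ℤₚ.+-identityʳ _)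
  boundary -[1+ _ ] refl off = ≡.trans (cong (λ x → x + f -[1+ n ]) (off +[1+ n ] λ ())) (ℤₚ.+-identityˡ _)

sumℤ² : ℕ → (ℤ → ℤ → ℤ) → ℤ
sumℤ² n f = sumℤ n λ x → sumℤ n (f x)

sumℤ²-cong : ∀ n {f g} → (∀ x y → f x y ≡ g x y) → sumℤ² n f ≡ sumℤ² n g
sumℤ²-cong n e = sumℤ-cong n λ x → sumℤ-cong n (e x)

sumℤ²-0 : ∀ n {f} → (∀ x y → f x y ≡ 0ℤ) → sumℤ² n f ≡ 0ℤ
sumℤ²-0 n e = sumℤ-0 n λ x → sumℤ-0 n (e x)

sumℤ²-pick : ∀ n a b {f} → ∣ a ∣ ≤ n → ∣ b ∣ ≤ n → (∀ x y → ¬ (x ≡ a × y ≡ b) → f x y ≡ 0ℤ) → sumℤ² n f ≡ f a b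
sumℤ²-pick n a b a≤n b≤n off = ≡.trans
  (sumℤ-pick n a a≤n λ x x≢a → sumℤ-0 n λ y → off x y λ { (x≡a , _) → x≢a x≡a })
  (sumℤ-pick n b b≤n λ y y≢b → off a y λ { (_ , y≡b) → y≢b y≡b })

sumℤ²-swap : ∀ n (f : ℤ → ℤ → ℤ → ℤ → ℤ) →
  sumℤ² n (λ x y → sumℤ² n (f x y)) ≡ sumℤ² n (λ u v → sumℤ² n (λ x y → f x y u v))
sumℤ²-swap n f = begin
  sumℤ n (λ x → sumℤ n λ y → sumℤ n λ u → sumℤ n λ v → f x y u v)
    ≡⟨ sumℤ-cong n (λ x → sumℤ-swap n n _) ⟩
  sumℤ n (λ x → sumℤ n λ u → sumℤ n λ y → sumℤ n λ v → f x y u v)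
    ≡⟨ sumℤ-cong n (λ x → sumℤ-cong n λ u → sumℤ-swap n n _) ⟩
  sumℤ n (λ x → sumℤ n λ u → sumℤ n λ v → sumℤ n λ y → f x y u v)
    ≡⟨ sumℤ-swap n n _ ⟩
  sumℤ n (λ u → sumℤ n λ x → sumℤ n λ v → sumℤ n λ y → f x y u v)
    ≡⟨ sumℤ-cong n (λ u → sumℤ-swap n n _) ⟩
  sumℤ n (λ u → sumℤ n λ v → sumℤ n λ x → sumℤ n λ y → f x y u v) ∎
  where open ≡-Reasoning

δ : ℤ → ℤ → ℤ
δ x y with x ℤ.≟ y
... | yes _ = 1ℤ
... | no _ = 0ℤ

δ-refl : ∀ x → δ x x ≡ 1ℤ
δ-refl x with x ℤ.≟ x
... | yes _ = refl
... | no x≢x = contradiction refl x≢x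

δδ-off : ∀ x y u v w → (x ≡ u → y ≡ v → w ≡ 0ℤ) → δ x u * (δ y v * w) ≡ 0ℤ
δδ-off x y u v w h with x ℤ.≟ u | y ℤ.≟ v
... | no _ | _ = refl
... | yes _ | no _ = refl
... | yes x≡u | yes y≡v rewrite h x≡u y≡v = refl

δδ-on : ∀ x y {u v} w → x ≡ u → y ≡ v → δ x u * (δ y v * w) ≡ w
δδ-on x y w refl refl rewrite δ-refl x | δ-refl y = lemma w
  where
  lemma : ∀ w → 1ℤ * (1ℤ * w) ≡ w
  lemma = solve-∀

halve-≤ : ∀ {n} i x y → i + i ≡ x + y → ∣ x ∣ ≤ n → ∣ y ∣ ≤ n → ∣ i ∣ ≤ n
halve-≤ {n} i x y eq x≤n y≤n = ℕₚ.*-cancelˡ-≤ 2 (subst (_≤ 2 ℕ.* n) double (ℕₚ.≤-trans (ℤₚ.∣i+j∣≤∣i∣+∣j∣ x y) bound))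
  where
  twice : ∀ i → i + i ≡ + 2 * i
  twice = solve-∀
  double : ∣ x + y ∣ ≡ 2 ℕ.* ∣ i ∣
  double = ≡.trans (cong ∣_∣ (≡.trans (≡.sym eq) (twice i))) (ℤₚ.abs-* (+ 2) i)
  bound : ∣ x ∣ ℕ.+ ∣ y ∣ ≤ 2 ℕ.* n
  bound = ℕₚ.+-mono-≤ x≤n (ℕₚ.≤-trans y≤n (ℕₚ.m≤m+n n 0))

-- The map (i , j) ↦ (i + j , i − j) is a bijection of ℤ² onto the pairs of equal parity.
sumℤ²-rotate : ∀ n (W V : ℤ → ℤ → ℤ) → (∀ i j → V i j ≡ W (i + j) (i - j)) →
  (∀ x y → W x y ≢ 0ℤ → ∣ x ∣ ≤ n × ∣ y ∣ ≤ n × ∃ λ i → i + i ≡ x + y) →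
  sumℤ² n W ≡ sumℤ² n V
sumℤ²-rotate n W V V≡W support = begin
  sumℤ² n W                                                   ≡⟨ sumℤ²-cong n (λ x y → ≡.sym (at-xy x y)) ⟩
  sumℤ² n (λ x y → sumℤ² n λ i j → G x y i j)                 ≡⟨ sumℤ²-swap n G ⟩
  sumℤ² n (λ i j → sumℤ² n λ x y → G x y i j)                 ≡⟨ sumℤ²-cong n at-ij ⟩
  sumℤ² n V                                                   ∎
  where
  open ≡-Reasoning
  -- Double counting of the incidence (x , y) = (i + j , i - j), weighted by `W`: summing over (i ,
  -- j) first returns `W`, summing over (x , y) first returns `V`.
  G : ℤ → ℤ → ℤ → ℤ → ℤ
  G x y i j = δ x (i + j) * (δ y (i - j) * W x y)
  lemma₁ : ∀ i x → x ≡ i + (x - i)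
  lemma₁ = solve-∀
  lemma₂ : ∀ x y → y ≡ x + y - x
  lemma₂ = solve-∀
  lemma₃ : ∀ i x → i + i - x ≡ i - (x - i)
  lemma₃ = solve-∀
  lemma₄ : ∀ i j → i + j + (i - j) ≡ i + i
  lemma₄ = solve-∀
  lemma₅ : ∀ i j → j ≡ i + j - i
  lemma₅ = solve-∀
  lemma₆ : ∀ i x → x - i + (x - i) ≡ x + x - (i + i)
  lemma₆ = solve-∀
  lemma₇ : ∀ x y → x + x - (x + y) ≡ x + (- y)
  lemma₇ = solve-∀
  twice : ∀ i → i + i ≡ + 2 * i
  twice = solve-∀
  at-xy : ∀ x y → sumℤ² n (λ i j → G x y i j) ≡ W x y
  at-xy x y with W x y ℤ.≟ 0ℤ
  ... | yes W≡0 = ≡.trans (sumℤ²-0 n λ i j → δδ-off x y (i + j) (i - j) (W x y) λ _ _ → W≡0) (≡.sym W≡0)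
  ... | no W≢0 with support x y W≢0
  ... | x≤n , y≤n , i , 2i = ≡.trans
    -- From x = i + j the second coordinate must be x - i; its double is x - y, so `halve-≤` keeps
    -- it in the box as well.
    (sumℤ²-pick n i (x - i) (halve-≤ i x y 2i x≤n y≤n)
      (halve-≤ (x - i) x (- y) (≡.trans (lemma₆ i x) (≡.trans (cong (λ z → x + x - z) 2i) (lemma₇ x y))) x≤n
          (subst (_≤ n) (≡.sym (ℤₚ.∣-i∣≡∣i∣ y)) y≤n))
      λ i′ j′ off → δδ-off x y (i′ + j′) (i′ - j′) (W x y) λ { refl refl → contradiction
          (unique i′ j′ (≡.trans 2i (lemma₄ i′ j′))) off })
    (δδ-on x y (W x y) (lemma₁ i x) (≡.trans (lemma₂ x y) (≡.trans (cong (_- x) (≡.sym 2i)) (lemma₃ i x))))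
    where
    unique : ∀ i′ j′ → i + i ≡ i′ + i′ → i′ ≡ i × j′ ≡ i′ + j′ - i
    unique i′ j′ eq with ℤₚ.*-cancelˡ-≡ (+ 2) i i′ (≡.trans (≡.sym (twice i)) (≡.trans eq (twice i′)))
    ... | refl = refl , lemma₅ i j′
  at-ij : ∀ i j → sumℤ² n (λ x y → G x y i j) ≡ V i j
  at-ij i j with W (i + j) (i - j) ℤ.≟ 0ℤ
  ... | yes W≡0 = ≡.trans (sumℤ²-0 n λ x y → δδ-off x y (i + j) (i - j) (W x y) λ { refl refl → W≡0 })
      (≡.sym (≡.trans (V≡W i j) W≡0))
  ... | no W≢0 with support (i + j) (i - j) W≢0
  ... | x≤n , y≤n , _ = ≡.trans
    (sumℤ²-pick n (i + j) (i - j) x≤n y≤n λ x y off → δδ-off x y (i + j) (i - j) (W x y) λ x≡ y≡ → contradiction (x≡ , y≡) off)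
    (≡.trans (δδ-on (i + j) (i - j) (W (i + j) (i - j)) refl refl) (≡.sym (V≡W i j)))

sgn-neg : ∀ x → sgn (- x) ≡ sgn x
sgn-neg x = cong parity (ℤₚ.∣-i∣≡∣i∣ x)

sgn-suc : ∀ x → sgn (1ℤ + x) ≡ - sgn x
sgn-suc (+ n) = refl
sgn-suc -[1+ zero ] = refl
sgn-suc -[1+ suc n ] = ≡.sym (ℤₚ.neg-involutive (parity (suc n)))

sgn-+-nonneg : ∀ n y → sgn (+ n + y) ≡ sgn (+ n) * sgn y
sgn-+-nonneg zero y = ≡.trans (cong sgn (ℤₚ.+-identityˡ y)) (≡.sym (ℤₚ.*-identityˡ (sgn y)))
sgn-+-nonneg (suc n) y = begin
  sgn (+[1+ n ] + y)       ≡⟨ cong sgn (ℤₚ.+-assoc 1ℤ (+ n) y) ⟩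
  sgn (1ℤ + (+ n + y))     ≡⟨ sgn-suc (+ n + y) ⟩
  - sgn (+ n + y)          ≡⟨ cong -_ (sgn-+-nonneg n y) ⟩
  - (sgn (+ n) * sgn y)    ≡⟨ ℤₚ.neg-distribˡ-* (sgn (+ n)) (sgn y) ⟩
  - sgn (+ n) * sgn y      ∎
  where open ≡-Reasoning

sgn-+ : ∀ x y → sgn (x + y) ≡ sgn x * sgn y
sgn-+ (+ n) y = sgn-+-nonneg n y
sgn-+ -[1+ n ] y = begin
  sgn (-[1+ n ] + y)            ≡⟨ cong sgn (lemma +[1+ n ] y) ⟩
  sgn (- (+[1+ n ] + - y))      ≡⟨ sgn-neg (+[1+ n ] + - y) ⟩
  sgn (+[1+ n ] + - y)          ≡⟨ sgn-+-nonneg (suc n) (- y) ⟩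
  sgn +[1+ n ] * sgn (- y)      ≡⟨ cong (sgn +[1+ n ] *_) (sgn-neg y) ⟩
  sgn +[1+ n ] * sgn y          ∎
  where
  open ≡-Reasoning
  lemma : ∀ x y → - x + y ≡ - (x + - y)
  lemma = solve-∀

sgn-square : ∀ x → sgn x * sgn x ≡ 1ℤ
sgn-square x = go ∣ x ∣
  where
  lemma : ∀ x → - x * - x ≡ x * x
  lemma = solve-∀
  go : ∀ n → parity n * parity n ≡ 1ℤ
  go zero = refl
  go (suc n) = ≡.trans (lemma (parity n)) (go n)

even-or-odd : ∀ n → (∃ λ k → k ℕ.+ k ≡ n) ⊎ parity n ≡ - 1ℤ
even-or-odd 0 = inj₁ (0 , refl)
even-or-odd 1 = inj₂ refl
even-or-odd (suc (suc n)) with even-or-odd n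
... | inj₁ (k , refl) = inj₁ (suc k , cong suc (ℕₚ.+-suc k k))
... | inj₂ odd = inj₂ (≡.trans (ℤₚ.neg-involutive (parity n)) odd)

even-or-oddℤ : ∀ z → (∃ λ i → i + i ≡ z) ⊎ sgn z ≡ - 1ℤ
even-or-oddℤ z with even-or-odd ∣ z ∣
... | inj₂ odd = inj₂ odd
... | inj₁ (k , 2k) = inj₁ (go z 2k)
  where
  go : ∀ z → k ℕ.+ k ≡ ∣ z ∣ → ∃ λ i → i + i ≡ z
  go (+ n) refl = + k , refl
  go -[1+ n ] eq = - + k , ≡.trans (≡.sym (ℤₚ.neg-distrib-+ (+ k) (+ k))) (cong (λ m → - + m) eq)

-- Products of theta series as sums over ℤ²

module Lattice (d : ℕ) where
  open Dissection d public

  Σℤ-⊛ : ∀ n f b → Σℤ n f ⊛ b ≈ Σℤ n (λ x → f x ⊛ b)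
  Σℤ-⊛ zero f b = ≈-refl
  Σℤ-⊛ (suc n) f b = linear (const 1ℤ) (Σℤ-⊛ n f b)
    (solve 5 (λ s u v b s′ → (s :+ (u :+ v)) :* b :+ con 1ℤ :* s′ := s′ :+ (u :* b :+ v :* b) :+ con 1ℤ :* (s :* b))
      ≈-refl (Σℤ n f) (f +[1+ n ]) (f -[1+ n ]) b (Σℤ n (λ x → f x ⊛ b)))

  ⊛-Σℤ : ∀ n a f → a ⊛ Σℤ n f ≈ Σℤ n (λ x → a ⊛ f x)
  ⊛-Σℤ n a f = ≈-trans (solve 2 (λ a b → a :* b := b :* a) ≈-refl a (Σℤ n f))
    (≈-trans (Σℤ-⊛ n f a) (Σℤ-cong (λ x → solve 2 (λ a b → a :* b := b :* a) ≈-refl (f x) a) n))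

  Σℤ-⊛-Σℤ : ∀ n f g → Σℤ n f ⊛ Σℤ n g ≈ Σℤ n (λ x → Σℤ n λ y → f x ⊛ g y)
  Σℤ-⊛-Σℤ n f g = ≈-trans (Σℤ-⊛ n f (Σℤ n g)) (Σℤ-cong (λ x → ⊛-Σℤ n (f x) g) n)

  -- Adding the two placements of the sign gives the weight (-1)^x + (-1)^y, which vanishes unless x
  -- and y have equal parity. On the remaining pairs x = i + j and y = i - j, and the weight is
  -- 2(-1)^i (-1)^j.
  theta-rotate : ∀ {e₁ e₂ e₃} → (∀ x → ∣ x ∣ ≤ e₁ x) → (∀ x → ∣ x ∣ ≤ e₂ x) → (∀ x → ∣ x ∣ ≤ e₃ x) →
    (∀ i j → e₁ (i + j) ℕ.+ e₂ (i - j) ≡ e₃ i ℕ.+ e₃ j) →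
    theta one e₁ ⊛ theta sgn e₂ ⊕ theta sgn e₁ ⊛ theta one e₂ ≈ const (+ 2) ⊛ (theta sgn e₃ ⊛ theta sgn e₃)
  theta-rotate {e₁} {e₂} {e₃} b₁ b₂ b₃ e₁+e₂≡e₃+e₃ = trunc⇒≈ λ N →
    trunc-trans (trunc-⊕ (trunc-⊛ (theta-trunc one b₁ ℕₚ.≤-refl) (theta-trunc sgn b₂ ℕₚ.≤-refl))
        (trunc-⊛ (theta-trunc sgn b₁ ℕₚ.≤-refl) (theta-trunc one b₂ ℕₚ.≤-refl)))
    (trunc-trans (≈⇒trunc (left N))
    (trunc-trans (trunc λ m≤N → ~-reflexive (rotate N _ m≤N))
    (trunc-sym (trunc-trans (trunc-⊛ (≈⇒trunc (≈-refl {const (+ 2)})) (trunc-⊛ (theta-trunc sgn b₃ {N} ℕₚ.≤-refl)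
        (theta-trunc sgn b₃ ℕₚ.≤-refl))) (≈⇒trunc (right N))))))
    where
    w v : ℤ → ℤ → Series
    w x y = const (sgn x + sgn y) ⊛ q^ (e₁ x ℕ.+ e₂ y)
    v i j = const (+ 2 * (sgn i * sgn j)) ⊛ q^ (e₃ i ℕ.+ e₃ j)

    const-+ : ∀ x y → const (x + y) ≈ const x ⊕ const y
    const-+ x y = from≡ λ { zero → refl ; (suc n) → refl }

    left : ∀ n → Σℤ n (thetaTerm one e₁) ⊛ Σℤ n (thetaTerm sgn e₂) ⊕ Σℤ n (thetaTerm sgn e₁) ⊛ Σℤ n (thetaTerm one e₂) ≈ Σℤ n
        (λ x → Σℤ n (w x))
    left n = ≈-trans (Σℤ-⊛-Σℤ n (thetaTerm one e₁) (thetaTerm sgn e₂) ⟨+⟩ Σℤ-⊛-Σℤ n (thetaTerm sgn e₁) (thetaTerm one e₂))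
      (≈-trans (from≡ λ m → ≡.sym (≡.trans (sumℤ-cong n λ x → sumℤ-+ n (λ y → (thetaTerm one e₁ x ⊛ thetaTerm sgn e₂ y) m)
          (λ y → (thetaTerm sgn e₁ x ⊛ thetaTerm one e₂ y) m))
                                           (sumℤ-+ n (λ x → sumℤ n λ y → (thetaTerm one e₁ x ⊛ thetaTerm sgn e₂ y) m)
                                               (λ x → sumℤ n λ y → (thetaTerm sgn e₁ x ⊛ thetaTerm one e₂ y) m))))
      (Σℤ-cong (λ x → Σℤ-cong (term x) n) n))
      where
      term : ∀ x y → thetaTerm one e₁ x ⊛ thetaTerm sgn e₂ y ⊕ thetaTerm sgn e₁ x ⊛ thetaTerm one e₂ y ≈ w x y
      term x y =
        linear (⊖ q^ (e₁ x ℕ.+ e₂ y)) (const-+ (sgn x) (sgn y))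
        (linear (⊖ (const (sgn x) ⊕ const (sgn y))) (q^-+ (e₁ x) (e₂ y))
        (solve 6 (λ s t u p q r →
          (con 1ℤ :* p) :* (t :* q) :+ (s :* p) :* (con 1ℤ :* q) :+ (:- r) :* (s :+ t) :+ (:- (s :+ t)) :* (p :* q)
          := u :* r :+ (:- r) :* u :+ (:- (s :+ t)) :* r)
          ≈-refl (const (sgn x)) (const (sgn y)) (const (sgn x + sgn y)) (q^ (e₁ x)) (q^ (e₂ y)) (q^ (e₁ x ℕ.+ e₂ y))))

    right : ∀ n → const (+ 2) ⊛ (Σℤ n (thetaTerm sgn e₃) ⊛ Σℤ n (thetaTerm sgn e₃)) ≈ Σℤ n (λ i → Σℤ n (v i))
    right n = ≈-trans (≈-refl {const (+ 2)} ⟨*⟩ Σℤ-⊛-Σℤ n (thetaTerm sgn e₃) (thetaTerm sgn e₃))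
      (≈-trans (⊛-Σℤ n (const (+ 2)) (λ i → Σℤ n λ j → thetaTerm sgn e₃ i ⊛ thetaTerm sgn e₃ j))
      (Σℤ-cong (λ i → ≈-trans (⊛-Σℤ n (const (+ 2)) (λ j → thetaTerm sgn e₃ i ⊛ thetaTerm sgn e₃ j)) (Σℤ-cong (term i) n)) n))
      where
      term : ∀ i j → const (+ 2) ⊛ (thetaTerm sgn e₃ i ⊛ thetaTerm sgn e₃ j) ≈ v i j
      term i j =
        linear (⊖ q^ (e₃ i ℕ.+ e₃ j)) (const-* (+ 2) (sgn i * sgn j))
        (linear (⊖ (const (+ 2) ⊛ q^ (e₃ i ℕ.+ e₃ j))) (const-* (sgn i) (sgn j))
        (linear (⊖ (const (+ 2) ⊛ (const (sgn i) ⊛ const (sgn j)))) (q^-+ (e₃ i) (e₃ j))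
        (solve 7 (λ s t st u p q r →
          con (+ 2) :* ((s :* p) :* (t :* q)) :+ (:- r) :* (con (+ 2) :* st) :+ (:- (con (+ 2) :* r)) :* (s :* t) :+
              (:- (con (+ 2) :* (s :* t))) :* (p :* q)
          := u :* r :+ (:- r) :* u :+ (:- (con (+ 2) :* r)) :* st :+ (:- (con (+ 2) :* (s :* t))) :* r)
          ≈-refl (const (sgn i)) (const (sgn j)) (const (sgn i * sgn j)) (const (+ 2 * (sgn i * sgn j))) (q^ (e₃ i))
              (q^ (e₃ j)) (q^ (e₃ i ℕ.+ e₃ j)))))

    rotate : ∀ N m → m ≤ N → sumℤ² N (λ x y → w x y m) ≡ sumℤ² N (λ i j → v i j m)
    rotate N m m≤N = sumℤ²-rotate N _ _ v≡w λ x y w≢0 →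
      ℕₚ.≮⇒≥ (λ N<x → w≢0 (vanish x y (ℕₚ.≤-trans (ℕₚ.<-≤-trans N<x (b₁ x)) (ℕₚ.m≤m+n (e₁ x) (e₂ y))))) ,
      ℕₚ.≮⇒≥ (λ N<y → w≢0 (vanish x y (ℕₚ.≤-trans (ℕₚ.<-≤-trans N<y (b₂ y)) (ℕₚ.m≤n+m (e₂ y) (e₁ x))))) ,
      same-parity x y w≢0
      where
      vanish : ∀ x y → N < e₁ x ℕ.+ e₂ y → w x y m ≡ 0ℤ
      vanish x y N<e = ≡.trans (const-⊛ (sgn x + sgn y) (q^ (e₁ x ℕ.+ e₂ y)) m)
        (≡.trans (cong ((sgn x + sgn y) *_) (q^-below _ m (ℕₚ.≤-<-trans m≤N N<e))) (ℤₚ.*-zeroʳ (sgn x + sgn y)))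
      same-parity : ∀ x y → w x y m ≢ 0ℤ → ∃ λ i → i + i ≡ x + y
      same-parity x y w≢0 with even-or-oddℤ (x + y)
      ... | inj₁ even = even
      ... | inj₂ odd = contradiction (≡.trans (const-⊛ (sgn x + sgn y) (q^ (e₁ x ℕ.+ e₂ y)) m)
          (cong (_* (q^ (e₁ x ℕ.+ e₂ y)) m) opposite)) w≢0
        where
        -- Both brackets vanish once st = -1 and ss = 1.
        lemma : ∀ s t → s + t ≡ s * (s * t + 1ℤ) + t * (1ℤ + - (s * s))
        lemma = solve-∀
        lemma₂ : ∀ s t → s * (- 1ℤ + 1ℤ) + t * (1ℤ + - 1ℤ) ≡ 0ℤ
        lemma₂ = solve-∀
        opposite : sgn x + sgn y ≡ 0ℤ
        opposite = ≡.trans (lemma (sgn x) (sgn y))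
          (≡.trans (cong₂ (λ a b → sgn x * (a + 1ℤ) + sgn y * (1ℤ + - b)) (≡.trans (≡.sym (sgn-+ x y)) odd) (sgn-square x))
              (lemma₂ (sgn x) (sgn y)))
      twice : ∀ x → + 2 * x ≡ x + x
      twice = solve-∀
      v≡w : ∀ i j → v i j m ≡ w (i + j) (i - j) m
      v≡w i j rewrite sgn-+ i j | sgn-+ i (- j) | sgn-neg j | e₁+e₂≡e₃+e₃ i j | twice (sgn i * sgn j) = refl

-- The generating function of RD

-- Global form of the local `choose` in `cnt`; as a series it is multiplication by q^e.
shiftℕ : ℕ → (ℕ → ℕ) → ℕ → ℕ
shiftℕ e a m with e ℕ.≤? m
... | yes _ = a (m ℕ.∸ e)
... | no _ = 0

cnt-step : ∀ k m → 4 ∤ suc k → cnt (suc k) m ≡ sum (map (λ j → shiftℕ (j ℕ.* suc k) (cnt k) m) (upTo 9))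
-- The truth of j * suc k ≤ m is decreasing in j, so only nine of the 2⁸ combinations occur.
cnt-step k m 4∤ with 4 ∣? suc k
... | yes 4∣ = contradiction 4∣ 4∤
... | no _ with 1 ℕ.* suc k ℕ.≤? m | 2 ℕ.* suc k ℕ.≤? m | 3 ℕ.* suc k ℕ.≤? m | 4 ℕ.* suc k ℕ.≤? m | 5 ℕ.* suc k ℕ.≤? m | 6 ℕ.*
    suc k ℕ.≤? m | 7 ℕ.* suc k ℕ.≤? m | 8 ℕ.* suc k ℕ.≤? m
...   | yes _ | yes _ | yes _ | yes _ | yes _ | yes _ | yes _ | yes _ = refl
...   | yes _ | yes _ | yes _ | yes _ | yes _ | yes _ | yes _ | no _ = refl
...   | yes _ | yes _ | yes _ | yes _ | yes _ | yes _ | no _ | no _ = refl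
...   | yes _ | yes _ | yes _ | yes _ | yes _ | no _ | no _ | no _ = refl
...   | yes _ | yes _ | yes _ | yes _ | no _ | no _ | no _ | no _ = refl
...   | yes _ | yes _ | yes _ | no _ | no _ | no _ | no _ | no _ = refl
...   | yes _ | yes _ | no _ | no _ | no _ | no _ | no _ | no _ = refl
...   | yes _ | no _ | no _ | no _ | no _ | no _ | no _ | no _ = refl
...   | no _ | no _ | no _ | no _ | no _ | no _ | no _ | no _ = refl
...   | no ≰ | yes ≤ | _ | _ | _ | _ | _ | _ = contradiction (ℕₚ.m+n≤o⇒n≤o (suc k) ≤) ≰
...   | _ | no ≰ | yes ≤ | _ | _ | _ | _ | _ = contradiction (ℕₚ.m+n≤o⇒n≤o (suc k) ≤) ≰
...   | _ | _ | no ≰ | yes ≤ | _ | _ | _ | _ = contradiction (ℕₚ.m+n≤o⇒n≤o (suc k) ≤) ≰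
...   | _ | _ | _ | no ≰ | yes ≤ | _ | _ | _ = contradiction (ℕₚ.m+n≤o⇒n≤o (suc k) ≤) ≰
...   | _ | _ | _ | _ | no ≰ | yes ≤ | _ | _ = contradiction (ℕₚ.m+n≤o⇒n≤o (suc k) ≤) ≰
...   | _ | _ | _ | _ | _ | no ≰ | yes ≤ | _ = contradiction (ℕₚ.m+n≤o⇒n≤o (suc k) ≤) ≰
...   | _ | _ | _ | _ | _ | _ | no ≰ | yes ≤ = contradiction (ℕₚ.m+n≤o⇒n≤o (suc k) ≤) ≰

-- Theta exponents as integer polynomials

+square : ∀ c x → + square c x ≡ + c * (x * x)
+square c x = ≡.trans (ℤₚ.pos-* c (∣ x ∣ ℕ.* ∣ x ∣)) (cong (+ c *_) (go x))
  where
  go : ∀ x → + (∣ x ∣ ℕ.* ∣ x ∣) ≡ x * x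
  go (+ n) = ℤₚ.pos-* n n
  go -[1+ n ] = refl

+ω : ∀ x → + ω x ≡ + 3 * (x * x) + + 2 * x
+ω (+ n) = ≡.trans (ℤₚ.pos-* n (3 ℕ.* n ℕ.+ 2)) (≡.trans (cong (λ y → + n * (y + + 2)) (ℤₚ.pos-* 3 n)) (lemma (+ n)))
  where
  lemma : ∀ x → x * (+ 3 * x + + 2) ≡ + 3 * (x * x) + + 2 * x
  lemma = solve-∀
+ω -[1+ n ] = ≡.trans (ℤₚ.pos-* (suc n) (3 ℕ.* n ℕ.+ 1)) (≡.trans (cong (λ y → +[1+ n ] * (y + 1ℤ)) (ℤₚ.pos-* 3 n))
    (lemma (+ n)))
  where
  lemma : ∀ x → (1ℤ + x) * (+ 3 * x + 1ℤ) ≡ + 3 * (- (1ℤ + x) * - (1ℤ + x)) + + 2 * - (1ℤ + x)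
  lemma = solve-∀

+pentagonal : ∀ x → + pentagonal x ≡ + 6 * (x * x) + + 2 * x
+pentagonal (+ n) = ≡.trans (ℤₚ.pos-* n (6 ℕ.* n ℕ.+ 2)) (≡.trans (cong (λ y → + n * (y + + 2)) (ℤₚ.pos-* 6 n)) (lemma (+ n)))
  where
  lemma : ∀ x → x * (+ 6 * x + + 2) ≡ + 6 * (x * x) + + 2 * x
  lemma = solve-∀
+pentagonal -[1+ n ] = ≡.trans (ℤₚ.pos-* (suc n) (6 ℕ.* n ℕ.+ 4)) (≡.trans (cong (λ y → +[1+ n ] * (y + + 4)) (ℤₚ.pos-* 6 n))
    (lemma (+ n)))
  where
  lemma : ∀ x → (1ℤ + x) * (+ 6 * x + + 4) ≡ + 6 * (- (1ℤ + x) * - (1ℤ + x)) + + 2 * - (1ℤ + x)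
  lemma = solve-∀

-- Checked after casting to ℤ, where the case distinctions on signs are gone and a polynomial
-- identity remains.
square-rotate : ∀ i j → square 1 (i + j) ℕ.+ square 1 (i - j) ≡ square 2 i ℕ.+ square 2 j
square-rotate i j = ℤₚ.+-injective (≡.trans (cong₂ _+_ (+square 1 (i + j)) (+square 1 (i - j)))
  (≡.trans (lemma i j) (≡.sym (cong₂ _+_ (+square 2 i) (+square 2 j)))))
  where
  lemma : ∀ i j → 1ℤ * ((i + j) * (i + j)) + 1ℤ * ((i - j) * (i - j)) ≡ + 2 * (i * i) + + 2 * (j * j)
  lemma = solve-∀

-- Both quadratic parts have coefficient 3, so the cross terms 6ij and -6ij cancel, while 2(i + j)
-- is already a sum of a term in i and a term in j. This is what pairs Ω with φ(±q³).
ω-rotate : ∀ i j → 1 ℕ.* ω (i + j) ℕ.+ square 3 (i - j) ≡ pentagonal i ℕ.+ pentagonal j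
ω-rotate i j = ℤₚ.+-injective (≡.trans (cong₂ _+_ (≡.trans (cong +_ (ℕₚ.*-identityˡ (ω (i + j)))) (+ω (i + j)))
    (+square 3 (i - j)))
  (≡.trans (lemma i j) (≡.sym (cong₂ _+_ (+pentagonal i) (+pentagonal j)))))
  where
  lemma : ∀ i j → + 3 * ((i + j) * (i + j)) + + 2 * (i + j) + + 3 * ((i - j) * (i - j)) ≡ + 6 * (i * i) + + 2 * i +
      (+ 6 * (j * j) + + 2 * j)
  lemma = solve-∀

-- The product formula for `RD`

Cnt : ℕ → Series
Cnt k m = + cnt k m

RD : Series
RD n = + RD49 n

-- Partial products of f_c / f_(4c), branching on 4 ∣ `suc k` exactly as `cnt` does.
D : ℕ → ℕ → Series
D c zero = const 1ℤ
D c (suc k) with 4 ∣? suc k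
... | yes _ = D c k
... | no _ = D c k ⊛ (const 1ℤ ⊕ ⊖ q^ (c ℕ.* suc k))

D-∤ : ∀ c k → 4 ∤ suc k → D c (suc k) ≡ D c k ⊛ (const 1ℤ ⊕ ⊖ q^ (c ℕ.* suc k))
D-∤ c k 4∤ with 4 ∣? suc k
... | yes 4∣ = contradiction 4∣ 4∤
... | no _ = refl

D-∣ : ∀ c k → 4 ∣ suc k → D c (suc k) ≡ D c k
D-∣ c k 4∣ with 4 ∣? suc k
... | yes _ = refl
... | no 4∤ = contradiction 4∣ 4∤

cnt-∣ : ∀ k m → 4 ∣ suc k → cnt (suc k) m ≡ cnt k m
cnt-∣ k m 4∣ with 4 ∣? suc k
... | yes _ = refl
... | no 4∤ = contradiction 4∣ 4∤

q^-⊛-below : ∀ {e m} b → m < e → (q^ e ⊛ b) m ≡ 0ℤ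
q^-⊛-below {suc e} {zero} b m<e = refl
q^-⊛-below {suc e} {suc m} b (s≤s m<e) = ≡.trans (ℤₚ.+-identityˡ _) (q^-⊛-below b m<e)

q^-⊛-shift : ∀ e b m → (q^ e ⊛ b) (e ℕ.+ m) ≡ b m
q^-⊛-shift zero b m = ⊛-identityˡ b m
q^-⊛-shift (suc e) b m = ≡.trans (ℤₚ.+-identityˡ _) (q^-⊛-shift e b m)

+shiftℕ : ∀ e a m → + shiftℕ e a m ≡ (q^ e ⊛ λ n → + a n) m
+shiftℕ e a m with e ℕ.≤? m
... | yes e≤m = ≡.sym (≡.trans (cong (q^ e ⊛ λ n → + a n) (≡.sym (ℕₚ.m+[n∸m]≡n e≤m))) (q^-⊛-shift e (λ n → + a n) (m ℕ.∸ e)))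
... | no e≰m = ≡.sym (q^-⊛-below (λ n → + a n) (ℕₚ.≰⇒> e≰m))

sumℕ-cong : ∀ n {f g} → (∀ s → f s ≡ g s) → sumℕ n f ≡ sumℕ n g
sumℕ-cong zero e = e 0
sumℕ-cong (suc n) e = cong₂ _+_ (sumℕ-cong n e) (e (suc n))

Σℕ-⊛ : ∀ n f b m → (Σℕ n f ⊛ b) m ≡ sumℕ n λ s → (f s ⊛ b) m
Σℕ-⊛ zero f b m = refl
Σℕ-⊛ (suc n) f b m = ≡.trans (⊛-distribʳ b (Σℕ n f) (f (suc n)) m) (cong (_+ (f (suc n) ⊛ b) m) (Σℕ-⊛ n f b m))

Cnt-∤ : ∀ k m → 4 ∤ suc k → Cnt (suc k) m ≡ (Σℕ 8 (λ j → q^ (j ℕ.* suc k)) ⊛ Cnt k) m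
Cnt-∤ k m 4∤ = begin
  + cnt (suc k) m                                                  ≡⟨ cong +_ (cnt-step k m 4∤) ⟩
  + sum (map (λ j → shiftℕ (j ℕ.* suc k) (cnt k) m) (upTo 9))      ≡⟨ cong +_ (reassociate (λ j → shiftℕ (j ℕ.* suc k)
      (cnt k) m)) ⟩
  sumℕ 8 (λ j → + shiftℕ (j ℕ.* suc k) (cnt k) m)                  ≡⟨ sumℕ-cong 8 (λ j → +shiftℕ (j ℕ.* suc k) (cnt k) m) ⟩
  sumℕ 8 (λ j → (q^ (j ℕ.* suc k) ⊛ Cnt k) m)                      ≡⟨ Σℕ-⊛ 8 (λ j → q^ (j ℕ.* suc k)) (Cnt k) m ⟨
  (Σℕ 8 (λ j → q^ (j ℕ.* suc k)) ⊛ Cnt k) m                        ∎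
  where
  open ≡-Reasoning
  lemma : ∀ a b c d e f g h i → a ℕ.+ (b ℕ.+ (c ℕ.+ (d ℕ.+ (e ℕ.+ (f ℕ.+ (g ℕ.+ (h ℕ.+ (i ℕ.+ 0))))))))
      ≡ a ℕ.+ b ℕ.+ c ℕ.+ d ℕ.+ e ℕ.+ f ℕ.+ g ℕ.+ h ℕ.+ i
  lemma = ℕ-solve-∀
  reassociate : ∀ f → sum (map f (upTo 9)) ≡ f 0 ℕ.+ f 1 ℕ.+ f 2 ℕ.+ f 3 ℕ.+ f 4 ℕ.+ f 5 ℕ.+ f 6 ℕ.+ f 7 ℕ.+ f 8
  reassociate f = lemma (f 0) (f 1) (f 2) (f 3) (f 4) (f 5) (f 6) (f 7) (f 8)

module Partitions (d : ℕ) where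
  open Lattice d public

  geometric : ∀ e n → (const 1ℤ ⊕ ⊖ q^ e) ⊛ Σℕ n (λ j → q^ (j ℕ.* e)) ≈ const 1ℤ ⊕ ⊖ q^ (suc n ℕ.* e)
  geometric e zero = ≈-trans (solve 1 (λ X → (con 1ℤ :+ :- X) :* con 1ℤ := con 1ℤ :+ :- X) ≈-refl (q^ e))
    (≈-refl {const 1ℤ} ⟨+⟩ ⊖-cong (q^-≡ (≡.sym (ℕₚ.*-identityˡ e))))
  geometric e (suc n) =
    linear (const 1ℤ) (geometric e n)
    (linear (⊖ const 1ℤ) (≈-sym (q^-+ e (suc n ℕ.* e)))
    (solve 4 (λ X S Y Z → (con 1ℤ :+ :- X) :* (S :+ Y) :+ con 1ℤ :* (con 1ℤ :+ :- Y) :+ (:- con 1ℤ) :* Z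
      := con 1ℤ :+ :- Z :+ con 1ℤ :* ((con 1ℤ :+ :- X) :* S) :+ (:- con 1ℤ) :* (X :* Y))
      ≈-refl (q^ e) (Σℕ n (λ j → q^ (j ℕ.* e))) (q^ (suc n ℕ.* e)) (q^ (suc (suc n) ℕ.* e))))

  -- The multiplicities 0 to 8 of the part k + 1 contribute nine terms of a geometric series, which
  -- the factor 1 - q^(k+1) closes up to 1 - q^(9(k+1)).
  Cnt-step : ∀ k → 4 ∤ suc k → (const 1ℤ ⊕ ⊖ q^ (suc k)) ⊛ Cnt (suc k) ≈ (const 1ℤ ⊕ ⊖ q^ (9 ℕ.* suc k)) ⊛ Cnt k
  Cnt-step k 4∤ =
    linear (const 1ℤ ⊕ ⊖ q^ (suc k)) (from≡ λ m → Cnt-∤ k m 4∤)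
    (linear (Cnt k) (geometric (suc k) 8)
    (solve 5 (λ X Y C C′ S → (con 1ℤ :+ :- X) :* C′ :+ (con 1ℤ :+ :- X) :* (S :* C) :+ C :* (con 1ℤ :+ :- Y)
      := (con 1ℤ :+ :- Y) :* C :+ (con 1ℤ :+ :- X) :* C′ :+ C :* ((con 1ℤ :+ :- X) :* S))
      ≈-refl (q^ (suc k)) (q^ (9 ℕ.* suc k)) (Cnt k) (Cnt (suc k)) (Σℕ 8 (λ j → q^ (j ℕ.* suc k)))))

  -- Read off from `Cnt-step`, both of whose factors are 1 up to q^k; no combinatorial argument
  -- about large parts is made.
  Cnt-converges : Converges Cnt
  Cnt-converges k = go (4 ∣? suc k)
    where
    kill : ∀ {e N} a → N < e → (const 1ℤ ⊕ ⊖ q^ e) ⊛ a ≈[ N ] a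
    kill a N<e = trunc-trans (trunc-⊛ (trunc-⊕ (≈⇒trunc (≈-refl {const 1ℤ})) (trunc-⊖ (q^-trunc N<e))) (≈⇒trunc (≈-refl {a})))
      (≈⇒trunc (solve 1 (λ a → (con 1ℤ :+ :- con 0ℤ) :* a := a) ≈-refl a))
    go : Dec (4 ∣ suc k) → Cnt (suc k) ≈[ k ] Cnt k
    go (yes 4∣) = ≈⇒trunc (from≡ λ m → cong +_ (cnt-∣ k m 4∣))
    go (no 4∤) = trunc-trans (trunc-sym (kill (Cnt (suc k)) ℕₚ.≤-refl))
      (trunc-trans (≈⇒trunc (Cnt-step k 4∤)) (kill (Cnt k) (ℕₚ.m≤n*m (suc k) 9)))

  ≡⇒≈ : ∀ {a b : Series} → a ≡ b → a ≈ b
  ≡⇒≈ refl = ≈-refl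

  Cnt-D : ∀ k → Cnt k ⊛ D 1 k ≈ D 9 k
  Cnt-D zero = ≈-trans (from≡ {Cnt 0} {const 1ℤ} (λ { zero → refl ; (suc n) → refl }) ⟨*⟩ ≈-refl)
      (solve 0 (con 1ℤ :* con 1ℤ := con 1ℤ) ≈-refl)
  Cnt-D (suc k) = go (4 ∣? suc k)
    where
    go : Dec (4 ∣ suc k) → Cnt (suc k) ⊛ D 1 (suc k) ≈ D 9 (suc k)
    go (yes 4∣) = ≈-trans (from≡ (λ m → cong +_ (cnt-∣ k m 4∣)) ⟨*⟩ ≡⇒≈ (D-∣ 1 k 4∣)) (≈-trans (Cnt-D k)
        (≈-sym (≡⇒≈ (D-∣ 9 k 4∣))))
    go (no 4∤) =
      linear (Cnt (suc k)) (≡⇒≈ (D-∤ 1 k 4∤))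
      (linear (⊖ const 1ℤ) (≡⇒≈ (D-∤ 9 k 4∤))
      (linear (D 1 k) (Cnt-step k 4∤)
      (linear (const 1ℤ ⊕ ⊖ q^ (9 ℕ.* suc k)) (Cnt-D k)
      (linear (⊖ (Cnt (suc k) ⊛ D 1 k)) (q^-≡ (ℕₚ.*-identityˡ (suc k)))
      (solve 9 (λ C C′ X X′ Y D D′ E E′ →
        C′ :* E :+ C′ :* (D :* (con 1ℤ :+ :- X′)) :+ (:- con 1ℤ) :* (D′ :* (con 1ℤ :+ :- Y))
          :+ D :* ((con 1ℤ :+ :- Y) :* C) :+ (con 1ℤ :+ :- Y) :* D′ :+ (:- (C′ :* D)) :* X
        := E′ :+ C′ :* E :+ (:- con 1ℤ) :* E′ :+ D :* ((con 1ℤ :+ :- X) :* C′) :+ (con 1ℤ :+ :- Y) :* (C :* D) :+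
            (:- (C′ :* D)) :* X′)
        ≈-refl (Cnt k) (Cnt (suc k)) (q^ suc k) (q^ (1 ℕ.* suc k)) (q^ (9 ℕ.* suc k)) (D 1 k) (D 9 k) (D 1 (suc k))
            (D 9 (suc k)))))))

  -- Among the first 4n factors of f_c, those skipped by `D` have index 4j and make up
  -- `Π (c * 4) n`. One induction step therefore covers four indices.
  D-Π : ∀ c n → D c (n ℕ.* 4) ⊛ Π (c ℕ.* 4) n ≈ Π c (n ℕ.* 4)
  D-Π c zero = solve 0 (con 1ℤ :* con 1ℤ := con 1ℤ) ≈-refl
  D-Π c (suc n) =
    linear (Π (c ℕ.* 4) (suc n)) D-step
    (linear (u ⊛ v ⊛ w ⊛ (const 1ℤ ⊕ ⊖ q^ (c ℕ.* 4 ℕ.* suc n))) (D-Π c n)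
    (linear (⊖ (Π c (n ℕ.* 4) ⊛ u ⊛ v ⊛ w)) (q^-≡ (exponent c n))
    (solve 9 (λ D D′ P R u v w X Y →
      D′ :* (P :* (con 1ℤ :+ :- X)) :+ (P :* (con 1ℤ :+ :- X)) :* (D :* u :* v :* w) :+ u :* v :* w :* (con 1ℤ :+ :- X) :* R :+
          (:- (R :* u :* v :* w)) :* Y
      := R :* u :* v :* w :* (con 1ℤ :+ :- Y) :+ (P :* (con 1ℤ :+ :- X)) :* D′ :+ u :* v :* w :* (con 1ℤ :+ :- X) :*
          (D :* P) :+ (:- (R :* u :* v :* w)) :* X)
      ≈-refl (D c (n ℕ.* 4)) (D c (suc n ℕ.* 4)) (Π (c ℕ.* 4) n) (Π c (n ℕ.* 4)) u v w (q^ (c ℕ.* 4 ℕ.* suc n))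
          (q^ (c ℕ.* (suc n ℕ.* 4))))))
    where
    exponent : ∀ c n → c ℕ.* 4 ℕ.* suc n ≡ c ℕ.* (suc n ℕ.* 4)
    exponent = ℕ-solve-∀
    factor : ℕ → Series
    factor k = const 1ℤ ⊕ ⊖ q^ (c ℕ.* k)
    u = factor (1 ℕ.+ n ℕ.* 4)
    v = factor (2 ℕ.+ n ℕ.* 4)
    w = factor (3 ℕ.+ n ℕ.* 4)
    4∤ : ∀ r → 0 < r → r < 4 → 4 ∤ r ℕ.+ n ℕ.* 4
    4∤ (suc r) _ r<4 4∣ = ℕₚ.<⇒≱ r<4 (∣⇒≤ (∣m+n∣m⇒∣n (subst (4 ∣_) (ℕₚ.+-comm (suc r) (n ℕ.* 4)) 4∣) (divides n refl)))
    D-step : D c (suc n ℕ.* 4) ≈ D c (n ℕ.* 4) ⊛ u ⊛ v ⊛ w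
    D-step = ≈-trans (≡⇒≈ (D-∣ c (3 ℕ.+ n ℕ.* 4) (divides (suc n) refl)))
      (≈-trans (≡⇒≈ (D-∤ c (2 ℕ.+ n ℕ.* 4) (4∤ 3 (s≤s z≤n) (s≤s (s≤s (s≤s (s≤s z≤n)))))))
      (≈-trans (≡⇒≈ (D-∤ c (1 ℕ.+ n ℕ.* 4) (4∤ 2 (s≤s z≤n) (s≤s (s≤s (s≤s z≤n))))) ⟨*⟩ ≈-refl {w})
      (≡⇒≈ (D-∤ c (n ℕ.* 4) (4∤ 1 (s≤s z≤n) (s≤s (s≤s z≤n)))) ⟨*⟩ ≈-refl {v} ⟨*⟩ ≈-refl {w})))

  -- `RD` unfolds to `lim Cnt`. Stage 4N is chosen so that `D-Π` applies to `D 1` and to `D 9`; the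
  -- latter produces f_36 from 9 · 4.
  RD-product : RD ⊛ η 1 ⊛ η 36 ≈ η 9 ⊛ η 4
  RD-product = trunc⇒≈ λ N → let n = N ℕ.* 4; N≤n = ℕₚ.m≤m*n N 4 in
    trunc-trans (trunc-⊛ (trunc-⊛ (lim-trunc Cnt-converges N≤n) (η-trunc 1 N≤n)) (η-trunc 36 ℕₚ.≤-refl))
    (trunc-trans (≈⇒trunc
      (linear (Cnt n ⊛ Π 36 N) (≈-sym (D-Π 1 N))
      (linear (Π 36 N ⊛ Π 4 N) (Cnt-D n)
      (linear (Π 4 N) (D-Π 9 N)
      (solve 7 (λ C D₁ D₉ P₁ P₄ P₉ P₃₆ → C :* P₁ :* P₃₆ :+ C :* P₃₆ :* (D₁ :* P₄) :+ P₃₆ :* P₄ :* D₉ :+ P₄ :* P₉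
        := P₉ :* P₄ :+ C :* P₃₆ :* P₁ :+ P₃₆ :* P₄ :* (C :* D₁) :+ P₄ :* (D₉ :* P₃₆))
        ≈-refl (Cnt n) (D 1 n) (D 9 n) (Π 1 n) (Π 4 N) (Π 9 n) (Π 36 N))))))
    (trunc-sym (trunc-⊛ (η-trunc 9 N≤n) (η-trunc 4 ℕₚ.≤-refl))))

-- The trisection of ψ

sumℕ-mod-3 : ∀ n h → sumℕ (suc (suc (n ℕ.* 3))) h ≡ sumℕ n (λ u → h (u ℕ.* 3) + (h (suc (u ℕ.* 3)) + h (suc (suc (u ℕ.* 3)))))
sumℕ-mod-3 zero h = lemma (h 0) (h 1) (h 2)
  where
  lemma : ∀ a b c → a + b + c ≡ a + (b + c)
  lemma = solve-∀
sumℕ-mod-3 (suc n) h rewrite sumℕ-mod-3 n h = lemma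
    (sumℕ n (λ u → h (u ℕ.* 3) + (h (suc (u ℕ.* 3)) + h (suc (suc (u ℕ.* 3)))))) (h m) (h (suc m)) (h (suc (suc m)))
  where
  m = suc n ℕ.* 3
  lemma : ∀ s a b c → s + a + b + c ≡ s + (a + (b + c))
  lemma = solve-∀

-- (3u² + u)/2
trisected : ℕ → ℕ
trisected zero = 0
trisected (suc u) = trisected u ℕ.+ (3 ℕ.* u ℕ.+ 2)

triangle-3u : ∀ u → triangle (u ℕ.* 3) ≡ trisected u ℕ.* 3
triangle-3u zero = refl
triangle-3u (suc u) rewrite triangle-3u u = lemma u (trisected u)
  where
  lemma : ∀ u g → suc (suc (suc (u ℕ.* 3))) ℕ.+ (suc (suc (u ℕ.* 3)) ℕ.+ (suc (u ℕ.* 3) ℕ.+ g ℕ.* 3)) ≡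
      (g ℕ.+ (3 ℕ.* u ℕ.+ 2)) ℕ.* 3
  lemma = ℕ-solve-∀

trisected-triangle : ∀ u → trisected u ℕ.+ u ≡ triangle u ℕ.* 3
trisected-triangle zero = refl
trisected-triangle (suc u) = ≡.trans (lemma₁ u (trisected u)) (≡.trans (cong (ℕ._+ (3 ℕ.* u ℕ.+ 3)) (trisected-triangle u))
    (lemma₂ u (triangle u)))
  where
  lemma₁ : ∀ u g → g ℕ.+ (3 ℕ.* u ℕ.+ 2) ℕ.+ suc u ≡ g ℕ.+ u ℕ.+ (3 ℕ.* u ℕ.+ 3)
  lemma₁ = ℕ-solve-∀
  lemma₂ : ∀ u t → t ℕ.* 3 ℕ.+ (3 ℕ.* u ℕ.+ 3) ≡ (suc u ℕ.+ t) ℕ.* 3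
  lemma₂ = ℕ-solve-∀

triangle-3u+1 : ∀ u → triangle (suc (u ℕ.* 3)) ≡ 1 ℕ.+ triangle u ℕ.* 3 ℕ.* 3
triangle-3u+1 u rewrite triangle-3u u = cong suc (≡.trans (lemma u (trisected u)) (cong (ℕ._* 3) (trisected-triangle u)))
  where
  lemma : ∀ u g → u ℕ.* 3 ℕ.+ g ℕ.* 3 ≡ (g ℕ.+ u) ℕ.* 3
  lemma = ℕ-solve-∀

triangle-3u+2 : ∀ u → triangle (suc (suc (u ℕ.* 3))) ≡ (trisected u ℕ.+ suc (2 ℕ.* u)) ℕ.* 3
triangle-3u+2 u rewrite triangle-3u u = lemma u (trisected u)
  where
  lemma : ∀ u g → suc (suc (u ℕ.* 3)) ℕ.+ (suc (u ℕ.* 3) ℕ.+ g ℕ.* 3) ≡ (g ℕ.+ suc (2 ℕ.* u)) ℕ.* 3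
  lemma = ℕ-solve-∀

trisected-bound : ∀ u → u ≤ trisected u
trisected-bound zero = z≤n
trisected-bound (suc u) = ℕₚ.≤-trans (ℕₚ.m≤m+n (suc u) (suc (trisected u ℕ.+ 2 ℕ.* u))) (ℕₚ.≤-reflexive (lemma u (trisected u)))
  where
  lemma : ∀ u g → suc u ℕ.+ suc (g ℕ.+ 2 ℕ.* u) ≡ g ℕ.+ (3 ℕ.* u ℕ.+ 2)
  lemma = ℕ-solve-∀

module Sections (d : ℕ) where
  open Partitions d public

  Σℕ-cong : ∀ {f g} → (∀ x → f x ≈ g x) → ∀ n → Σℕ n f ≈ Σℕ n g
  Σℕ-cong e zero = e 0
  Σℕ-cong e (suc n) = Σℕ-cong e n ⟨+⟩ e (suc n)

  ⟨q³⟩-homo-⊕ : ∀ a b → (a ⊕ b) ⟨q³⟩ ≈ a ⟨q³⟩ ⊕ b ⟨q³⟩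
  ⟨q³⟩-homo-⊕ a b = from≡ (⟨q³⟩-⊕ a b)

  ⟨q³⟩-homo-⊛ : ∀ a b → (a ⊛ b) ⟨q³⟩ ≈ a ⟨q³⟩ ⊛ b ⟨q³⟩
  ⟨q³⟩-homo-⊛ a b = from≡ (⟨q³⟩-⊛ a b)

  third-homo-⊛ : ∀ a b → third (a ⟨q³⟩ ⊛ b) ≈ a ⊛ third b
  third-homo-⊛ a b = from≡ (third-⊛ a b)

  third-⟨q³⟩ : ∀ a b c → third (a ⟨q³⟩ ⊕ q^ 1 ⊛ b ⟨q³⟩ ⊕ q^ 2 ⊛ c ⟨q³⟩) ≈ b
  third-⟨q³⟩ a b c =
    linear (const 1ℤ) (third-cong (solve 5 (λ a b c p q → a :+ p :* b :+ q :* c := a :* con 1ℤ :+ b :* p :+ c :* q) ≈-refl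
        (a ⟨q³⟩) (b ⟨q³⟩) (c ⟨q³⟩) (q^ 1) (q^ 2)))
    (linear (const 1ℤ) (third-homo-⊛ a (const 1ℤ))
    (linear (const 1ℤ) (third-homo-⊛ b (q^ 1))
    (linear (const 1ℤ) (third-homo-⊛ c (q^ 2))
    (linear a third-1
    (linear b third-q
    (linear c third-q²
    (solve 10 (λ x y a b c u v w o p →
      x :+ con 1ℤ :* (u :+ v :+ w) :+ con 1ℤ :* (a :* o) :+ con 1ℤ :* (b :* p) :+ con 1ℤ :*
          (c :* y) :+ a :* con 0ℤ :+ b :* con 1ℤ :+ c :* con 0ℤ
      := b :+ con 1ℤ :* x :+ con 1ℤ :* u :+ con 1ℤ :* v :+ con 1ℤ :* w :+ a :* o :+ b :* p :+ c :* y)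
      ≈-refl (third (a ⟨q³⟩ ⊕ q^ 1 ⊛ b ⟨q³⟩ ⊕ q^ 2 ⊛ c ⟨q³⟩)) (third (q^ 2)) a b c
        (third (a ⟨q³⟩ ⊛ const 1ℤ)) (third (b ⟨q³⟩ ⊛ q^ 1)) (third (c ⟨q³⟩ ⊛ q^ 2)) (third (const 1ℤ)) (third (q^ 1)))))))))
    where
    third-1 : third (const 1ℤ) ≈ const 0ℤ
    third-1 = from≡ λ { zero → refl ; (suc n) → refl }
    third-q : third (q^ 1) ≈ const 1ℤ
    third-q = from≡ λ { zero → refl ; (suc n) → refl }
    third-q² : third (q^ 2) ≈ const 0ℤ
    third-q² = from≡ λ { zero → refl ; (suc n) → refl }

  -- The part of ψ with exponents divisible by 3, written in q³. It collects s = 3u and s = 3u + 2;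
  -- parity is not involved.
  ψ-even : Series
  ψ-even = lim λ n → Σℕ n λ u → q^ (trisected u) ⊕ q^ (trisected u ℕ.+ suc (2 ℕ.* u))

  -- For s = 3u + 1 the triangular number is 1 + 9u(u + 1)/2, so this class reproduces ψ in q⁹; for
  -- the other two classes it is divisible by 3. No exponent is ≡ 2 (mod 3).
  ψ-dissection : ψ ≈ ψ-even ⟨q³⟩ ⊕ q^ 1 ⊛ (ψ ⟨q³⟩) ⟨q³⟩
  ψ-dissection = trunc⇒≈ λ N →
    trunc-trans (lim-trunc ψ-converges (ℕₚ.m≤n⇒m≤1+n (ℕₚ.m≤n⇒m≤1+n (ℕₚ.m≤m*n N 3))))
    (trunc-trans (≈⇒trunc (≈-trans (from≡ λ m → sumℕ-mod-3 N (λ s → (q^ (triangle s)) m)) (finite N)))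
    (trunc-sym (trunc-⊕ (⟨q³⟩-trunc (lim-trunc converges ℕₚ.≤-refl)) (trunc-⊛ (≈⇒trunc (≈-refl {q^ 1}))
        (⟨q³⟩-trunc (⟨q³⟩-trunc (lim-trunc ψ-converges ℕₚ.≤-refl)))))))
    where
    A B : ℕ → Series
    A u = q^ (trisected u) ⊕ q^ (trisected u ℕ.+ suc (2 ℕ.* u))
    B u = q^ (triangle u)
    converges : Converges (λ n → Σℕ n A)
    converges n = trunc-absorb (trunc-trans
      (trunc-⊕ (q^-trunc (trisected-bound (suc n))) (q^-trunc (ℕₚ.≤-trans (trisected-bound (suc n))
          (ℕₚ.m≤m+n (trisected (suc n)) (suc (2 ℕ.* suc n))))))
      (≈⇒trunc (solve 0 (con 0ℤ :+ con 0ℤ := con 0ℤ) ≈-refl)))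
    term : ∀ u → q^ (triangle (u ℕ.* 3)) ⊕ (q^ (triangle (suc (u ℕ.* 3))) ⊕ q^ (triangle (suc (suc (u ℕ.* 3))))) ≈ A u ⟨q³⟩ ⊕
        q^ 1 ⊛ (B u ⟨q³⟩) ⟨q³⟩
    term u =
      linear (const 1ℤ) (q^-≡ (triangle-3u u))
      (linear (const 1ℤ) (q^-split {triangle (suc (u ℕ.* 3))} 1 (triangle u ℕ.* 3 ℕ.* 3) (triangle-3u+1 u))
      (linear (const 1ℤ) (q^-≡ (triangle-3u+2 u))
      (linear (⊖ const 1ℤ) (⟨q³⟩-homo-⊕ (q^ (trisected u)) (q^ (trisected u ℕ.+ suc (2 ℕ.* u))))
      (linear (⊖ const 1ℤ) (from≡ (⟨q³⟩-q^ (trisected u)))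
      (linear (⊖ const 1ℤ) (from≡ (⟨q³⟩-q^ (trisected u ℕ.+ suc (2 ℕ.* u))))
      (linear (⊖ q^ 1) (≈-trans (⟨q³⟩-cong (from≡ (⟨q³⟩-q^ (triangle u)))) (from≡ (⟨q³⟩-q^ (triangle u ℕ.* 3))))
      (solve 12 (λ a b c a′ b′ c′ q S S₁ S₂ T o →
        a :+ (b :+ c) :+ con 1ℤ :* a′ :+ con 1ℤ :* (q :* b′) :+ con 1ℤ :* c′ :+ (:- con 1ℤ) :* (S₁ :+ S₂) :+
            (:- con 1ℤ) :* a′ :+ (:- con 1ℤ) :* c′ :+ (:- q) :* b′
        := S :+ q :* T :+ con 1ℤ :* a :+ con 1ℤ :* b :+ con 1ℤ :* c :+ (:- con 1ℤ) :* S :+ (:- con 1ℤ) :* S₁ :+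
            (:- con 1ℤ) :* S₂ :+ (:- q) :* T)
        ≈-refl (q^ (triangle (u ℕ.* 3))) (q^ (triangle (suc (u ℕ.* 3)))) (q^ (triangle (suc (suc (u ℕ.* 3)))))
        (q^ (trisected u ℕ.* 3)) (q^ (triangle u ℕ.* 3 ℕ.* 3)) (q^ ((trisected u ℕ.+ suc (2 ℕ.* u)) ℕ.* 3)) (q^ 1)
        (A u ⟨q³⟩) ((q^ (trisected u)) ⟨q³⟩) ((q^ (trisected u ℕ.+ suc (2 ℕ.* u))) ⟨q³⟩) ((B u ⟨q³⟩) ⟨q³⟩) (const 1ℤ))))))))
    finite : ∀ n → Σℕ n (λ u → q^ (triangle (u ℕ.* 3)) ⊕ (q^ (triangle (suc (u ℕ.* 3))) ⊕ q^ (triangle (suc (suc (u ℕ.* 3))))))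
      ≈ Σℕ n A ⟨q³⟩ ⊕ q^ 1 ⊛ (Σℕ n B ⟨q³⟩) ⟨q³⟩
    finite zero = term 0
    finite (suc n) =
      linear (const 1ℤ) (finite n)
      (linear (const 1ℤ) (term (suc n))
      (linear (⊖ const 1ℤ) (⟨q³⟩-homo-⊕ (Σℕ n A) (A (suc n)))
      (linear (⊖ q^ 1) (≈-trans (⟨q³⟩-cong (⟨q³⟩-homo-⊕ (Σℕ n B) (B (suc n)))) (⟨q³⟩-homo-⊕ (Σℕ n B ⟨q³⟩) (B (suc n) ⟨q³⟩)))
      (solve 9 (λ u v A a B b q X Y →
        u :+ v :+ con 1ℤ :* (A :+ q :* B) :+ con 1ℤ :* (a :+ q :* b) :+ (:- con 1ℤ) :* (A :+ a) :+ (:- q) :* (B :+ b)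
        := X :+ q :* Y :+ con 1ℤ :* u :+ con 1ℤ :* v :+ (:- con 1ℤ) :* X :+ (:- q) :* Y)
        ≈-refl _ _ (Σℕ n A ⟨q³⟩) (A (suc n) ⟨q³⟩) ((Σℕ n B ⟨q³⟩) ⟨q³⟩) ((B (suc n) ⟨q³⟩) ⟨q³⟩) (q^ 1) (Σℕ (suc n) A ⟨q³⟩)
            ((Σℕ (suc n) B ⟨q³⟩) ⟨q³⟩)))))

  sgn-3x : ∀ x → sgn (3x x) ≡ sgn x
  sgn-3x (+ n) = parity-*3 n
    where
    parity-*3 : ∀ n → parity (n ℕ.* 3) ≡ parity n
    parity-*3 zero = refl
    parity-*3 (suc n) = ≡.trans (ℤₚ.neg-involutive _) (cong -_ (parity-*3 n))
  sgn-3x -[1+ n ] = sgn-3x (+ suc n)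

-- `Ω₊ c` is Ω(q^c) and `Ω₋ c` is Ω(-q^c), because 3x² + 2x has the parity of x.
Ω₋ Ω₊ : ℕ → Series
Ω₋ c = theta sgn λ x → c ℕ.* ω x
Ω₊ c = theta one λ x → c ℕ.* ω x

module Dissected (d : ℕ) where
  open Sections d public

  φ₋-dissection : ∀ c .{{_ : ℕ.NonZero c}} → φ₋ c ≈ φ₋ (c ℕ.* 3) ⟨q³⟩ ⊕ const (- + 2) ⊛ (q^ c ⊛ Ω₋ c ⟨q³⟩)
  φ₋-dissection c = square-dissection c (- 1ℤ) sgn sgn-neg sgn-3x sgn-3x+1
    where
    negate : ∀ x → - x ≡ - 1ℤ * x
    negate = solve-∀
    sgn-3x+1 : ∀ x → sgn (3x+1 x) ≡ - 1ℤ * sgn x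
    sgn-3x+1 (+ n) = ≡.trans (cong -_ (sgn-3x (+ n))) (negate (parity n))
    sgn-3x+1 -[1+ n ] = ≡.trans (≡.trans (≡.sym (ℤₚ.neg-involutive _)) (cong -_ (sgn-3x (+ suc n)))) (negate (parity (suc n)))

  φ₊-dissection : ∀ c .{{_ : ℕ.NonZero c}} → φ₊ c ≈ φ₊ (c ℕ.* 3) ⟨q³⟩ ⊕ const (+ 2) ⊛ (q^ c ⊛ Ω₊ c ⟨q³⟩)
  φ₊-dissection c = square-dissection c 1ℤ one (λ _ → refl) (λ _ → refl) (λ _ → refl)

  ⟨q³⟩-homo-const : ∀ x → const x ⟨q³⟩ ≈ const x
  ⟨q³⟩-homo-const x = from≡ (⟨q³⟩-const x)

-- The progression 3m + 1 modulo 4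

module Modulo-4 where
  open Dissected 4

  4≈0 : const (+ 4) ≈ const 0ℤ
  4≈0 = mk≈ λ { zero → mk~ 1ℤ refl ; (suc n) → ~-refl }

  -- The terms at x and -x coincide, so every partial sum has the form 1 + 2S, and (1 + 2S)² = 1 +
  -- 4(S + S²).
  φ₋-square : ∀ c .{{_ : ℕ.NonZero c}} → φ₋ c ⊛ φ₋ c ≈ const 1ℤ
  φ₋-square c = trunc⇒≈ λ N → trunc-trans (trunc-⊛ (theta-trunc sgn (square-bound c) ℕₚ.≤-refl)
      (theta-trunc sgn (square-bound c) ℕₚ.≤-refl))
    (≈⇒trunc (linear (Σℤ N t ⊕ const 1ℤ ⊕ const (+ 2) ⊛ S N) (doubled N)
      (linear (S N ⊕ S N ⊛ S N) 4≈0
      (solve 2 (λ T S →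
        T :* T :+ (T :+ con 1ℤ :+ con (+ 2) :* S) :* (con 1ℤ :+ con (+ 2) :* S) :+ (S :+ S :* S) :* con 0ℤ
        := con 1ℤ :+ (T :+ con 1ℤ :+ con (+ 2) :* S) :* T :+ (S :+ S :* S) :* con (+ 4))
        ≈-refl (Σℤ N t) (S N)))))
    where
    t : ℤ → Series
    t = thetaTerm sgn (square c)
    S : ℕ → Series
    S zero = const 0ℤ
    S (suc n) = S n ⊕ t +[1+ n ]
    doubled : ∀ n → Σℤ n t ≈ const 1ℤ ⊕ const (+ 2) ⊛ S n
    doubled zero = ≈-trans (≈-refl {const 1ℤ} ⟨*⟩ q^-≡ (ℕₚ.*-zeroʳ c)) (solve 0 (con 1ℤ :* con 1ℤ := con 1ℤ :+ con
        (+ 2) :* con 0ℤ) ≈-refl)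
    doubled (suc n) = linear (const 1ℤ) (doubled n)
      (solve 3 (λ T S u → T :+ (u :+ u) :+ con 1ℤ :* (con 1ℤ :+ con (+ 2) :* S) := con 1ℤ :+ con (+ 2) :*
          (S :+ u) :+ con 1ℤ :* T)
        ≈-refl (Σℤ n t) (S n) (t +[1+ n ]))

  -- f_4 φ(-q²) = f_2² = f_1 ψ, and f_1 cancels. The modulus enters afterwards: `φ₋ 2` is its own
  -- inverse modulo 4, which moves it to the other side.
  RD-φ₋ : RD ⊛ η 36 ⊛ φ₋ 2 ≈ η 9 ⊛ ψ
  RD-φ₋ = ⊛-cancelˡ {η 1} refl
    (linear (φ₋ 2) RD-product
    (linear (⊖ η 9) (gauss-φ 2)
    (linear (η 9) gauss-ψ
    (solve 8 (λ R a b c e g f p →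
      a :* (R :* b :* f) :+ f :* (c :* e) :+ (:- c) :* (e :* f) :+ c :* (a :* p)
      := a :* (c :* p) :+ f :* (R :* a :* b) :+ (:- c) :* (g :* g) :+ c :* (g :* g))
      ≈-refl RD (η 1) (η 36) (η 9) (η 4) (η 2) (φ₋ 2) ψ))))

  RD-ψφ₋ : RD ⊛ η 36 ≈ η 9 ⊛ (ψ ⊛ φ₋ 2)
  RD-ψφ₋ = linear (φ₋ 2) RD-φ₋ (linear (⊖ (RD ⊛ η 36)) (φ₋-square 2)
    (solve 5 (λ R b c f p → R :* b :+ f :* (c :* p) :+ (:- (R :* b)) :* con 1ℤ := c :* (p :* f) :+ f :* (R :* b :* f) :+
        (:- (R :* b)) :* (f :* f))
      ≈-refl RD (η 36) (η 9) (φ₋ 2) ψ))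

  -- In (A + qB)(C - 2q²D), with A, B, C, D series in q³, only qBC has exponents ≡ 1 (mod 3); the
  -- product q · q² falls back into class 0.
  third-ψφ₋ : third (ψ ⊛ φ₋ 2) ≈ ψ ⟨q³⟩ ⊛ φ₋ 6
  third-ψφ₋ = ≈-trans (third-cong split) (third-⟨q³⟩ a b c)
    where
    a b c : Series
    a = ψ-even ⊛ φ₋ 6 ⊕ const (- + 2) ⊛ (q^ 1 ⊛ (ψ ⟨q³⟩ ⊛ Ω₋ 2))
    b = ψ ⟨q³⟩ ⊛ φ₋ 6
    c = const (- + 2) ⊛ (ψ-even ⊛ Ω₋ 2)
    split : ψ ⊛ φ₋ 2 ≈ a ⟨q³⟩ ⊕ q^ 1 ⊛ b ⟨q³⟩ ⊕ q^ 2 ⊛ c ⟨q³⟩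
    split = ≈-trans (ψ-dissection ⟨*⟩ φ₋-dissection 2)
      (≈-trans (solve 6 (λ e p f o q q² → (e :+ q :* p) :* (f :+ con (- + 2) :* (q² :* o))
          := (e :* f :+ con (- + 2) :* ((q :* q²) :* (p :* o))) :+ q :* (p :* f) :+ q² :* (con (- + 2) :* (e :* o)))
          ≈-refl (ψ-even ⟨q³⟩) ((ψ ⟨q³⟩) ⟨q³⟩) (φ₋ 6 ⟨q³⟩) (Ω₋ 2 ⟨q³⟩) (q^ 1) (q^ 2))
      (≈-sym (a≈ ⟨+⟩ ≈-refl {q^ 1} ⟨*⟩ ⟨q³⟩-homo-⊛ (ψ ⟨q³⟩) (φ₋ 6) ⟨+⟩ ≈-refl {q^ 2} ⟨*⟩ c≈)))
      where
      c≈ : c ⟨q³⟩ ≈ const (- + 2) ⊛ (ψ-even ⟨q³⟩ ⊛ Ω₋ 2 ⟨q³⟩)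
      c≈ = ≈-trans (⟨q³⟩-homo-⊛ (const (- + 2)) (ψ-even ⊛ Ω₋ 2)) (⟨q³⟩-homo-const (- + 2) ⟨*⟩ ⟨q³⟩-homo-⊛ ψ-even (Ω₋ 2))
      a≈ : a ⟨q³⟩ ≈ ψ-even ⟨q³⟩ ⊛ φ₋ 6 ⟨q³⟩ ⊕ const (- + 2) ⊛ ((q^ 1 ⊛ q^ 2) ⊛ ((ψ ⟨q³⟩) ⟨q³⟩ ⊛ Ω₋ 2 ⟨q³⟩))
      a≈ = ≈-trans (⟨q³⟩-homo-⊕ (ψ-even ⊛ φ₋ 6) (const (- + 2) ⊛ (q^ 1 ⊛ (ψ ⟨q³⟩ ⊛ Ω₋ 2))))
        (⟨q³⟩-homo-⊛ ψ-even (φ₋ 6) ⟨+⟩ ≈-trans (⟨q³⟩-homo-⊛ (const (- + 2)) (q^ 1 ⊛ (ψ ⟨q³⟩ ⊛ Ω₋ 2)))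
          (⟨q³⟩-homo-const (- + 2) ⟨*⟩ ≈-trans (⟨q³⟩-homo-⊛ (q^ 1) (ψ ⟨q³⟩ ⊛ Ω₋ 2)) (≈-trans (from≡ (⟨q³⟩-q^ 1))
              (q^-+ 1 2) ⟨*⟩ ⟨q³⟩-homo-⊛ (ψ ⟨q³⟩) (Ω₋ 2))))

  -- The extraction turns f_36 and f_9 into f_12 and f_3, and then f_3 ψ(q³) φ(-q⁶) = f_6² φ(-q⁶) =
  -- f_12 φ(-q⁶)² ≡ f_12, so f_12 cancels.
  third-RD : third RD ≈ const 1ℤ
  third-RD = ⊛-cancelˡ {η 12} refl
    (linear (⊖ const 1ℤ) (third-homo-⊛ (η 12) RD)
    (linear (const 1ℤ) (third-cong (≈-trans (η-⟨q³⟩ 12 ⟨*⟩ ≈-refl {RD}) (solve 2 (λ a b → a :* b := b :* a) ≈-refl (η 36) RD)))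
    (linear (const 1ℤ) (third-cong (≈-trans RD-ψφ₋ (≈-sym (η-⟨q³⟩ 3) ⟨*⟩ ≈-refl {ψ ⊛ φ₋ 2})))
    (linear (const 1ℤ) (third-homo-⊛ (η 3) (ψ ⊛ φ₋ 2))
    (linear (η 3) third-ψφ₋
    (linear (φ₋ 6) η₃ψ
    (linear (φ₋ 6) (gauss-φ 6)
    (linear (η 12) (φ₋-square 6)
    (solve 12 (λ a R x y z u w e p f s o →
      a :* R :+ (:- con 1ℤ) :* (a :* R) :+ con 1ℤ :* y :+ con 1ℤ :* z :+ con 1ℤ :* (e :* w) :+ e :* (p :* f) :+ f :*
          (s :* s) :+ f :* (a :* f) :+ a :* con 1ℤ
      := a :* con 1ℤ :+ (:- con 1ℤ) :* x :+ con 1ℤ :* x :+ con 1ℤ :* y :+ con 1ℤ :* z :+ e :* w :+ f :* (e :* p) :+ f :*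
          (s :* s) :+ a :* (f :* f))
      ≈-refl (η 12) (third RD) (third (η 12 ⟨q³⟩ ⊛ RD)) (third (RD ⊛ η 36)) (third (η 3 ⟨q³⟩ ⊛ (ψ ⊛ φ₋ 2))) (const 1ℤ)
        (third (ψ ⊛ φ₋ 2)) (η 3) (ψ ⟨q³⟩) (φ₋ 6) (η 6) (const 1ℤ))))))))))
    where
    η₃ψ : η 3 ⊛ ψ ⟨q³⟩ ≈ η 6 ⊛ η 6
    η₃ψ = ≈-trans (≈-sym (η-⟨q³⟩ 1) ⟨*⟩ ≈-refl {ψ ⟨q³⟩}) (≈-trans (≈-sym (⟨q³⟩-homo-⊛ (η 1) ψ))
      (≈-trans (⟨q³⟩-cong (≈-sym gauss-ψ)) (≈-trans (⟨q³⟩-homo-⊛ (η 2) (η 2)) (η-⟨q³⟩ 2 ⟨*⟩ η-⟨q³⟩ 2))))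

-- The progression 3m + 1 modulo 3

module Modulo-3 where
  open Dissected 3

  3≈0 : const (+ 3) ≈ const 0ℤ
  3≈0 = mk≈ λ { zero → mk~ 1ℤ refl ; (suc n) → ~-refl }

  -- Factor by factor, (1 - X)³ = 1 - X³ + 3(X² - X).
  frobenius : ∀ c .{{_ : ℕ.NonZero c}} → η c ⊛ η c ⊛ η c ≈ η (c ℕ.* 3)
  frobenius c = trunc⇒≈ λ N → let e = η-trunc c {N} ℕₚ.≤-refl in
    trunc-trans (trunc-⊛ (trunc-⊛ e e) e) (trunc-trans (≈⇒trunc (finite N))
        (trunc-sym (η-trunc (c ℕ.* 3) {{ℕₚ.m*n≢0 c 3}} ℕₚ.≤-refl)))
    where
    exponent : ∀ c n → c ℕ.* 3 ℕ.* suc n ≡ c ℕ.* suc n ℕ.+ (c ℕ.* suc n ℕ.+ c ℕ.* suc n)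
    exponent = ℕ-solve-∀
    finite : ∀ n → Π c n ⊛ Π c n ⊛ Π c n ≈ Π (c ℕ.* 3) n
    finite zero = solve 0 (con 1ℤ :* con 1ℤ :* con 1ℤ := con 1ℤ) ≈-refl
    finite (suc n) =
      linear ((const 1ℤ ⊕ ⊖ X) ⊛ (const 1ℤ ⊕ ⊖ X) ⊛ (const 1ℤ ⊕ ⊖ X)) (finite n)
      (linear (Π (c ℕ.* 3) n) (≈-trans (q^-split (c ℕ.* suc n) (c ℕ.* suc n ℕ.+ c ℕ.* suc n) (exponent c n))
          (≈-refl {X} ⟨*⟩ q^-+ (c ℕ.* suc n) (c ℕ.* suc n)))
      (linear (Π (c ℕ.* 3) n ⊛ (X ⊛ X ⊕ ⊖ X)) 3≈0
      (solve 4 (λ P R X Y → let F = con 1ℤ :+ :- X in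
        (P :* F) :* (P :* F) :* (P :* F) :+ F :* F :* F :* R :+ R :* (X :* (X :* X)) :+ (R :* (X :* X :+ :- X)) :* con 0ℤ
        := R :* (con 1ℤ :+ :- Y) :+ F :* F :* F :* (P :* P :* P) :+ R :* Y :+ (R :* (X :* X :+ :- X)) :* con (+ 3))
        ≈-refl (Π c n) (Π (c ℕ.* 3) n) X (q^ (c ℕ.* 3 ℕ.* suc n)))))
      where
      X = q^ (c ℕ.* suc n)

  X : Series
  X = φ₋ 1 ⊛ φ₋ 1 ⊛ φ₊ 1

  -- The rotation gives twice this identity; doubling once more removes the 2, since 4 ≡ 1 modulo 3.
  φ₊φ₋ : φ₊ 1 ⊛ φ₋ 1 ≈ φ₋ 2 ⊛ φ₋ 2
  φ₊φ₋ = linear (const (+ 2)) (theta-rotate {square 1} {square 1} {square 2} (square-bound 1) (square-bound 1)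
      (square-bound 2) square-rotate)
    (linear (φ₋ 2 ⊛ φ₋ 2 ⊕ ⊖ (φ₊ 1 ⊛ φ₋ 1)) 3≈0
    (solve 3 (λ p m f → p :* m :+ con (+ 2) :* (con (+ 2) :* (f :* f)) :+ (f :* f :+ :- (p :* m)) :* con 0ℤ
      := f :* f :+ con (+ 2) :* (p :* m :+ m :* p) :+ (f :* f :+ :- (p :* m)) :* con (+ 3))
      ≈-refl (φ₊ 1) (φ₋ 1) (φ₋ 2)))

  Ωφ : Ω₊ 1 ⊛ φ₋ 3 ⊕ Ω₋ 1 ⊛ φ₊ 3 ≈ const (+ 2) ⊛ (η 4 ⊛ η 4)
  Ωφ = ≈-trans (theta-rotate {λ x → 1 ℕ.* ω x} {square 3} {pentagonal} (ω-bound 1) (square-bound 3) pentagonal-bound ω-rotate)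
    (≈-refl {const (+ 2)} ⟨*⟩ (≈-sym euler ⟨*⟩ ≈-sym euler))

  -- φ(-q)²φ(q) = φ(-q)φ(-q²)² = (f_1²/f_2)(f_2²/f_4)², with denominators cleared.
  X-product : X ⊛ (η 4 ⊛ η 4) ≈ η 1 ⊛ η 1 ⊛ (η 2 ⊛ η 2 ⊛ η 2)
  X-product = ⊛-cancelˡ {η 2} refl
    (linear (φ₋ 1 ⊛ η 2 ⊛ η 4 ⊛ η 4) φ₊φ₋
    (linear (⊖ (φ₋ 2 ⊛ φ₋ 2 ⊛ η 4 ⊛ η 4)) (gauss-φ 1)
    (linear (⊖ (η 1 ⊛ η 1 ⊛ (η 4 ⊛ φ₋ 2 ⊕ η 2 ⊛ η 2))) (gauss-φ 2)
    (solve 6 (λ a b c m p f →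
      b :* (m :* m :* p :* (c :* c)) :+ m :* b :* c :* c :* (f :* f) :+ (:- (f :* f :* c :* c)) :* (b :* m) :+
          (:- (a :* a :* (c :* f :+ b :* b))) :* (c :* f)
      := b :* (a :* a :* (b :* b :* b)) :+ m :* b :* c :* c :* (p :* m) :+ (:- (f :* f :* c :* c)) :* (a :* a) :+
          (:- (a :* a :* (c :* f :+ b :* b))) :* (b :* b))
      ≈-refl (η 1) (η 2) (η 4) (φ₋ 1) (φ₊ 1) (φ₋ 2)))))

  -- Multiplying by f_3 f_6 ≡ f_1³ f_2³ supplies the f_1² f_2³ of `X-product`, and the remaining f_4
  -- · f_4² is ≡ f_12. All factors other than `RD` and `X` then have index divisible by 3 and pass
  -- through the extraction.
  RD-X : RD ⊛ (η 36 ⊛ (η 3 ⊛ η 6)) ≈ η 9 ⊛ η 12 ⊛ X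
  RD-X =
    linear (η 1 ⊛ η 1 ⊛ (η 2 ⊛ η 2 ⊛ η 2)) RD-product
    (linear (⊖ (η 9 ⊛ η 4)) X-product
    (linear (⊖ (RD ⊛ η 36 ⊛ η 6)) (frobenius 1)
    (linear (⊖ (RD ⊛ η 36 ⊛ (η 1 ⊛ η 1 ⊛ η 1))) (frobenius 2)
    (linear (η 9 ⊛ X) (frobenius 4)
    (solve 10 (λ R a b c e₃ e₆ e₉ e₁₂ e₃₆ X →
      R :* (e₃₆ :* (e₃ :* e₆)) :+ a :* a :* (b :* b :* b) :* (e₉ :* c) :+ (:- (e₉ :* c)) :* (a :* a :* (b :* b :* b))
        :+ (:- (R :* e₃₆ :* e₆)) :* e₃ :+ (:- (R :* e₃₆ :* (a :* a :* a))) :* e₆ :+ e₉ :* X :* e₁₂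
      := e₉ :* e₁₂ :* X :+ a :* a :* (b :* b :* b) :* (R :* a :* e₃₆) :+ (:- (e₉ :* c)) :* (X :* (c :* c))
        :+ (:- (R :* e₃₆ :* e₆)) :* (a :* a :* a) :+ (:- (R :* e₃₆ :* (a :* a :* a))) :* (b :* b :* b) :+ e₉ :* X :*
            (c :* c :* c))
      ≈-refl RD (η 1) (η 2) (η 4) (η 3) (η 6) (η 9) (η 12) (η 36) X)))))

  -- The class-1 part of (m - 2qo)²(p + 2qO) is 2m²O - 4mop ≡ 2m(Om + op), and `Ωφ` makes this 4m
  -- f_4² ≡ m f_4².
  third-X : third X ≈ φ₋ 3 ⊛ (η 4 ⊛ η 4)
  third-X = ≈-trans (≈-trans (third-cong split) (third-⟨q³⟩ a b c))
    (linear (const (+ 2) ⊛ φ₋ 3) Ωφ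
    (linear (φ₋ 3 ⊛ (η 4 ⊛ η 4) ⊕ ⊖ (const (+ 2) ⊛ φ₋ 3 ⊛ Ω₋ 1 ⊛ φ₊ 3)) 3≈0
    (solve 5 (λ m p O o e →
      con (+ 2) :* (m :* m :* O) :+ con (- + 4) :* (m :* o :* p) :+ con (+ 2) :* m :* (con (+ 2) :* (e :* e)) :+
          (m :* (e :* e) :+ :- (con (+ 2) :* m :* o :* p)) :* con 0ℤ
      := m :* (e :* e) :+ con (+ 2) :* m :* (O :* m :+ o :* p) :+ (m :* (e :* e) :+ :- (con (+ 2) :* m :* o :* p)) :* con (+ 3))
      ≈-refl (φ₋ 3) (φ₊ 3) (Ω₊ 1) (Ω₋ 1) (η 4))))
    where
    m p O o : Series
    m = φ₋ 3
    p = φ₊ 3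
    O = Ω₊ 1
    o = Ω₋ 1
    a b c : Series
    a = m ⊛ m ⊛ p ⊕ const (+ 8) ⊛ (q^ 1 ⊛ (o ⊛ o ⊛ O))
    b = const (+ 2) ⊛ (m ⊛ m ⊛ O) ⊕ const (- + 4) ⊛ (m ⊛ o ⊛ p)
    c = const (+ 4) ⊛ (o ⊛ o ⊛ p) ⊕ const (- + 8) ⊛ (m ⊛ o ⊛ O)
    split : X ≈ a ⟨q³⟩ ⊕ q^ 1 ⊛ b ⟨q³⟩ ⊕ q^ 2 ⊛ c ⟨q³⟩
    split = ≈-trans (φ₋-dissection 1 ⟨*⟩ φ₋-dissection 1 ⟨*⟩ φ₊-dissection 1)
      (≈-trans
        (linear (const (+ 4) ⊛ (o′ ⊛ o′ ⊛ p′) ⊕ const (- + 8) ⊛ (m′ ⊛ o′ ⊛ O′)) (≈-sym (q^-+ 1 1))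
        (linear (const (+ 8) ⊛ (o′ ⊛ o′ ⊛ O′)) q³
        (solve 7 (λ m p O o q q² q³ →
          (m :+ con (- + 2) :* (q :* o)) :* (m :+ con (- + 2) :* (q :* o)) :* (p :+ con (+ 2) :* (q :* O))
            :+ (con (+ 4) :* (o :* o :* p) :+ con (- + 8) :* (m :* o :* O)) :* q² :+ (con (+ 8) :* (o :* o :* O)) :* q³
          := (m :* m :* p :+ con (+ 8) :* (q³ :* (o :* o :* O))) :+ q :* (con (+ 2) :* (m :* m :* O) :+ con (- + 4) :*
              (m :* o :* p))
            :+ q² :* (con (+ 4) :* (o :* o :* p) :+ con (- + 8) :* (m :* o :* O))
            :+ (con (+ 4) :* (o :* o :* p) :+ con (- + 8) :* (m :* o :* O)) :* (q :* q) :+ (con (+ 8) :* (o :* o :* O)) :*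
                (q :* q :* q))
          ≈-refl m′ p′ O′ o′ (q^ 1) (q^ 2) (q^ 3))))
        (≈-sym (a≈ ⟨+⟩ ≈-refl {q^ 1} ⟨*⟩ b≈ ⟨+⟩ ≈-refl {q^ 2} ⟨*⟩ c≈)))
      where
      m′ p′ O′ o′ : Series
      m′ = m ⟨q³⟩
      p′ = p ⟨q³⟩
      O′ = O ⟨q³⟩
      o′ = o ⟨q³⟩
      q³ : q^ 1 ⊛ q^ 1 ⊛ q^ 1 ≈ q^ 3
      q³ = ≈-trans (≈-sym (q^-+ 1 1) ⟨*⟩ ≈-refl {q^ 1}) (≈-sym (q^-+ 2 1))
      cubic : ∀ x y z → (x ⊛ y ⊛ z) ⟨q³⟩ ≈ x ⟨q³⟩ ⊛ y ⟨q³⟩ ⊛ z ⟨q³⟩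
      cubic x y z = ≈-trans (⟨q³⟩-homo-⊛ (x ⊛ y) z) (⟨q³⟩-homo-⊛ x y ⟨*⟩ ≈-refl)
      scaled : ∀ k x y z → (const k ⊛ (x ⊛ y ⊛ z)) ⟨q³⟩ ≈ const k ⊛ (x ⟨q³⟩ ⊛ y ⟨q³⟩ ⊛ z ⟨q³⟩)
      scaled k x y z = ≈-trans (⟨q³⟩-homo-⊛ (const k) (x ⊛ y ⊛ z)) (⟨q³⟩-homo-const k ⟨*⟩ cubic x y z)
      a≈ : a ⟨q³⟩ ≈ m′ ⊛ m′ ⊛ p′ ⊕ const (+ 8) ⊛ (q^ 3 ⊛ (o′ ⊛ o′ ⊛ O′))
      a≈ = ≈-trans (⟨q³⟩-homo-⊕ (m ⊛ m ⊛ p) (const (+ 8) ⊛ (q^ 1 ⊛ (o ⊛ o ⊛ O)))) (cubic m m p ⟨+⟩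
        ≈-trans (⟨q³⟩-homo-⊛ (const (+ 8)) (q^ 1 ⊛ (o ⊛ o ⊛ O))) (⟨q³⟩-homo-const (+ 8) ⟨*⟩
          ≈-trans (⟨q³⟩-homo-⊛ (q^ 1) (o ⊛ o ⊛ O)) (from≡ (⟨q³⟩-q^ 1) ⟨*⟩ cubic o o O)))
      b≈ : b ⟨q³⟩ ≈ const (+ 2) ⊛ (m′ ⊛ m′ ⊛ O′) ⊕ const (- + 4) ⊛ (m′ ⊛ o′ ⊛ p′)
      b≈ = ≈-trans (⟨q³⟩-homo-⊕ (const (+ 2) ⊛ (m ⊛ m ⊛ O)) (const (- + 4) ⊛ (m ⊛ o ⊛ p))) (scaled (+ 2) m m O ⟨+⟩ scaled
          (- + 4) m o p)
      c≈ : c ⟨q³⟩ ≈ const (+ 4) ⊛ (o′ ⊛ o′ ⊛ p′) ⊕ const (- + 8) ⊛ (m′ ⊛ o′ ⊛ O′)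
      c≈ = ≈-trans (⟨q³⟩-homo-⊕ (const (+ 4) ⊛ (o ⊛ o ⊛ p)) (const (- + 8) ⊛ (m ⊛ o ⊛ O))) (scaled (+ 4) o o p ⟨+⟩ scaled
          (- + 8) m o O)

  -- The right side of `RD-X` extracts to f_3 f_4³ φ(-q³) ≡ f_3 f_12 φ(-q³), and f_3 ≡ f_1 · f_1² =
  -- f_1 f_2 φ(-q). So f_12 f_1 f_2, the extracted form of f_36 f_3 f_6, cancels.
  third-RD : third RD ≈ φ₋ 1 ⊛ φ₋ 3
  third-RD = ⊛-cancelˡ {η 12 ⊛ η 1 ⊛ η 2} refl
    (linear (const 1ℤ) left
    (linear (const 1ℤ) (third-cong RD-X)
    (linear (const 1ℤ) right
    (linear (η 3 ⊛ η 4) third-X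
    (linear (η 3 ⊛ φ₋ 3) (frobenius 4)
    (linear (⊖ (η 12 ⊛ φ₋ 3)) (frobenius 1)
    (linear (η 12 ⊛ η 1 ⊛ φ₋ 3) (gauss-φ 1)
    (solve 11 (λ a b c e₃ e₁₂ R x y z m f →
      e₁₂ :* a :* b :* R :+ con 1ℤ :* x :+ con 1ℤ :* y :+ con 1ℤ :* (e₃ :* c :* z) :+ e₃ :* c :* (m :* (c :* c))
        :+ e₃ :* m :* e₁₂ :+ (:- (e₁₂ :* m)) :* e₃ :+ e₁₂ :* a :* m :* (b :* f)
      := e₁₂ :* a :* b :* (f :* m) :+ con 1ℤ :* (e₁₂ :* a :* b :* R) :+ con 1ℤ :* x :+ con 1ℤ :* y :+ e₃ :* c :* z
        :+ e₃ :* m :* (c :* c :* c) :+ (:- (e₁₂ :* m)) :* (a :* a :* a) :+ e₁₂ :* a :* m :* (a :* a))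
      ≈-refl (η 1) (η 2) (η 4) (η 3) (η 12) (third RD) (third (RD ⊛ (η 36 ⊛ (η 3 ⊛ η 6)))) (third (η 9 ⊛ η 12 ⊛ X)) (third X)
          (φ₋ 3) (φ₋ 1)))))))))
    where
    left : (η 12 ⊛ η 1 ⊛ η 2) ⊛ third RD ≈ third (RD ⊛ (η 36 ⊛ (η 3 ⊛ η 6)))
    left = ≈-trans (≈-sym (third-homo-⊛ (η 12 ⊛ η 1 ⊛ η 2) RD)) (third-cong (≈-trans
      (≈-trans (⟨q³⟩-homo-⊛ (η 12 ⊛ η 1) (η 2)) (≈-trans (⟨q³⟩-homo-⊛ (η 12) (η 1)) (η-⟨q³⟩ 12 ⟨*⟩ η-⟨q³⟩ 1) ⟨*⟩ η-⟨q³⟩ 2) ⟨*⟩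
          ≈-refl {RD})
      (solve 4 (λ R a b c → a :* b :* c :* R := R :* (a :* (b :* c))) ≈-refl RD (η 36) (η 3) (η 6))))
    right : third (η 9 ⊛ η 12 ⊛ X) ≈ (η 3 ⊛ η 4) ⊛ third X
    right = ≈-trans (third-cong (≈-sym (≈-trans (⟨q³⟩-homo-⊛ (η 3) (η 4)) (η-⟨q³⟩ 3 ⟨*⟩ η-⟨q³⟩ 4)) ⟨*⟩ ≈-refl {X}))
        (third-homo-⊛ (η 3 ⊛ η 4) X)

-- Representations by x² + 3y²

sumℕ-head : ∀ n h → sumℕ (suc n) h ≡ h 0 + sumℕ n (λ k → h (suc k))
sumℕ-head zero h = refl
sumℕ-head (suc n) h rewrite sumℕ-head n h = ℤₚ.+-assoc (h 0) _ _

sumℕ-+ : ∀ n f g → sumℕ n (λ k → f k + g k) ≡ sumℕ n f + sumℕ n g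
sumℕ-+ zero f g = refl
sumℕ-+ (suc n) f g rewrite sumℕ-+ n f g = lemma (sumℕ n f) (sumℕ n g) (f (suc n)) (g (suc n))
  where
  lemma : ∀ a b c d → a + b + (c + d) ≡ a + c + (b + d)
  lemma = solve-∀

sumℕ-* : ∀ n x f → sumℕ n (λ k → x * f k) ≡ x * sumℕ n f
sumℕ-* zero x f = refl
sumℕ-* (suc n) x f rewrite sumℕ-* n x f = ≡.sym (ℤₚ.*-distribˡ-+ x (sumℕ n f) (f (suc n)))

nC0≡1 : ∀ n → n C 0 ≡ 1
nC0≡1 n = ≡.trans (nCk≡nC[n∸k] {0} {n} z≤n) (nCn≡1 n)

binomial : ∀ a n → (1ℤ + a) ℤ.^ n ≡ sumℕ n λ k → + (n C k) * a ℤ.^ k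
binomial a zero = refl
binomial a (suc n) = begin
  (1ℤ + a) * (1ℤ + a) ℤ.^ n                                 ≡⟨ cong ((1ℤ + a) *_) (binomial a n) ⟩
  (1ℤ + a) * S                                              ≡⟨ lemma₁ a S ⟩
  a * S + (S + 0ℤ * a ℤ.^ suc n)                            ≡⟨ cong (λ c → a * S + (S + + c * a ℤ.^ suc n))
      (k>n⇒nCk≡0 (ℕₚ.n<1+n n)) ⟨
  a * S + sumℕ (suc n) (t n)                                ≡⟨ cong (λ z → a * S + z) (sumℕ-head n (t n)) ⟩
  a * S + (t n 0 + sumℕ n (λ k → t n (suc k)))              ≡⟨ cong₂ (λ x c → x + (+ c * 1ℤ + sumℕ n (λ k → t n (suc k))))
      (≡.sym (sumℕ-* n a (t n))) (≡.trans (nC0≡1 n) (≡.sym (nC0≡1 (suc n)))) ⟩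
  A + (t (suc n) 0 + sumℕ n (λ k → t n (suc k)))            ≡⟨ lemma₂ A (t (suc n) 0) _ ⟩
  t (suc n) 0 + (A + sumℕ n (λ k → t n (suc k)))            ≡⟨ cong (λ z → t (suc n) 0 + z) (sumℕ-+ n (λ k → a * t n k)
      (λ k → t n (suc k))) ⟨
  t (suc n) 0 + sumℕ n (λ k → a * t n k + t n (suc k))      ≡⟨ cong (λ z → t (suc n) 0 + z) (sumℕ-cong n pascal) ⟩
  t (suc n) 0 + sumℕ n (λ k → t (suc n) (suc k))            ≡⟨ sumℕ-head n (t (suc n)) ⟨
  sumℕ (suc n) (t (suc n))                                  ∎
  where
  open ≡-Reasoning
  t : ℕ → ℕ → ℤ
  t n k = + (n C k) * a ℤ.^ k
  S A : ℤ
  S = sumℕ n (t n)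
  A = sumℕ n (λ k → a * t n k)
  lemma₁ : ∀ a S → (1ℤ + a) * S ≡ a * S + (S + 0ℤ)
  lemma₁ = solve-∀
  lemma₂ : ∀ x y z → x + (y + z) ≡ y + (x + z)
  lemma₂ = solve-∀
  lemma₃ : ∀ a x y z → a * (x * z) + y * (a * z) ≡ (x + y) * (a * z)
  lemma₃ = solve-∀
  pascal : ∀ k → a * t n k + t n (suc k) ≡ t (suc n) (suc k)
  pascal k = ≡.trans (lemma₃ a (+ (n C k)) (+ (n C suc k)) (a ℤ.^ k)) (cong (λ c → + c * a ℤ.^ suc k)
      (nCk+nC[k+1]≡[n+1]C[k+1] n k))

prime∤! : ∀ {p} → Prime p → ∀ m → m < p → p ∤ m !
prime∤! {p} pp zero m<p p∣1 = ℕₚ.<⇒≱ (ℕ.nonTrivial⇒n>1 p {{prime⇒nonTrivial pp}}) (∣⇒≤ p∣1)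
prime∤! pp (suc m) m<p p∣ with euclidsLemma (suc m) (m !) pp p∣
... | inj₁ p∣1+m = ℕₚ.<⇒≱ m<p (∣⇒≤ p∣1+m)
... | inj₂ p∣m! = prime∤! pp m (ℕₚ.<-trans (ℕₚ.n<1+n m) m<p) p∣m!

prime∣C : ∀ {m} → Prime (suc m) → ∀ k → 0 < k → k ≤ m → suc m ∣ suc m C k
prime∣C {m} pp k 0<k k≤m with euclidsLemma (p C k) (k ! ℕ.* (p ℕ.∸ k) !) pp (subst (p ∣_) (≡.sym factorials) (m∣m*n (m !)))
  where
  p = suc m
  factorials : (p C k) ℕ.* (k ! ℕ.* (p ℕ.∸ k) !) ≡ p !
  factorials = ≡.trans (cong (ℕ._* (k ! ℕ.* (p ℕ.∸ k) !)) (nCk≡n!/k![n-k]! (ℕₚ.m≤n⇒m≤1+n k≤m)))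
    (m/n*n≡m {{k !* (p ℕ.∸ k) !≢0}} (k![n∸k]!∣n! (ℕₚ.m≤n⇒m≤1+n k≤m)))
... | inj₁ p∣C = p∣C
... | inj₂ p∣ with euclidsLemma (k !) ((suc m ℕ.∸ k) !) pp p∣
...   | inj₁ p∣k! = contradiction p∣k! (prime∤! pp k (s≤s k≤m))
...   | inj₂ p∣[p-k]! = contradiction p∣[p-k]! (prime∤! pp (suc m ℕ.∸ k) (ℕₚ.∸-monoʳ-< 0<k (ℕₚ.m≤n⇒m≤1+n k≤m)))

module PrimeModulus (p : ℕ) (pp : Prime p) where
  open Mod p public

  +∣⇒~0 : ∀ {n} → p ∣ n → + n ~ 0ℤ
  +∣⇒~0 (divides k refl) = mk~ (+ k) (≡.trans (ℤₚ.pos-* k p) (≡.trans (ℤₚ.*-comm (+ k) (+ p)) (≡.sym (ℤₚ.+-identityˡ _))))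

  ∣⇒~0 : ∀ {x} → p ∣ ∣ x ∣ → x ~ 0ℤ
  ∣⇒~0 {+ n} p∣n = +∣⇒~0 p∣n
  ∣⇒~0 { -[1+ n ] } p∣n = ~-neg (+∣⇒~0 p∣n)

  euclid : ∀ x y → x * y ~ 0ℤ → x ~ 0ℤ ⊎ y ~ 0ℤ
  euclid x y xy~0 with euclidsLemma ∣ x ∣ ∣ y ∣ pp (subst (p ∣_) (ℤₚ.abs-* x y) (~0⇒∣ xy~0))
  ... | inj₁ p∣x = inj₁ (∣⇒~0 p∣x)
  ... | inj₂ p∣y = inj₂ (∣⇒~0 p∣y)

  ~-linear : ∀ {L R l r} k → l ~ r → L + k * r ~ R + k * l → L ~ R
  ~-linear {L} {R} {l} {r} k (mk~ u l≡) (mk~ v eq) = mk~ (v + k * u) (begin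
    L                                        ≡⟨ lemma₁ L (k * r) ⟩
    L + k * r - k * r                        ≡⟨ cong (_- k * r) eq ⟩
    R + k * l + + p * v - k * r              ≡⟨ cong (λ z → R + k * z + + p * v - k * r) l≡ ⟩
    R + k * (r + + p * u) + + p * v - k * r  ≡⟨ lemma₂ R k r (+ p) u v ⟩
    R + + p * (v + k * u)                    ∎)
    where
    open ≡-Reasoning
    lemma₁ : ∀ L z → L ≡ L + z - z
    lemma₁ = solve-∀
    lemma₂ : ∀ R k r p u v → R + k * (r + p * u) + p * v - k * r ≡ R + p * (v + k * u)
    lemma₂ = solve-∀

  ~-^ : ∀ {x y} n → x ~ y → x ℤ.^ n ~ y ℤ.^ n
  ~-^ zero e = ~-refl
  ~-^ {x} {y} (suc n) e = ~-* {x} {y} {x ℤ.^ n} {y ℤ.^ n} e (~-^ n e)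

-- Induction on `a`: modulo p only the outer terms of the binomial expansion of (1 + a)^p survive.
fermat : ∀ p → (pp : Prime p) → let open Mod p in ∀ a → (+ a) ℤ.^ p ~ + a
fermat (suc m) pp = go
  where
  open PrimeModulus (suc m) pp
  step : ∀ a → a ℤ.^ suc m ~ a → (1ℤ + a) ℤ.^ suc m ~ 1ℤ + a
  step a a^p~a = ~-trans (~-reflexive (binomial a (suc m))) (~-+ {sumℕ m t} {1ℤ} {t (suc m)} {a} (middle m ℕₚ.≤-refl) last)
    where
    t : ℕ → ℤ
    t k = + (suc m C k) * a ℤ.^ k
    last : t (suc m) ~ a
    last = ~-trans (~-reflexive (≡.trans (cong (λ c → + c * a ℤ.^ suc m) (nCn≡1 (suc m))) (ℤₚ.*-identityˡ (a ℤ.^ suc m)))) a^p~a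
    middle : ∀ n → n ≤ m → sumℕ n t ~ 1ℤ
    middle zero _ = ~-reflexive (cong (λ c → + c * 1ℤ) (nC0≡1 (suc m)))
    middle (suc n) n<m = ~-+ {sumℕ n t} {1ℤ} {t (suc n)} {0ℤ} (middle n (ℕₚ.<⇒≤ n<m))
      (~-trans (~-* {+ (suc m C suc n)} {0ℤ} {a ℤ.^ suc n} {a ℤ.^ suc n} (+∣⇒~0 (prime∣C pp (suc n) (s≤s z≤n) n<m)) ~-refl)
        (~-reflexive (ℤₚ.*-zeroˡ (a ℤ.^ suc n))))
  go : ∀ a → (+ a) ℤ.^ suc m ~ + a
  go zero = ~-refl
  go (suc a) = step (+ a) (go a)

-- −3 is a non-residue modulo p: with a = x − y and b = 2y one has a² + ab + b² = x² + 3y²,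
-- so a³ ≡ b³, and cubing is injective because 3 ∤ p − 1.
module NonResidue (p : ℕ) (pp : Prime p) (k : ℕ) (p≡ : p ≡ 5 ℕ.+ 6 ℕ.* k) where
  open PrimeModulus p pp

  small : ∀ c → .{{ℕ.NonZero c}} → c < 5 → ¬ (+ c ~ 0ℤ)
  small c c<5 c~0 = ℕₚ.<⇒≱ (ℕₚ.<-≤-trans c<5 (subst (5 ≤_) (≡.sym p≡) (ℕₚ.m≤m+n 5 (6 ℕ.* k)))) (∣⇒≤ (~0⇒∣ c~0))

  square~0 : ∀ z → z * z ~ 0ℤ → z ~ 0ℤ
  square~0 z zz~0 with euclid z z zz~0
  ... | inj₁ z~0 = z~0
  ... | inj₂ z~0 = z~0

  -- The two power hypotheses are Fermat's theorem with p = 2 + 3e. From a³ ~ b³ they give ab² ~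
  -- a²b²(a³)^e ~ a²b²(b³)^e ~ a²b, hence ab(b - a) ~ 0. If a ~ 0 the norm is b², and if a ~ b it is
  -- 3b²; either way b ~ 0.
  norm~0 : ∀ e a b → a * a * (a * a * a) ℤ.^ e ~ a → b * b * (b * b * b) ℤ.^ e ~ b → a * a + a * b + b * b ~ 0ℤ → b ~ 0ℤ
  norm~0 e a b fermat-a fermat-b norm = cases (euclid a (b * (b - a)) product~0)
    where
    cubes : a * a * a ~ b * b * b
    cubes = ~-linear (a - b) norm (~-reflexive (lemma a b))
      where
      lemma : ∀ a b → a * a * a + (a - b) * 0ℤ ≡ b * b * b + (a - b) * (a * a + a * b + b * b)
      lemma = solve-∀

    product~0 : a * (b * (b - a)) ~ 0ℤ
    product~0 =
      ~-linear (- (b * b)) fermat-a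
      (~-linear (a * a * (b * b)) (~-^ e cubes)
      (~-linear (a * a) fermat-b
      (~-reflexive (lemma a b ((a * a * a) ℤ.^ e) ((b * b * b) ℤ.^ e)))))
      where
      lemma : ∀ a b c d → a * (b * (b - a)) + (- (b * b)) * a + a * a * (b * b) * d + a * a * b
        ≡ 0ℤ + (- (b * b)) * (a * a * c) + a * a * (b * b) * c + a * a * (b * b * d)
      lemma = solve-∀

    cases″ : + 3 ~ 0ℤ ⊎ b * b ~ 0ℤ → b ~ 0ℤ
    cases″ (inj₁ 3~0) = contradiction 3~0 (small 3 (s≤s (s≤s (s≤s (s≤s z≤n)))))
    cases″ (inj₂ bb~0) = square~0 b bb~0

    cases′ : b ~ 0ℤ ⊎ b - a ~ 0ℤ → b ~ 0ℤ
    cases′ (inj₁ b~0) = b~0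
    cases′ (inj₂ b-a~0) = cases″ (euclid (+ 3) (b * b) (~-linear 1ℤ norm (~-linear (+ 2 * b + a) b-a~0
        (~-reflexive (lemma a b)))))
      where
      lemma : ∀ a b → + 3 * (b * b) + 1ℤ * 0ℤ + (+ 2 * b + a) * 0ℤ ≡ 0ℤ + 1ℤ * (a * a + a * b + b * b) + (+ 2 * b + a) * (b - a)
      lemma = solve-∀

    cases : a ~ 0ℤ ⊎ b * (b - a) ~ 0ℤ → b ~ 0ℤ
    cases (inj₁ a~0) = square~0 b (~-linear 1ℤ norm (~-linear (- (a + b)) a~0 (~-reflexive (lemma a b))))
      where
      lemma : ∀ a b → b * b + 1ℤ * 0ℤ + (- (a + b)) * 0ℤ ≡ 0ℤ + 1ℤ * (a * a + a * b + b * b) + (- (a + b)) * a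
      lemma = solve-∀
    cases (inj₂ rest) = cases′ (euclid b (b - a) rest)

  fermat′ : ∀ n → + n * + n * (+ n * + n * + n) ℤ.^ (1 ℕ.+ 2 ℕ.* k) ~ + n
  fermat′ n = ~-trans (~-reflexive (≡.sym (≡.trans (cong ((+ n) ℤ.^_) (≡.trans p≡ (exponent k)))
      (power (+ n) (1 ℕ.+ 2 ℕ.* k))))) (fermat p pp n)
    where
    exponent : ∀ k → 5 ℕ.+ 6 ℕ.* k ≡ 2 ℕ.+ 3 ℕ.* (1 ℕ.+ 2 ℕ.* k)
    exponent = ℕ-solve-∀
    square≡ : ∀ z → z * (z * 1ℤ) ≡ z * z
    square≡ = solve-∀
    cube≡ : ∀ z → z * (z * (z * 1ℤ)) ≡ z * z * z
    cube≡ = solve-∀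
    power : ∀ z e → z ℤ.^ (2 ℕ.+ 3 ℕ.* e) ≡ z * z * (z * z * z) ℤ.^ e
    power z e = ≡.trans (ℤₚ.^-distribˡ-+-* z 2 (3 ℕ.* e)) (cong₂ _*_ (square≡ z) (≡.trans (≡.sym (ℤₚ.^-*-assoc z 3 e))
        (cong (ℤ._^ e) (cube≡ z))))

  ∣x²+3y²⇒∣y : ∀ x y → p ∣ x ℕ.* x ℕ.+ 3 ℕ.* (y ℕ.* y) → p ∣ y
  ∣x²+3y²⇒∣y x y p∣ = cases (euclid (+ 2) (+ y) (subst (_~ 0ℤ) (ℤₚ.pos-* 2 y)
    (norm~0 (1 ℕ.+ 2 ℕ.* k) (+ u) (+ (2 ℕ.* y)) (fermat′ u) (fermat′ (2 ℕ.* y)) norm)))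
    where
    -- Congruent to x - y modulo p, yet a natural number, as `fermat` requires.
    u : ℕ
    u = x ℕ.+ ℕ.pred p ℕ.* y

    cases : + 2 ~ 0ℤ ⊎ + y ~ 0ℤ → p ∣ y
    cases (inj₁ 2~0) = contradiction 2~0 (small 2 (s≤s (s≤s (s≤s z≤n))))
    cases (inj₂ y~0) = ~0⇒∣ y~0

    identity : ∀ x y r → (x ℕ.+ r ℕ.* y) ℕ.* (x ℕ.+ r ℕ.* y) ℕ.+ (x ℕ.+ r ℕ.* y) ℕ.* (2 ℕ.* y) ℕ.+ 2 ℕ.* y ℕ.* (2 ℕ.* y)
      ≡ x ℕ.* x ℕ.+ 3 ℕ.* (y ℕ.* y) ℕ.+ suc r ℕ.* (2 ℕ.* x ℕ.* y ℕ.+ y ℕ.* y ℕ.+ r ℕ.* (y ℕ.* y))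
    identity = ℕ-solve-∀

    p∣norm : p ∣ u ℕ.* u ℕ.+ u ℕ.* (2 ℕ.* y) ℕ.+ 2 ℕ.* y ℕ.* (2 ℕ.* y)
    p∣norm = subst (p ∣_) (≡.sym (identity x y (ℕ.pred p))) (∣m∣n⇒∣m+n p∣ (subst (λ z → p ∣ z ℕ.* c)
        (≡.sym (ℕₚ.suc-pred p {{prime⇒nonZero pp}})) (m∣m*n c)))
      where
      c : ℕ
      c = 2 ℕ.* x ℕ.* y ℕ.+ y ℕ.* y ℕ.+ ℕ.pred p ℕ.* (y ℕ.* y)

    cast : ∀ a b → + (a ℕ.* a ℕ.+ a ℕ.* b ℕ.+ b ℕ.* b) ≡ + a * + a + + a * + b + + b * + b
    cast a b = cong₂ _+_ (cong₂ _+_ (ℤₚ.pos-* a a) (ℤₚ.pos-* a b)) (ℤₚ.pos-* b b)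

    norm : + u * + u + + u * + (2 ℕ.* y) + + (2 ℕ.* y) * + (2 ℕ.* y) ~ 0ℤ
    norm = ~-trans (~-reflexive (≡.sym (cast u (2 ℕ.* y)))) (+∣⇒~0 p∣norm)

  ∣x²⇒∣x : ∀ x → p ∣ x ℕ.* x → p ∣ x
  ∣x²⇒∣x x p∣xx with euclidsLemma x x pp p∣xx
  ... | inj₁ p∣x = p∣x
  ... | inj₂ p∣x = p∣x

  ∣x²+3y²⇒∣x : ∀ x y → p ∣ x ℕ.* x ℕ.+ 3 ℕ.* (y ℕ.* y) → p ∣ x
  ∣x²+3y²⇒∣x x y p∣N = ∣x²⇒∣x x (∣m+n∣m⇒∣n (subst (p ∣_) (ℕₚ.+-comm (x ℕ.* x) _) p∣N)
    (∣-trans (∣x²+3y²⇒∣y x y p∣N) (∣-trans (m∣m*n y) (n∣m*n 3))))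

  -- Descent: p divides both x and y, so p² can be divided out of the equation, which lowers α by
  -- one. At α = 0 one factor p is left over on the left and would divide s.
  x²+3y²≢ : ∀ α s x y → p ∤ s → x ℕ.* x ℕ.+ 3 ℕ.* (y ℕ.* y) ≢ p ℕ.^ (2 ℕ.* α ℕ.+ 1) ℕ.* s
  x²+3y²≢ α s x y p∤s eq = descend α (∣x²+3y²⇒∣x x y p∣N) (∣x²+3y²⇒∣y x y p∣N) eq
    where
    instance
      _ = prime⇒nonZero pp
    p∣N : p ∣ x ℕ.* x ℕ.+ 3 ℕ.* (y ℕ.* y)
    p∣N = subst (p ∣_) (≡.sym (≡.trans eq (≡.trans (cong (λ e → p ℕ.^ e ℕ.* s) (ℕₚ.+-comm (2 ℕ.* α) 1)) (ℕₚ.*-assoc p _ s))))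
        (m∣m*n _)
    exponent : ∀ α → 2 ℕ.* suc α ℕ.+ 1 ≡ suc (suc (2 ℕ.* α ℕ.+ 1))
    exponent = ℕ-solve-∀
    assoc : ∀ p x s → p ℕ.* (p ℕ.* x) ℕ.* s ≡ p ℕ.* (p ℕ.* (x ℕ.* s))
    assoc = ℕ-solve-∀
    scale : ∀ x y p → x ℕ.* p ℕ.* (x ℕ.* p) ℕ.+ 3 ℕ.* (y ℕ.* p ℕ.* (y ℕ.* p)) ≡ p ℕ.* (p ℕ.* (x ℕ.* x ℕ.+ 3 ℕ.* (y ℕ.* y)))
    scale = ℕ-solve-∀
    cancel : ∀ x y E → x ℕ.* p ℕ.* (x ℕ.* p) ℕ.+ 3 ℕ.* (y ℕ.* p ℕ.* (y ℕ.* p)) ≡ p ℕ.* E → p ℕ.* (x ℕ.* x ℕ.+ 3 ℕ.* (y ℕ.* y))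
        ≡ E
    cancel x y E eq = ℕₚ.*-cancelˡ-≡ _ E p (≡.trans (≡.sym (scale x y p)) eq)
    descend : ∀ α → p ∣ x → p ∣ y → x ℕ.* x ℕ.+ 3 ℕ.* (y ℕ.* y) ≡ p ℕ.^ (2 ℕ.* α ℕ.+ 1) ℕ.* s → ⊥
    descend zero (divides x′ refl) (divides y′ refl) eq = p∤s
        (subst (p ∣_) (cancel x′ y′ s (≡.trans eq (cong (ℕ._* s) (ℕₚ.*-identityʳ p)))) (m∣m*n _))
    descend (suc α) (divides x′ refl) (divides y′ refl) eq = x²+3y²≢ α s x′ y′ p∤s (ℕₚ.*-cancelˡ-≡ _ _ p
      (cancel x′ y′ (p ℕ.* (p ℕ.^ (2 ℕ.* α ℕ.+ 1) ℕ.* s)) (≡.trans eq (≡.trans (cong (λ e → p ℕ.^ e ℕ.* s) (exponent α))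
          (assoc p (p ℕ.^ (2 ℕ.* α ℕ.+ 1)) s)))))

-- Vanishing coefficients and the final congruence

⊛-vanishes : ∀ a b n → (∀ i j → i ℕ.+ j ≡ n → a i ≡ 0ℤ ⊎ b j ≡ 0ℤ) → (a ⊛ b) n ≡ 0ℤ
⊛-vanishes a b zero zeros = annihilate (zeros 0 0 refl)
  where
  annihilate : a 0 ≡ 0ℤ ⊎ b 0 ≡ 0ℤ → a 0 * b 0 ≡ 0ℤ
  annihilate (inj₁ a≡0) rewrite a≡0 = refl
  annihilate (inj₂ b≡0) rewrite b≡0 = ℤₚ.*-zeroʳ (a 0)
⊛-vanishes a b (suc n) zeros = cong₂ _+_ (annihilate (zeros 0 (suc n) refl)) (⊛-vanishes (tail a) b n λ i j i+j≡n → zeros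
    (suc i) j (cong suc i+j≡n))
  where
  annihilate : a 0 ≡ 0ℤ ⊎ b (suc n) ≡ 0ℤ → a 0 * b (suc n) ≡ 0ℤ
  annihilate (inj₁ a≡0) rewrite a≡0 = refl
  annihilate (inj₂ b≡0) rewrite b≡0 = ℤₚ.*-zeroʳ (a 0)

q^-off : ∀ e n → e ≢ n → (q^ e) n ≡ 0ℤ
q^-off zero zero e≢n = contradiction refl e≢n
q^-off zero (suc n) e≢n = refl
q^-off (suc e) zero e≢n = refl
q^-off (suc e) (suc n) e≢n = q^-off e n λ { refl → e≢n refl }

-- Constructive form of "a nonzero sum has a nonzero term": `P` collects the evidence that such a
-- term provides.
sumℤ-zero-or : ∀ {P : Set} n {f} → (∀ x → f x ≡ 0ℤ ⊎ P) → sumℤ n f ≡ 0ℤ ⊎ P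
sumℤ-zero-or zero zeros = zeros 0ℤ
sumℤ-zero-or (suc n) zeros with sumℤ-zero-or n zeros | zeros +[1+ n ] | zeros -[1+ n ]
... | inj₂ p | _ | _ = inj₂ p
... | inj₁ _ | inj₂ p | _ = inj₂ p
... | inj₁ _ | inj₁ _ | inj₂ p = inj₂ p
... | inj₁ s≡0 | inj₁ x≡0 | inj₁ y≡0 rewrite s≡0 | x≡0 | y≡0 = inj₁ refl

theta-support : ∀ ε e n → theta ε e n ≡ 0ℤ ⊎ ∃ λ x → e x ≡ n
theta-support ε e n = sumℤ-zero-or n term
  where
  term : ∀ x → thetaTerm ε e x n ≡ 0ℤ ⊎ ∃ λ x → e x ≡ n
  term x with e x ℕ.≟ n
  ... | yes ex≡n = inj₂ (x , ex≡n)
  ... | no ex≢n = inj₁ (≡.trans (const-⊛ (ε x) (q^ (e x)) n) (≡.trans (cong (ε x *_) (q^-off (e x) n ex≢n)) (ℤₚ.*-zeroʳ (ε x))))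

φ₋φ₋-vanishes : ∀ n → (∀ x y → x ℕ.* x ℕ.+ 3 ℕ.* (y ℕ.* y) ≢ n) → (φ₋ 1 ⊛ φ₋ 3) n ≡ 0ℤ
φ₋φ₋-vanishes n unrepresented = ⊛-vanishes (φ₋ 1) (φ₋ 3) n zeros
  where
  zeros : ∀ i j → i ℕ.+ j ≡ n → φ₋ 1 i ≡ 0ℤ ⊎ φ₋ 3 j ≡ 0ℤ
  zeros i j i+j≡n with theta-support sgn (square 1) i | theta-support sgn (square 3) j
  ... | inj₁ φi≡0 | _ = inj₁ φi≡0
  ... | inj₂ _ | inj₁ φj≡0 = inj₂ φj≡0
  ... | inj₂ (x , refl) | inj₂ (y , refl) = contradiction
      (≡.trans (cong (ℕ._+ square 3 y) (≡.sym (ℕₚ.*-identityˡ (∣ x ∣ ℕ.* ∣ x ∣)))) i+j≡n) (unrepresented ∣ x ∣ ∣ y ∣)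

-- The index begins at 3 · 1 + 1, because the extracted series is ≡ 1 and its constant coefficient
-- does not vanish.
4∣RD49 : ∀ m → 4 ∣ RD49 (suc (suc m ℕ.* 3))
4∣RD49 m = Mod.~0⇒∣ 4 (Mod.at Modulo-4.third-RD (suc m))

3∣RD49 : ∀ m → (∀ x y → x ℕ.* x ℕ.+ 3 ℕ.* (y ℕ.* y) ≢ m) → 3 ∣ RD49 (suc (m ℕ.* 3))
3∣RD49 m unrepresented = Mod.~0⇒∣ 3 (Mod.~-trans 3 (Mod.at Modulo-3.third-RD m) (Mod.~-reflexive 3
    (φ₋φ₋-vanishes m unrepresented)))

12∣ : ∀ {n} → 4 ∣ n → 3 ∣ n → 12 ∣ n
12∣ 4∣n (divides k refl) with coprime-divisor {4} {3} {k} (from-yes (coprime? 4 3)) (subst (4 ∣_) (ℕₚ.*-comm k 3) 4∣n)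
... | divides l refl = divides l (ℕₚ.*-assoc l 4 3)

theorem5p1 : (p : ℕ) → Prime p → p % 6 ≡ 5 →
    (α n i : ℕ) → 1 ≤ i → i ≤ p ℕ.∸ 1 →
    12 ∣ RD49 (6 ℕ.* p ^ (2 ℕ.* α ℕ.+ 1) ℕ.* (p ℕ.* n ℕ.+ i) ℕ.+ 3 ℕ.* p ^ (2 ℕ.* α ℕ.+ 2) ℕ.+ 1)
theorem5p1 p pp p%6≡5 α n i 1≤i i≤p-1 = subst (λ k → 12 ∣ RD49 k) (≡.sym index)
  (12∣ (4∣ m m>0) (3∣RD49 m λ x y → x²+3y²≢ α s x y p∤s))
  where
  instance
    _ = prime⇒nonZero pp
  p≡ : p ≡ 5 ℕ.+ 6 ℕ.* (p ℕ./ 6)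
  p≡ = ≡.trans (m≡m%n+[m/n]*n p 6) (cong₂ ℕ._+_ p%6≡5 (ℕₚ.*-comm (p ℕ./ 6) 6))
  open NonResidue p pp (p ℕ./ 6) p≡
  -- With P = p^(2α+1) the index is 6P(pn + i) + 3pP + 1 = 3Ps + 1. Modulo p, s is 2i, which is
  -- nonzero as p is odd and 1 ≤ i < p.
  s m : ℕ
  s = 2 ℕ.* (p ℕ.* n ℕ.+ i) ℕ.+ p
  m = p ^ (2 ℕ.* α ℕ.+ 1) ℕ.* s
  p>2 : 2 < p
  p>2 = subst (2 <_) (≡.sym p≡) (s≤s (s≤s (s≤s z≤n)))
  p∤s : p ∤ s
  p∤s p∣s with euclidsLemma 2 (p ℕ.* n ℕ.+ i) pp (∣m+n∣m⇒∣n (subst (p ∣_) (ℕₚ.+-comm _ p) p∣s)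
      (divides 1 (≡.sym (ℕₚ.*-identityˡ p))))
  ... | inj₁ p∣2 = ℕₚ.<⇒≱ p>2 (∣⇒≤ p∣2)
  ... | inj₂ p∣pn+i = ℕₚ.<⇒≱ (ℕₚ.≤-<-trans i≤p-1 (ℕₚ.≤-reflexive (ℕₚ.suc-pred p))) (∣⇒≤ {{ℕ.>-nonZero 1≤i}}
      (∣m+n∣m⇒∣n p∣pn+i (m∣m*n n)))
  m>0 : 0 < m
  m>0 = ℕ.>-nonZero⁻¹ m {{ℕₚ.m*n≢0 _ s {{ℕₚ.m^n≢0 p (2 ℕ.* α ℕ.+ 1)}} {{ℕ.>-nonZero (ℕₚ.≤-trans (ℕ.>-nonZero⁻¹ p)
      (ℕₚ.m≤n+m p _))}}}}
  4∣ : ∀ m → 0 < m → 4 ∣ RD49 (suc (m ℕ.* 3))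
  4∣ (suc m) _ = 4∣RD49 m
  regroup : ∀ p P n i → 6 ℕ.* P ℕ.* (p ℕ.* n ℕ.+ i) ℕ.+ 3 ℕ.* (p ℕ.* P) ℕ.+ 1 ≡ suc (P ℕ.* (2 ℕ.* (p ℕ.* n ℕ.+ i) ℕ.+ p) ℕ.* 3)
  regroup = ℕ-solve-∀
  index : 6 ℕ.* p ^ (2 ℕ.* α ℕ.+ 1) ℕ.* (p ℕ.* n ℕ.+ i) ℕ.+ 3 ℕ.* p ^ (2 ℕ.* α ℕ.+ 2) ℕ.+ 1 ≡ suc (m ℕ.* 3)
  index = ≡.trans (cong (λ e → 6 ℕ.* p ^ (2 ℕ.* α ℕ.+ 1) ℕ.* (p ℕ.* n ℕ.+ i) ℕ.+ 3 ℕ.* p ^ e ℕ.+ 1) (ℕₚ.+-suc (2 ℕ.* α) 1))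
      (regroup p (p ^ (2 ℕ.* α ℕ.+ 1)) n i)
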